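{- Let $r\ge1$ and let $P_r^A=\Phi^+(A_r)$ be the standard positive-root poset of type $A_r$, graded by $\rho=$ root height minus one. Then $$\mathbb{H}_{P_r^A,\rho}(q,t)=\sum_{w\in\{L,R\}^{r-1}}q^{\sum_{j\in D(w)}(j-1)}\,t^{|D(w)|}.$$ In particular, this $q$-Zeta numerator is coefficientwise nonnegative for every $r\ge1$, and for $1\le k\le\lfloor r/2\rfloor$, $$[t^k]\,\mathbb{H}_{P_r^A,\rho}(q,t)=q^{k(k-1)}\sum_{h=k}^{r-k}\genfrac{[}{]}{0pt}{}{h-1}{k-1}_q\genfrac{[}{]}{0pt}{}{r-h}{k}_q.$$ The coefficients of $t^k$ vanish for $k>\lfloor r/2\rfloor$, while the constant coefficient is $1$. At $q=1$, $$\mathbb{H}_{P_r^A,\rho}(1,t)=\sum_{k=0}^{\lfloor r/2\rfloor}\binom{r}{2k}t^k=\frac{(1+\sqrt t)^r+(1-\sqrt t)^r}{2}.$$ For $r\ge2$, this last polynomial has exactly $\lfloor r/2\rfloor$ distinct negative real zeros.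
   Context: $q$-Zeta numerator: let $P$ be a finite graded poset with a unique maximum and rank function $\rho:P\to\{0,\dots,H\}$, where $H$ is the maximal rank. For $m\ge 0$ put $A_m(P,\rho;q)=\sum_{x_1\le\cdots\le x_m}q^{\rho(x_1)+\cdots+\rho(x_m)}$ (sum over weak chains in $P$; $A_0=1$). The numerator $\mathbb{H}_{P,\rho}(q,t)$ is the polynomial determined by $\sum_{m\ge 0}A_m(P,\rho;q)t^m=\mathbb{H}_{P,\rho}(q,t)/\prod_{a=0}^{H}(1-q^at)$. Type $A_r$: the positive roots are $e_i-e_{j+1}$, $1\le i\le j\le r$, with simple roots $e_i-e_{i+1}$, $1\le i\le r$. Order: $\alpha\le\beta$ iff $\beta-\alpha$ is a nonnegative integer combination of simple roots. Height is the sum of simple-root coefficients. For a word $w=w_1\cdots w_m$ in $\{L,R\}$, $D(w)=\{j: w_j=L\text{ and }(j=1\text{ or }w_{j-1}=R)\}$ (for $r=1$ the only word is empty). $\genfrac{[}{]}{0pt}{}{N}{k}_q$ is the Gaussian binomial coefficient, equal to $0$ unless $0\le k\le N$. -}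

module Defs where

open import Algebra.Bundles using (RawRing)
import Algebra.Definitions.RawSemiring as RawSemiringDefinitions
open import Data.Bool.Base using (if_then_else_)
open import Data.Fin.Base as Fin using (Fin; zero; suc; toℕ; fromℕ; fromℕ<; inject₁)
import Data.Fin.Properties as Fin
open import Data.Integer.Base as ℤ using (ℤ; +_; 0ℤ; 1ℤ)
import Data.Integer.Properties as ℤ
import Data.Integer.Solver as ℤSolver
open import Data.List.Base as List
  using (List; []; _∷_; map; foldr; filter; length; upTo; allFin; cartesianProduct; cartesianProductWith; mapMaybe)
open import Data.List.Membership.Propositional using (_∈_)
open import Data.List.Membership.Propositional.Properties using (∈-allFin; ∈-cartesianProduct⁺)
open import Data.List.Relation.Unary.All using (All; []; _∷_)
open import Data.List.Relation.Unary.AllPairs using ([]; _∷_)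
open import Data.List.Relation.Unary.Any using (here; there)
open import Data.List.Relation.Unary.Unique.Propositional using (Unique)
import Data.List.Relation.Unary.Unique.Propositional.Properties as Unique
open import Data.Maybe.Base using (Maybe; just; nothing)
open import Data.Nat.Base as ℕ using (ℕ; zero; suc; _∸_; NonZero; z≤n; s≤s; ⌊_/2⌋)
open import Data.Nat.Combinatorics using (_C_)
import Data.Nat.ListAction as ℕ
import Data.Nat.Properties as ℕ
open import Data.Product.Base using (Σ-syntax; ∃; ∃-syntax; _×_; _,_; proj₁; proj₂)
open import Data.Rational.Base as ℚ using (ℚ; 0ℚ; 1ℚ; ½)
import Data.Rational.Properties as ℚ
import Data.Rational.Solver as ℚSolver
open import Data.Sum.Base using (_⊎_; inj₁; inj₂)
open import Data.Vec.Base as Vec using (Vec; []; _∷_; lookup)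
import Data.Vec.Relation.Unary.Linked as Linked
open import Function.Base using (_∘_)
open import Level using (0ℓ)
open import Relation.Binary.Core using (Rel)
open import Relation.Binary.Definitions using (Maximum)
open import Relation.Binary.Structures using (IsDecPartialOrder)
open import Relation.Binary.PropositionalEquality
  using (_≡_; _≢_; refl; sym; trans; cong; cong₂; subst; subst₂; isEquivalence; module ≡-Reasoning)
open import Relation.Nullary using (¬_; Dec; yes; no; does; contradiction)
open import Relation.Nullary.Decidable using (map′; _×-dec_; _⊎-dec_)

module Ring (R : RawRing 0ℓ 0ℓ) where
  open RawRing R
  open RawSemiringDefinitions rawSemiring public using (_^_)

  ∑ ∏ : ∀ {A : Set} → List A → (A → Carrier) → Carrier
  ∑ xs f = foldr _+_ 0# (map f xs)
  ∏ xs f = foldr _*_ 1# (map f xs)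

  -- Coefficient lists, constant term first.  Trailing zeros are allowed,
  -- so polynomials are compared by _≈ₚ_ and never by _≡_.
  Poly : Set
  Poly = List Carrier

  coeff : Poly → ℕ → Carrier
  coeff []      _       = 0#
  coeff (a ∷ p) zero    = a
  coeff (a ∷ p) (suc n) = coeff p n

  infix 4 _≈ₚ_
  _≈ₚ_ : Rel Poly 0ℓ
  p ≈ₚ p′ = ∀ n → coeff p n ≈ coeff p′ n

  constant : Carrier → Poly
  constant a = a ∷ []

  X : Poly
  X = 0# ∷ 1# ∷ []

  infixl 6 _+ₚ_
  infixl 7 _*ₚ_

  _+ₚ_ : Poly → Poly → Poly
  []      +ₚ p′       = p′
  (a ∷ p) +ₚ []       = a ∷ p
  (a ∷ p) +ₚ (b ∷ p′) = (a + b) ∷ (p +ₚ p′)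

  _*ₚ_ : Poly → Poly → Poly
  []      *ₚ p′ = []
  (a ∷ p) *ₚ p′ = map (a *_) p′ +ₚ (0# ∷ p *ₚ p′)

  polynomials : RawRing 0ℓ 0ℓ
  polynomials = record
    { Carrier = Poly
    ; _≈_     = _≈ₚ_
    ; _+_     = _+ₚ_
    ; _*_     = _*ₚ_
    ; -_      = map (-_)
    ; 0#      = []
    ; 1#      = constant 1#
    }

  eval : Poly → Carrier → Carrier
  eval []      x = 0#
  eval (a ∷ p) x = a + x * eval p x

  Series : Set
  Series = ℕ → Carrier

  infixl 7 _⊛_
  _⊛_ : Series → Series → Series
  (f ⊛ g) n = ∑ (upTo (suc n)) (λ i → f i * g (n ∸ i))

ℤ-ring ℤ[x] ℤ[q][t] : RawRing 0ℓ 0ℓ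
ℤ-ring  = ℤ.+-*-rawRing
ℤ[x]    = Ring.polynomials ℤ-ring
ℤ[q][t] = Ring.polynomials ℤ[x]

-- One-variable polynomials over ℤ; the variable is q, t or √t according
-- to context.
Poly₁ Poly₂ : Set
Poly₁ = RawRing.Carrier ℤ[x]
Poly₂ = RawRing.Carrier ℤ[q][t]

infix 4 _≈₁_ _≈₂_
_≈₁_ : Rel Poly₁ 0ℓ
_≈₁_ = RawRing._≈_ ℤ[x]

_≈₂_ : Rel Poly₂ 0ℓ
_≈₂_ = RawRing._≈_ ℤ[q][t]

infixl 7 _·₁_
_·₁_ : Poly₁ → Poly₁ → Poly₁
_·₁_ = RawRing._*_ ℤ[x]

q : Poly₁
q = Ring.X ℤ-ring

q^_ : ℕ → Poly₁
q^ n = q ^ n where open Ring ℤ[x]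

t^ : ℕ → Poly₂
t^ n = Ring.X ℤ[x] ^ n where open Ring ℤ[q][t]

[t^_] : ℕ → Poly₂ → Poly₁
[t^ k ] p = Ring.coeff ℤ[x] p k

-- Both endpoints included.
range : ℕ → ℕ → List ℕ
range a b = map (a ℕ.+_) (upTo (suc b ∸ a))

-- The recursion [n+1 k+1] = [n k] + q^(k+1) [n k+1]; it gives 0 when k > n.
gaussian : ℕ → ℕ → Poly₁
gaussian _       zero    = RawRing.1# ℤ[x]
gaussian zero    (suc k) = RawRing.0# ℤ[x]
gaussian (suc n) (suc k) = gaussian n k + q^ (suc k) * gaussian n (suc k)
  where open RawRing ℤ[x]

CoefficientwiseNonnegative : Poly₂ → Set
CoefficientwiseNonnegative p = ∀ k n → 0ℤ ℤ.≤ Ring.coeff ℤ-ring ([t^ k ] p) n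

-- p(1,t)
at-q≡1 : Poly₂ → Poly₁
at-q≡1 = map (λ c → Ring.eval ℤ-ring c 1ℤ)

-- p(s²) as a polynomial in s
substitute-square : Poly₁ → Poly₁
substitute-square p = eval (map (Ring.constant ℤ-ring) p) (X ^ 2)
  where open Ring ℤ[x] using (eval; _^_)
        open Ring ℤ-ring using (X)

tuples : ∀ {A : Set} → List A → ∀ m → List (Vec A m)
tuples xs zero    = [] ∷ []
tuples xs (suc m) = cartesianProductWith _∷_ xs (tuples xs m)

record FiniteGradedPoset : Set₁ where
  infix 4 _≤_ _⋖_
  field
    Carrier           : Set
    _≤_               : Rel Carrier 0ℓ
    isDecPartialOrder : IsDecPartialOrder _≡_ _≤_
    elements          : List Carrier
    elements-complete : ∀ x → x ∈ elements
    elements-unique   : Unique elements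

  _⋖_ : Rel Carrier 0ℓ
  x ⋖ y = x ≤ y × x ≢ y × (∀ z → x ≤ z → z ≤ y → z ≡ x ⊎ z ≡ y)

  field
    ⊤                 : Carrier
    ⊤-maximum         : Maximum _≤_ ⊤
    ρ                 : Carrier → ℕ
    ρ-minimal         : ∀ x → (∀ y → y ≤ x → y ≡ x) → ρ x ≡ 0
    ρ-cover           : ∀ {x y} → x ⋖ y → ρ y ≡ suc (ρ x)

  open IsDecPartialOrder isDecPartialOrder public using (_≤?_)

  H : ℕ
  H = ρ ⊤

  weakChains : ∀ m → List (Vec Carrier m)
  weakChains m = filter (Linked.linked? _≤?_) (tuples elements m)

module _ (P : FiniteGradedPoset) where
  open FiniteGradedPoset P

  chainSeries : Ring.Series ℤ[x]
  chainSeries m = ∑ (weakChains m) (λ x → q^ (Vec.sum (Vec.map ρ x)))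
    where open Ring ℤ[x]

  denominator : Poly₂
  denominator = ∏ (range 0 H) (λ a → 1# + - (constant (q^ a) * t^ 1))
    where open RawRing ℤ[q][t] using (1#; -_; _+_; _*_)
          open Ring ℤ[q][t] using (∏)
          open Ring ℤ[x] using (constant)

  -- The denominator has constant term 1, so multiplying the generating
  -- function by it says the same as dividing the numerator by it.
  IsNumerator : Poly₂ → Set
  IsNumerator ℍ = ∀ n → (chainSeries ⊛ coeff denominator) n ≈₁ coeff ℍ n
    where open Ring ℤ[x]

∑ℤ : ∀ {n} → (Fin n → ℤ) → ℤ
∑ℤ = sum where open RawSemiringDefinitions ℤ.+-*-rawSemiring

∑ℕ : ∀ {n} → (Fin n → ℕ) → ℕ
∑ℕ = sum where open RawSemiringDefinitions ℕ.+-*-rawSemiring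

e : ∀ {n} → Fin n → Fin n → ℤ
e i k = if does (i Fin.≟ k) then 1ℤ else 0ℤ

simple : ∀ {r} → Fin r → Fin (suc r) → ℤ
simple i k = e (inject₁ i) k ℤ.- e (suc i) k

combination : ∀ {r} → (Fin r → ℤ) → Fin (suc r) → ℤ
combination c k = ∑ℤ (λ i → c i ℤ.* simple i k)

record PosRoot (r : ℕ) : Set where
  constructor root
  field
    i j : Fin r
    i≤j : i Fin.≤ j

-- Indices are 0-based: the vector of  root i j _  is  e_i − e_{j+1}.
⟦_⟧ : ∀ {r} → PosRoot r → Fin (suc r) → ℤ
⟦ root i j _ ⟧ k = e (inject₁ i) k ℤ.- e (suc j) k

infix 4 _⊑_
_⊑_ : ∀ {r} → Rel (PosRoot r) 0ℓ
_⊑_ {r} α β = Σ[ c ∈ (Fin r → ℕ) ] ∀ k → ⟦ β ⟧ k ℤ.- ⟦ α ⟧ k ≡ combination (+_ ∘ c) k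

simpleCoeff : ∀ {r} → PosRoot r → Fin r → ℕ
simpleCoeff (root i j _) k = if does (i Fin.≤? k ×-dec k Fin.≤? j) then 1 else 0

height : ∀ {r} → PosRoot r → ℕ
height α = ∑ℕ (simpleCoeff α)

∑ℤ-zero : ∀ n (f : Fin n → ℤ) → (∀ i → f i ≡ 0ℤ) → ∑ℤ f ≡ 0ℤ
∑ℤ-zero zero    f f≡0 = refl
∑ℤ-zero (suc n) f f≡0 = cong₂ ℤ._+_ (f≡0 zero) (∑ℤ-zero n (f ∘ suc) (f≡0 ∘ suc))

combination-cong : ∀ {r} {c d : Fin r → ℤ} → (∀ i → c i ≡ d i) → ∀ k → combination c k ≡ combination d k
combination-cong {zero}  eq k = refl
combination-cong {suc r} {c} {d} eq k = go (suc r) (λ i → cong (ℤ._* simple i k) (eq i))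
  where
  go : ∀ n {f g : Fin n → ℤ} → (∀ i → f i ≡ g i) → ∑ℤ f ≡ ∑ℤ g
  go zero    eq = refl
  go (suc n) eq = cong₂ ℤ._+_ (eq zero) (go n (eq ∘ suc))

combination-minus : ∀ {r} (c d : Fin r → ℤ) k →
  combination (λ i → c i ℤ.- d i) k ≡ combination c k ℤ.- combination d k
combination-minus {r} c d k = go r c d (λ i → simple i k)
  where
  open ℤSolver.+-*-Solver using (solve; con; _:=_; _:+_; _:-_; _:*_)
  go : ∀ n (c d s : Fin n → ℤ) →
    ∑ℤ (λ i → (c i ℤ.- d i) ℤ.* s i) ≡ ∑ℤ (λ i → c i ℤ.* s i) ℤ.- ∑ℤ (λ i → d i ℤ.* s i)
  go zero    c d s = refl
  go (suc n) c d s = trans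
    (cong (λ u → (c zero ℤ.- d zero) ℤ.* s zero ℤ.+ u) (go n (c ∘ suc) (d ∘ suc) (s ∘ suc)))
    (solve 5 (λ a b x u v → (a :- b) :* x :+ (u :- v) := (a :* x :+ u) :- (b :* x :+ v)) refl
      (c zero) (d zero) (s zero) _ _)

combination-zero : ∀ {r} (c : Fin (suc r) → ℤ) → combination c zero ≡ c zero
combination-zero {r} c = trans
  (cong₂ ℤ._+_ (ℤ.*-identityʳ (c zero)) (∑ℤ-zero r _ (λ i → ℤ.*-zeroʳ (c (suc i)))))
  (ℤ.+-identityʳ (c zero))

combination-suc : ∀ {r} (c : Fin (suc r) → ℤ) m →
  combination c (suc m) ≡ combination (c ∘ suc) m ℤ.- c zero ℤ.* e zero m
combination-suc c m =
  solve 3 (λ a x u → a :* (con 0ℤ :- x) :+ u := u :- a :* x) refl (c zero) (e zero m) (combination (c ∘ suc) m)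
  where open ℤSolver.+-*-Solver using (solve; con; _:=_; _:+_; _:-_; _:*_)

-- Simple roots are linearly independent.
combination-injective : ∀ {r} (c : Fin r → ℤ) → (∀ k → combination c k ≡ 0ℤ) → ∀ i → c i ≡ 0ℤ
combination-injective {suc r} c eq zero    = trans (sym (combination-zero c)) (eq zero)
combination-injective {suc r} c eq (suc i) = combination-injective (c ∘ suc) tail-eq i
  where
  open ≡-Reasoning
  c₀≡0 : c zero ≡ 0ℤ
  c₀≡0 = combination-injective c eq zero
  tail-eq : ∀ k → combination (c ∘ suc) k ≡ 0ℤ
  tail-eq k = begin
    combination (c ∘ suc) k                          ≡⟨ sym (ℤ.+-identityʳ _) ⟩
    combination (c ∘ suc) k ℤ.- 0ℤ ℤ.* e zero k      ≡⟨ cong (λ a → combination (c ∘ suc) k ℤ.- a ℤ.* e zero k) (sym c₀≡0) ⟩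
    combination (c ∘ suc) k ℤ.- c zero ℤ.* e zero k  ≡⟨ sym (combination-suc c k) ⟩
    combination c (suc k)                            ≡⟨ eq (suc k) ⟩
    0ℤ                                               ∎

private
  χ : ∀ {r} → Fin r → Fin r → Fin r → ℕ
  χ i j k = if does (i Fin.≤? k ×-dec k Fin.≤? j) then 1 else 0

  χ-zero-suc : ∀ {r} (j k : Fin (suc r)) → χ zero (suc j) (suc k) ≡ χ zero j k
  χ-zero-suc j zero    = refl
  χ-zero-suc j (suc k) = refl

  χ-suc-suc : ∀ {r} (i j k : Fin r) → χ (suc i) (suc j) (suc k) ≡ χ i j k
  χ-suc-suc zero    j zero    = refl
  χ-suc-suc zero    j (suc k) = refl
  χ-suc-suc (suc i) j zero    = refl
  χ-suc-suc (suc i) j (suc k) = refl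

  χ-decomposition : ∀ {r} (i j : Fin r) → i Fin.≤ j → ∀ k →
    e (inject₁ i) k ℤ.- e (suc j) k ≡ combination (+_ ∘ χ i j) k
  χ-decomposition i@zero    j           _   zero    = sym (combination-zero (+_ ∘ χ i j))
  χ-decomposition i@(suc _) j@(suc _)   _   zero    = sym (combination-zero (+_ ∘ χ i j))
  χ-decomposition {suc r} zero zero     _   (suc m) = sym (trans
    (combination-suc (+_ ∘ χ {suc r} zero zero) m)
    (cong₂ ℤ._-_ (∑ℤ-zero r _ (λ i → ℤ.*-zeroˡ (simple i m))) (ℤ.*-identityˡ (e zero m))))
  χ-decomposition {suc (suc r)} zero (suc j) _ (suc m) = sym (trans
    (combination-suc (+_ ∘ χ {suc (suc r)} zero (suc j)) m)
    (trans
      (cong₂ ℤ._-_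
        (trans (combination-cong (λ k → cong +_ (χ-zero-suc j k)) m)
          (sym (χ-decomposition {suc r} zero j z≤n m)))
        (ℤ.*-identityˡ (e zero m)))
      (solve 2 (λ x y → (x :- y) :- x := con 0ℤ :- y) refl (e zero m) (e (suc j) m))))
    where open ℤSolver.+-*-Solver using (solve; con; _:=_; _:+_; _:-_; _:*_)
  χ-decomposition (suc i) (suc j) (s≤s i≤j) (suc m) = sym (trans
    (combination-suc (+_ ∘ χ (suc i) (suc j)) m)
    (trans
      (cong₂ ℤ._-_
        (trans (combination-cong (λ k → cong +_ (χ-suc-suc i j k)) m)
          (sym (χ-decomposition i j i≤j m)))
        (ℤ.*-zeroˡ (e zero m)))
      (ℤ.+-identityʳ _)))

  ∑ℕ-cong : ∀ n {f g : Fin n → ℕ} → (∀ i → f i ≡ g i) → ∑ℕ f ≡ ∑ℕ g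
  ∑ℕ-cong zero    eq = refl
  ∑ℕ-cong (suc n) eq = cong₂ ℕ._+_ (eq zero) (∑ℕ-cong n (eq ∘ suc))

  ∑ℕ-zero : ∀ n → ∑ℕ {n} (λ _ → 0) ≡ 0
  ∑ℕ-zero zero    = refl
  ∑ℕ-zero (suc n) = ∑ℕ-zero n

  χ-sum : ∀ {r} (i j : Fin r) → i Fin.≤ j → ∑ℕ (χ i j) ≡ suc (toℕ j ∸ toℕ i)
  χ-sum {suc r}       zero    zero    _         = cong suc (∑ℕ-zero r)
  χ-sum {suc (suc r)} zero    (suc j) _         =
    cong suc (trans (∑ℕ-cong (suc r) (χ-zero-suc j)) (χ-sum {suc r} zero j z≤n))
  χ-sum {suc r}       (suc i) (suc j) (s≤s i≤j) =
    trans (∑ℕ-cong r (χ-suc-suc i j)) (χ-sum i j i≤j)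

  module Indicator {P : Set} where
    ≤1 : (d : Dec P) → (if does d then 1 else 0) ℕ.≤ 1
    ≤1 (yes _) = s≤s z≤n
    ≤1 (no  _) = z≤n

    ≡1 : (d : Dec P) → P → (if does d then 1 else 0) ≡ 1
    ≡1 (yes _) p = refl
    ≡1 (no ¬p) p = contradiction p ¬p

    ≥1⁻ : (d : Dec P) → 1 ℕ.≤ (if does d then 1 else 0) → P
    ≥1⁻ (yes p) _ = p
    ≥1⁻ (no _) ()

  χ≤1 : ∀ {r} (i j k : Fin r) → χ i j k ℕ.≤ 1
  χ≤1 i j k = Indicator.≤1 (i Fin.≤? k ×-dec k Fin.≤? j)

  χ-inside : ∀ {r} {i j k : Fin r} → i Fin.≤ k → k Fin.≤ j → χ i j k ≡ 1
  χ-inside {i = i} {j} {k} i≤k k≤j = Indicator.≡1 (i Fin.≤? k ×-dec k Fin.≤? j) (i≤k , k≤j)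

  χ-inside⁻ : ∀ {r} {i j k : Fin r} → 1 ℕ.≤ χ i j k → i Fin.≤ k × k Fin.≤ j
  χ-inside⁻ {i = i} {j} {k} = Indicator.≥1⁻ (i Fin.≤? k ×-dec k Fin.≤? j)

-- simpleCoeff α really lists the coefficients of α in the simple roots.
decomposition : ∀ {r} (α : PosRoot r) k → ⟦ α ⟧ k ≡ combination (+_ ∘ simpleCoeff α) k
decomposition (root i j i≤j) = χ-decomposition i j i≤j

height-formula : ∀ {r} (α : PosRoot r) → height α ≡ suc (toℕ (PosRoot.j α) ∸ toℕ (PosRoot.i α))
height-formula (root i j i≤j) = χ-sum i j i≤j

infix 4 _⊆_
_⊆_ : ∀ {r} → Rel (PosRoot r) 0ℓ
root i j _ ⊆ root i′ j′ _ = i′ Fin.≤ i × j Fin.≤ j′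

⊑⇒⊆ : ∀ {r} (α β : PosRoot r) → α ⊑ β → α ⊆ β
⊑⇒⊆ {r} α@(root i j i≤j) β@(root i′ j′ i′≤j′) (c , eq) =
  proj₁ (at i ℕ.≤-refl i≤j) , proj₂ (at j i≤j ℕ.≤-refl)
  where
  open ℤSolver.+-*-Solver using (solve; con; _:=_; _:+_; _:-_; _:*_)
  a b : Fin r → ℤ
  a = +_ ∘ simpleCoeff α
  b = +_ ∘ simpleCoeff β
  difference : ∀ k → combination (λ l → (b l ℤ.- a l) ℤ.- + c l) k ≡ 0ℤ
  difference k = trans (combination-minus (λ l → b l ℤ.- a l) (+_ ∘ c) k)
    (trans (cong₂ ℤ._-_
        (trans (combination-minus b a k) (sym (cong₂ ℤ._-_ (decomposition β k) (decomposition α k))))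
        (sym (eq k)))
      (ℤ.+-inverseʳ (⟦ β ⟧ k ℤ.- ⟦ α ⟧ k)))
  b≡a+c : ∀ k → simpleCoeff β k ≡ simpleCoeff α k ℕ.+ c k
  b≡a+c k = ℤ.+-injective (trans
    (solve 3 (λ x y z → y := ((y :- x) :- z) :+ (x :+ z)) refl (a k) (b k) (+ c k))
    (trans (cong (ℤ._+ (a k ℤ.+ + c k)) (combination-injective (λ l → (b l ℤ.- a l) ℤ.- + c l) difference k))
      (ℤ.+-identityˡ (a k ℤ.+ + c k))))
  at : ∀ k → i Fin.≤ k → k Fin.≤ j → i′ Fin.≤ k × k Fin.≤ j′
  at k i≤k k≤j = χ-inside⁻ (subst (1 ℕ.≤_) (sym (b≡a+c k))
    (ℕ.≤-trans (ℕ.≤-reflexive (sym (χ-inside i≤k k≤j))) (ℕ.m≤m+n (simpleCoeff α k) (c k))))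

⊆⇒⊑ : ∀ {r} (α β : PosRoot r) → α ⊆ β → α ⊑ β
⊆⇒⊑ {r} α@(root i j i≤j) β@(root i′ j′ i′≤j′) (i′≤i , j≤j′) = c , λ k →
  trans (cong₂ ℤ._-_ (decomposition β k) (decomposition α k))
    (trans (sym (combination-minus (+_ ∘ simpleCoeff β) (+_ ∘ simpleCoeff α) k))
      (combination-cong (λ l → sym (c≡b-a l)) k))
  where
  c : Fin r → ℕ
  c k = simpleCoeff β k ∸ simpleCoeff α k
  a≤b : ∀ k → simpleCoeff α k ℕ.≤ simpleCoeff β k
  a≤b k with simpleCoeff α k in eq
  ... | zero  = z≤n
  ... | suc n with i≤k , k≤j ← χ-inside⁻ {i = i} {j} {k} (subst (1 ℕ.≤_) (sym eq) (s≤s z≤n)) =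
    ℕ.≤-trans (ℕ.≤-trans (ℕ.≤-reflexive (sym eq)) (χ≤1 i j k))
      (ℕ.≤-reflexive (sym (χ-inside (ℕ.≤-trans i′≤i i≤k) (ℕ.≤-trans k≤j j≤j′))))
  c≡b-a : ∀ k → + c k ≡ + simpleCoeff β k ℤ.- + simpleCoeff α k
  c≡b-a k = trans (sym (ℤ.⊖-≥ (a≤b k))) (sym (ℤ.m-n≡m⊖n (simpleCoeff β k) (simpleCoeff α k)))

root-≡ : ∀ {r} {i i′ j j′ : Fin r} {p : i Fin.≤ j} {p′ : i′ Fin.≤ j′} →
  i ≡ i′ → j ≡ j′ → root i j p ≡ root i′ j′ p′
root-≡ refl refl = cong (root _ _) (ℕ.≤-irrelevant _ _)

⊑-isDecPartialOrder : ∀ r → IsDecPartialOrder _≡_ (_⊑_ {r})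
⊑-isDecPartialOrder r = record
  { isPartialOrder = record
    { isPreorder = record
      { isEquivalence = isEquivalence
      ; reflexive     = λ { {α} refl → ⊆⇒⊑ α α (ℕ.≤-refl , ℕ.≤-refl) }
      ; trans         = λ {α} {β} {γ} α⊑β β⊑γ →
          ⊆⇒⊑ α γ (⊆-trans α β γ (⊑⇒⊆ α β α⊑β) (⊑⇒⊆ β γ β⊑γ))
      }
    ; antisym = λ {α} {β} α⊑β β⊑α → ⊆-antisym α β (⊑⇒⊆ α β α⊑β) (⊑⇒⊆ β α β⊑α)
    }
  ; _≟_  = λ { (root i j _) (root i′ j′ _) →
      map′ (λ { (p , q) → root-≡ p q }) (λ { refl → refl , refl }) (i Fin.≟ i′ ×-dec j Fin.≟ j′) }
  ; _≤?_ = λ { α@(root i j _) β@(root i′ j′ _) →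
      map′ (⊆⇒⊑ α β) (⊑⇒⊆ α β) (i′ Fin.≤? i ×-dec j Fin.≤? j′) }
  }
  where
  ⊆-trans : (α β γ : PosRoot r) → α ⊆ β → β ⊆ γ → α ⊆ γ
  ⊆-trans _ _ _ (a , b) (c , d) = ℕ.≤-trans c a , ℕ.≤-trans b d
  ⊆-antisym : (α β : PosRoot r) → α ⊆ β → β ⊆ α → α ≡ β
  ⊆-antisym _ _ (a , b) (c , d) = root-≡ (Fin.≤-antisym c a) (Fin.≤-antisym b d)

private
  toRoot : ∀ {r} → Fin r × Fin r → Maybe (PosRoot r)
  toRoot (i , j) with i Fin.≤? j
  ... | yes i≤j = just (root i j i≤j)
  ... | no  _   = nothing

  toRoot-root : ∀ {r} (α : PosRoot r) → toRoot (PosRoot.i α , PosRoot.j α) ≡ just α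
  toRoot-root (root i j i≤j) with i Fin.≤? j
  ... | yes p = cong (λ h → just (root i j h)) (ℕ.≤-irrelevant p i≤j)
  ... | no ¬p = contradiction i≤j ¬p

  toRoot⁻ : ∀ {r} (x : Fin r × Fin r) {α} → toRoot x ≡ just α → x ≡ (PosRoot.i α , PosRoot.j α)
  toRoot⁻ (i , j) eq with i Fin.≤? j
  toRoot⁻ (i , j) refl | yes _ = refl

  module _ {A B : Set} (f : A → Maybe B) where
    mapMaybe-complete : ∀ {x y xs} → x ∈ xs → f x ≡ just y → y ∈ mapMaybe f xs
    mapMaybe-complete {xs = x ∷ xs} (here refl) eq rewrite eq = here refl
    mapMaybe-complete {xs = x ∷ xs} (there x∈)  eq with f x
    ... | just _  = there (mapMaybe-complete x∈ eq)
    ... | nothing = mapMaybe-complete x∈ eq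

    module _ (injective : ∀ {x x′ y} → f x ≡ just y → f x′ ≡ just y → x ≡ x′) where
      mapMaybe-fresh : ∀ {x y xs} → f x ≡ just y → All (x ≢_) xs → All (y ≢_) (mapMaybe f xs)
      mapMaybe-fresh eq [] = []
      mapMaybe-fresh {xs = x′ ∷ xs} eq (x≢x′ ∷ fresh) with f x′ in eq′
      ... | nothing = mapMaybe-fresh eq fresh
      ... | just y′ = (λ { refl → x≢x′ (injective eq eq′) }) ∷ mapMaybe-fresh eq fresh

      mapMaybe-unique : ∀ {xs} → Unique xs → Unique (mapMaybe f xs)
      mapMaybe-unique {[]} [] = []
      mapMaybe-unique {x ∷ xs} (fresh ∷ unique) with f x in eq
      ... | nothing = mapMaybe-unique unique
      ... | just y  = mapMaybe-fresh eq fresh ∷ mapMaybe-unique unique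

posRoots : ∀ r → List (PosRoot r)
posRoots r = mapMaybe toRoot (cartesianProduct (allFin r) (allFin r))

posRoots-complete : ∀ {r} (α : PosRoot r) → α ∈ posRoots r
posRoots-complete α =
  mapMaybe-complete toRoot (∈-cartesianProduct⁺ (∈-allFin (PosRoot.i α)) (∈-allFin (PosRoot.j α))) (toRoot-root α)

posRoots-unique : ∀ r → Unique (posRoots r)
posRoots-unique r = mapMaybe-unique toRoot
  (λ {x} {x′} eq eq′ → trans (toRoot⁻ x eq) (sym (toRoot⁻ x′ eq′)))
  (Unique.cartesianProduct⁺ (Unique.allFin⁺ r) (Unique.allFin⁺ r))

private
  fin : ∀ {r} m (k : Fin r) → m ℕ.≤ toℕ k → Σ[ l ∈ Fin r ] toℕ l ≡ m
  fin m k m≤k = fromℕ< m<r , Fin.toℕ-fromℕ< m<r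
    where m<r = ℕ.≤-<-trans m≤k (Fin.toℕ<n k)

height-minimal : ∀ {r} (α : PosRoot r) → (∀ β → β ⊑ α → β ≡ α) → height α ∸ 1 ≡ 0
height-minimal α@(root i j i≤j) minimal = trans (cong (_∸ 1) (height-formula α))
  (ℕ.m≤n⇒m∸n≡0 (ℕ.≤-reflexive (cong (toℕ ∘ PosRoot.j)
    (sym (minimal (root i i ℕ.≤-refl) (⊆⇒⊑ (root i i ℕ.≤-refl) α (ℕ.≤-refl , i≤j)))))))

height-cover : ∀ {r} (α β : PosRoot r) → α ⊑ β → α ≢ β →
  (∀ γ → α ⊑ γ → γ ⊑ β → γ ≡ α ⊎ γ ≡ β) → height β ∸ 1 ≡ suc (height α ∸ 1)
height-cover {r} α@(root i j i≤j) β@(root i′ j′ i′≤j′) α⊑β α≢β between =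
  trans (cong (_∸ 1) (height-formula β))
    (trans difference (sym (cong (λ h → suc (h ∸ 1)) (height-formula α))))
  where
  i′≤i = proj₁ (⊑⇒⊆ α β α⊑β)
  j≤j′ = proj₂ (⊑⇒⊆ α β α⊑β)

  extend-left : ∀ m → toℕ i ≡ suc m → toℕ i′ ℕ.≤ m → toℕ j′ ∸ toℕ i′ ≡ suc (toℕ j ∸ toℕ i)
  extend-left m i≡ i′≤m = shrink (between γ
      (⊆⇒⊑ α γ (l≤i , ℕ.≤-refl)) (⊆⇒⊑ γ β (ℕ.≤-trans i′≤m (ℕ.≤-reflexive (sym l≡)) , j≤j′)))
    where
    l≤ = fin m i (ℕ.≤-trans (ℕ.n≤1+n m) (ℕ.≤-reflexive (sym i≡)))
    l = proj₁ l≤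
    l≡ = proj₂ l≤
    l≤i : l Fin.≤ i
    l≤i = subst₂ ℕ._≤_ (sym l≡) (sym i≡) (ℕ.n≤1+n m)
    γ = root l j (ℕ.≤-trans l≤i i≤j)
    shrink : γ ≡ α ⊎ γ ≡ β → toℕ j′ ∸ toℕ i′ ≡ suc (toℕ j ∸ toℕ i)
    shrink (inj₁ eq) = contradiction
      (trans (sym i≡) (trans (sym (cong (toℕ ∘ PosRoot.i) eq)) l≡)) ℕ.1+n≢n
    shrink (inj₂ eq) = trans
      (cong₂ _∸_ (cong (toℕ ∘ PosRoot.j) (sym eq)) (trans (cong (toℕ ∘ PosRoot.i) (sym eq)) l≡))
      (trans (ℕ.+-∸-assoc 1 (subst (ℕ._≤ toℕ j) i≡ i≤j)) (cong (λ h → suc (toℕ j ∸ h)) (sym i≡)))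

  extend-right : toℕ i′ ≡ toℕ i → j Fin.< j′ → toℕ j′ ∸ toℕ i′ ≡ suc (toℕ j ∸ toℕ i)
  extend-right i′≡i j<j′ = shrink (between γ
      (⊆⇒⊑ α γ (ℕ.≤-refl , j≤l)) (⊆⇒⊑ γ β (i′≤i , ℕ.≤-trans (ℕ.≤-reflexive l≡) j<j′)))
    where
    l≤ = fin (suc (toℕ j)) j′ j<j′
    l = proj₁ l≤
    l≡ = proj₂ l≤
    j≤l : j Fin.≤ l
    j≤l = subst (toℕ j ℕ.≤_) (sym l≡) (ℕ.n≤1+n (toℕ j))
    γ = root i l (ℕ.≤-trans i≤j j≤l)
    shrink : γ ≡ α ⊎ γ ≡ β → toℕ j′ ∸ toℕ i′ ≡ suc (toℕ j ∸ toℕ i)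
    shrink (inj₁ eq) = contradiction (trans (sym l≡) (cong (toℕ ∘ PosRoot.j) eq)) ℕ.1+n≢n
    shrink (inj₂ eq) = trans
      (cong₂ _∸_ (trans (cong (toℕ ∘ PosRoot.j) (sym eq)) l≡) i′≡i) (ℕ.+-∸-assoc 1 i≤j)

  difference : toℕ j′ ∸ toℕ i′ ≡ suc (toℕ j ∸ toℕ i)
  difference with ℕ.m≤n⇒m<n∨m≡n i′≤i | ℕ.m≤n⇒m<n∨m≡n j≤j′
  ... | inj₁ i′<i | _         = extend-left (ℕ.pred (toℕ i))
    (sym (ℕ.suc-pred (toℕ i) {{ℕ.>-nonZero (ℕ.≤-<-trans z≤n i′<i)}})) (ℕ.<⇒≤pred i′<i)
  ... | inj₂ i′≡i | inj₁ j<j′ = extend-right i′≡i j<j′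
  ... | inj₂ i′≡i | inj₂ j≡j′ =
    contradiction (root-≡ (sym (Fin.toℕ-injective i′≡i)) (Fin.toℕ-injective j≡j′)) α≢β

rootPoset : ∀ r .{{_ : NonZero r}} → FiniteGradedPoset
rootPoset (suc n) = record
  { Carrier           = PosRoot (suc n)
  ; _≤_               = _⊑_
  ; isDecPartialOrder = ⊑-isDecPartialOrder (suc n)
  ; elements          = posRoots (suc n)
  ; elements-complete = posRoots-complete
  ; elements-unique   = posRoots-unique (suc n)
  ; ⊤                 = root zero (fromℕ n) z≤n
  ; ⊤-maximum         = λ α → ⊆⇒⊑ α (root zero (fromℕ n) z≤n) (z≤n , Fin.≤fromℕ (PosRoot.j α))
  ; ρ                 = λ α → height α ∸ 1
  ; ρ-minimal         = height-minimal
  ; ρ-cover           = λ { {α} {β} (α⊑β , α≢β , between) → height-cover α β α⊑β α≢β between }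
  }

data Letter : Set where
  L R : Letter

infix 4 _≟ᴸ_
_≟ᴸ_ : (a b : Letter) → Dec (a ≡ b)
L ≟ᴸ L = yes refl
L ≟ᴸ R = no λ ()
R ≟ᴸ L = no λ ()
R ≟ᴸ R = yes refl

words : ∀ m → List (Vec Letter m)
words = tuples (L ∷ R ∷ [])

StartsLBlock : ∀ {m} → Vec Letter m → Fin m → Set
StartsLBlock w j =
  lookup w j ≡ L × (toℕ j ≡ 0 ⊎ ∃[ i ] (suc (toℕ i) ≡ toℕ j × lookup w i ≡ R))

startsLBlock? : ∀ {m} (w : Vec Letter m) j → Dec (StartsLBlock w j)
startsLBlock? w j =
  (lookup w j ≟ᴸ L) ×-dec
  ((toℕ j ℕ.≟ 0) ⊎-dec Fin.any? (λ i → (suc (toℕ i) ℕ.≟ toℕ j) ×-dec (lookup w i ≟ᴸ R)))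

D : ∀ {m} → Vec Letter m → List (Fin m)
D {m} w = filter (startsLBlock? w) (allFin m)

-- Positions are 0-based, so the exponent j − 1 of a 1-based position is toℕ.
qExponent : ∀ {m} → Vec Letter m → ℕ
qExponent w = ℕ.sum (map toℕ (D w))

wordPolynomial : ℕ → Poly₂
wordPolynomial m = ∑ (words m) (λ w → constant (q^ (qExponent w)) * t^ (length (D w)))
  where open RawRing ℤ[q][t] using (_*_)
        open Ring ℤ[q][t] using (∑)
        open Ring ℤ[x] using (constant)

gaussianFormula : ℕ → ℕ → Poly₁
gaussianFormula r k =
  q^ (k ℕ.* (k ∸ 1)) * ∑ (range k (r ∸ k)) (λ h → gaussian (h ∸ 1) (k ∸ 1) * gaussian (r ∸ h) k)
  where open RawRing ℤ[x] using (_*_)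
        open Ring ℤ[x] using (∑)

evenBinomialPolynomial : ℕ → Poly₁
evenBinomialPolynomial r = ∑ (range 0 ⌊ r /2⌋) (λ k → constant (+ (r C (2 ℕ.* k))) * X ^ k)
  where open RawRing ℤ[x] using (_*_)
        open Ring ℤ[x] using (∑; _^_)
        open Ring ℤ-ring using (constant; X)

-- (1 + √t)^r + (1 − √t)^r, where X stands for √t; substitute-square rewrites
-- a polynomial in t in the same variable.
conjugatePowers : ℕ → Poly₁
conjugatePowers r = (1# + X) ^ r + (1# + - X) ^ r
  where open RawRing ℤ[x] using (1#; _+_; -_)
        open Ring ℤ[x] using (_^_)
        open Ring ℤ-ring using (X)

two : Poly₁
two = 1# + 1# where open RawRing ℤ[x]

Eventually : (ℕ → Set) → Set
Eventually P = ∃[ N ] (∀ n → N ℕ.≤ n → P n)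

IsCauchy : (ℕ → ℚ) → Set
IsCauchy x = ∀ ε → 0ℚ ℚ.< ε → ∃[ N ] (∀ m n → N ℕ.≤ m → N ℕ.≤ n → ℚ.∣ x m ℚ.- x n ∣ ℚ.< ε)

-- Real numbers as Cauchy sequences of rationals, identified by _≈ℝ_.
record ℝ : Set where
  constructor real
  field
    approx : ℕ → ℚ
    cauchy : IsCauchy approx
open ℝ public

infix 4 _≈ℝ_ _<ℝ_ _#_
infixl 6 _+ℝ_
infixl 7 _*ℝ_

_≈ℝ_ _<ℝ_ _#_ : Rel ℝ 0ℓ
x ≈ℝ y = ∀ ε → 0ℚ ℚ.< ε → Eventually (λ n → ℚ.∣ approx x n ℚ.- approx y n ∣ ℚ.< ε)
x <ℝ y = ∃[ ε ] (0ℚ ℚ.< ε × Eventually (λ n → approx x n ℚ.+ ε ℚ.≤ approx y n))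
x # y  = x <ℝ y ⊎ y <ℝ x

private
  half>0 : ∀ {ε} → 0ℚ ℚ.< ε → 0ℚ ℚ.< ½ ℚ.* ε
  half>0 0<ε = ℚ.*-monoʳ-<-pos ½ 0<ε

  halves : ∀ ε → ½ ℚ.* ε ℚ.+ ½ ℚ.* ε ≡ ε
  halves ε = trans (sym (ℚ.*-distribʳ-+ ε ½ ½)) (ℚ.*-identityˡ ε)

  shrink : ∀ B ε → 0ℚ ℚ.< B → 0ℚ ℚ.< ε → Σ[ δ ∈ ℚ ] (0ℚ ℚ.< δ × B ℚ.* δ ≡ ½ ℚ.* ε)
  shrink B ε 0<B 0<ε = 1/B ℚ.* (½ ℚ.* ε)
    , subst (ℚ._< 1/B ℚ.* (½ ℚ.* ε)) (ℚ.*-zeroʳ 1/B) (ℚ.*-monoʳ-<-pos 1/B {{ℚ.1/pos⇒pos B}} (half>0 0<ε))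
    , trans (sym (ℚ.*-assoc B 1/B (½ ℚ.* ε)))
        (trans (cong (ℚ._* (½ ℚ.* ε)) (ℚ.*-inverseʳ B)) (ℚ.*-identityˡ (½ ℚ.* ε)))
    where
    instance
      B-positive = ℚ.positive 0<B
      B-nonZero = ℚ.pos⇒nonZero B
    1/B = ℚ.1/ B

  bounded : ∀ x → IsCauchy x → Σ[ B ∈ ℚ ] (0ℚ ℚ.< B × Eventually (λ n → ℚ.∣ x n ∣ ℚ.≤ B))
  bounded x c with N , close ← c 1ℚ (ℚ.positive⁻¹ 1ℚ) = 1ℚ ℚ.+ ℚ.∣ x N ∣
    , ℚ.+-mono-<-≤ (ℚ.positive⁻¹ 1ℚ) (ℚ.0≤∣p∣ (x N))
    , N , λ n N≤n → begin
        ℚ.∣ x n ∣                          ≡⟨ cong ℚ.∣_∣ (solve 2 (λ u v → u := (u :- v) :+ v) refl (x n) (x N)) ⟩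
        ℚ.∣ (x n ℚ.- x N) ℚ.+ x N ∣        ≤⟨ ℚ.∣p+q∣≤∣p∣+∣q∣ (x n ℚ.- x N) (x N) ⟩
        ℚ.∣ x n ℚ.- x N ∣ ℚ.+ ℚ.∣ x N ∣    ≤⟨ ℚ.+-monoˡ-≤ ℚ.∣ x N ∣ (ℚ.<⇒≤ (close n N N≤n ℕ.≤-refl)) ⟩
        1ℚ ℚ.+ ℚ.∣ x N ∣                   ∎
    where open ℚ.≤-Reasoning
          open ℚSolver.+-*-Solver using (solve; _:=_; _:+_; _:-_)

  scaled-< : ∀ {u B d δ ε} → 0ℚ ℚ.< B → ℚ.∣ u ∣ ℚ.≤ B → ℚ.∣ d ∣ ℚ.< δ → B ℚ.* δ ≡ ε →
    ℚ.∣ u ℚ.* d ∣ ℚ.< ε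
  scaled-< {u} {B} {d} {δ} {ε} 0<B u≤B d<δ Bδ≡ε = begin-strict
    ℚ.∣ u ℚ.* d ∣            ≡⟨ ℚ.∣p*q∣≡∣p∣*∣q∣ u d ⟩
    ℚ.∣ u ∣ ℚ.* ℚ.∣ d ∣      ≤⟨ ℚ.*-monoʳ-≤-nonNeg ℚ.∣ d ∣ {{ℚ.nonNegative (ℚ.0≤∣p∣ d)}} u≤B ⟩
    B ℚ.* ℚ.∣ d ∣            <⟨ ℚ.*-monoʳ-<-pos B {{ℚ.positive 0<B}} d<δ ⟩
    B ℚ.* δ                  ≡⟨ Bδ≡ε ⟩
    ε                        ∎
    where open ℚ.≤-Reasoning

  sum-< : ∀ {u v w ε} → w ≡ u ℚ.+ v → ℚ.∣ u ∣ ℚ.< ½ ℚ.* ε → ℚ.∣ v ∣ ℚ.< ½ ℚ.* ε → ℚ.∣ w ∣ ℚ.< ε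
  sum-< {u} {v} {w} {ε} w≡ u< v< = begin-strict
    ℚ.∣ w ∣                  ≡⟨ cong ℚ.∣_∣ w≡ ⟩
    ℚ.∣ u ℚ.+ v ∣            ≤⟨ ℚ.∣p+q∣≤∣p∣+∣q∣ u v ⟩
    ℚ.∣ u ∣ ℚ.+ ℚ.∣ v ∣      <⟨ ℚ.+-mono-< u< v< ⟩
    ½ ℚ.* ε ℚ.+ ½ ℚ.* ε      ≡⟨ halves ε ⟩
    ε                        ∎
    where open ℚ.≤-Reasoning

  product-difference : ∀ a b c d → a ℚ.* b ℚ.- c ℚ.* d ≡ a ℚ.* (b ℚ.- d) ℚ.+ d ℚ.* (a ℚ.- c)
  product-difference = solve 4 (λ a b c d → (a :* b) :- (c :* d) := (a :* (b :- d)) :+ (d :* (a :- c))) refl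
    where open ℚSolver.+-*-Solver using (solve; _:=_; _:+_; _:-_; _:*_)

  product-cauchy : ∀ x y → IsCauchy x → IsCauchy y → IsCauchy (λ n → x n ℚ.* y n)
  product-cauchy x y cx cy ε 0<ε = go (bounded x cx) (bounded y cy)
    where
    Bounded : (ℕ → ℚ) → Set
    Bounded z = Σ[ B ∈ ℚ ] (0ℚ ℚ.< B × Eventually (λ n → ℚ.∣ z n ∣ ℚ.≤ B))
    Close : (ℕ → ℚ) → ℚ → Set
    Close z δ = ∃[ N ] (∀ m n → N ℕ.≤ m → N ℕ.≤ n → ℚ.∣ z m ℚ.- z n ∣ ℚ.< δ)
    go : Bounded x → Bounded y → Close (λ n → x n ℚ.* y n) ε
    go (A , 0<A , M , x≤A) (B , 0<B , N , y≤B) = near (shrink A ε 0<A 0<ε) (shrink B ε 0<B 0<ε)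
      where
      near : Σ[ δ ∈ ℚ ] (0ℚ ℚ.< δ × A ℚ.* δ ≡ ½ ℚ.* ε) → Σ[ δ ∈ ℚ ] (0ℚ ℚ.< δ × B ℚ.* δ ≡ ½ ℚ.* ε) →
        Close (λ n → x n ℚ.* y n) ε
      near (α , 0<α , Aα≡) (β , 0<β , Bβ≡) = combine (cy α 0<α) (cx β 0<β)
        where
        combine : Close y α → Close x β → Close (λ n → x n ℚ.* y n) ε
        combine (K , close-y) (J , close-x) = (M ℕ.⊔ N) ℕ.⊔ (K ℕ.⊔ J) , λ m n m≥ n≥ →
          let m≥MN = ℕ.m⊔n≤o⇒m≤o (M ℕ.⊔ N) (K ℕ.⊔ J) m≥
              n≥MN = ℕ.m⊔n≤o⇒m≤o (M ℕ.⊔ N) (K ℕ.⊔ J) n≥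
              m≥KJ = ℕ.m⊔n≤o⇒n≤o (M ℕ.⊔ N) (K ℕ.⊔ J) m≥
              n≥KJ = ℕ.m⊔n≤o⇒n≤o (M ℕ.⊔ N) (K ℕ.⊔ J) n≥
          in sum-< (product-difference (x m) (y m) (x n) (y n))
            (scaled-< {x m} {A} {y m ℚ.- y n} 0<A (x≤A m (ℕ.m⊔n≤o⇒m≤o M N m≥MN))
              (close-y m n (ℕ.m⊔n≤o⇒m≤o K J m≥KJ) (ℕ.m⊔n≤o⇒m≤o K J n≥KJ)) Aα≡)
            (scaled-< {y n} {B} {x m ℚ.- x n} 0<B (y≤B n (ℕ.m⊔n≤o⇒n≤o M N n≥MN))
              (close-x m n (ℕ.m⊔n≤o⇒n≤o K J m≥KJ) (ℕ.m⊔n≤o⇒n≤o K J n≥KJ)) Bβ≡)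

fromℚ : ℚ → ℝ
approx (fromℚ p) _ = p
cauchy (fromℚ p) ε 0<ε = 0 , λ _ _ _ _ → subst (λ d → ℚ.∣ d ∣ ℚ.< ε) (sym (ℚ.+-inverseʳ p)) 0<ε

0ℝ : ℝ
0ℝ = fromℚ 0ℚ

_+ℝ_ _*ℝ_ : ℝ → ℝ → ℝ
-ℝ_ : ℝ → ℝ

approx (x +ℝ y) n = approx x n ℚ.+ approx y n
cauchy (x +ℝ y) ε 0<ε
  with M , close-x ← cauchy x (½ ℚ.* ε) (half>0 0<ε)
     | N , close-y ← cauchy y (½ ℚ.* ε) (half>0 0<ε)
  = M ℕ.⊔ N , λ m n m≥ n≥ → sum-<
      (solve 4 (λ a b c d → (a :+ b) :- (c :+ d) := (a :- c) :+ (b :- d)) refl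
        (approx x m) (approx y m) (approx x n) (approx y n))
      (close-x m n (ℕ.m⊔n≤o⇒m≤o M N m≥) (ℕ.m⊔n≤o⇒m≤o M N n≥))
      (close-y m n (ℕ.m⊔n≤o⇒n≤o M N m≥) (ℕ.m⊔n≤o⇒n≤o M N n≥))
  where open ℚSolver.+-*-Solver using (solve; _:=_; _:+_; _:-_)

approx (-ℝ x) n = ℚ.- approx x n
cauchy (-ℝ x) ε 0<ε with N , close ← cauchy x ε 0<ε =
  N , λ m n m≥ n≥ → subst (ℚ._< ε)
    (trans (sym (ℚ.∣-p∣≡∣p∣ (approx x m ℚ.- approx x n)))
      (cong ℚ.∣_∣ (ℚ.neg-distrib-+ (approx x m) (ℚ.- approx x n))))
    (close m n m≥ n≥)

approx (x *ℝ y) n = approx x n ℚ.* approx y n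
cauchy (x *ℝ y) = product-cauchy (approx x) (approx y) (cauchy x) (cauchy y)

ℝ-ring : RawRing 0ℓ 0ℓ
ℝ-ring = record
  { Carrier = ℝ
  ; _≈_     = _≈ℝ_
  ; _+_     = _+ℝ_
  ; _*_     = _*ℝ_
  ; -_      = -ℝ_
  ; 0#      = 0ℝ
  ; 1#      = fromℚ 1ℚ
  }

evalℝ : Poly₁ → ℝ → ℝ
evalℝ p = Ring.eval ℝ-ring (map (λ c → fromℚ (c ℚ./ 1)) p)

NegativeZero : Poly₁ → ℝ → Set
NegativeZero p x = x <ℝ 0ℝ × evalℝ p x ≈ℝ 0ℝ

-- Distinctness is apartness, the positive form of inequality of reals.
ExactlyDistinctNegativeZeros : ℕ → Poly₁ → Set
ExactlyDistinctNegativeZeros n p = Σ[ z ∈ (Fin n → ℝ) ]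
  ( (∀ i → NegativeZero p (z i))
  × (∀ i j → i ≢ j → z i # z j)
  × (∀ x → NegativeZero p x → ∃[ i ] x ≈ℝ z i) )

{-# OPTIONS --safe #-}
-- Every root of rank n spans a copy of the poset of A_{n+1}, and its strict order ideal is the union of
-- the ideals of its two lower covers, which meet in the ideal of a root of rank n − 2.  Splitting weak
-- chains by whether their last element is the top therefore gives (1 − q^n t) S_n = 2 S_{n−1} − S_{n−2}
-- for the chain series S_n of A_{n+1}, and the numerators satisfy N_{r+2} = 2 N_{r+1} − (1 − q^r t) N_r.
-- The word sums obey the same recurrence: it holds for words read from any position after any letter,
-- by induction on their length, because splitting off the first letter is linear.
-- Everything else is read off this recurrence.  For the coefficient of t^k it says that the second
-- difference in r is q^r times the coefficient of t^{k−1}, which the convolution of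
-- q^{k(k−1)/2} [h−1 k−1] with q^{k(k−1)/2} [s k] satisfies as well.  At q = 1 it is the recurrence of
-- (1 + √t)^r + (1 − √t)^r, and for t < 0 it is of Sturm type: at a zero of N_{r+1} the values of N_r
-- and N_{r+2} have opposite signs, so the intermediate value theorem puts a zero of N_{r+2} between
-- consecutive zeros of N_{r+1}; factoring N_{r+1} over its zeros gives its signs at the new zeros,
-- which closes the induction, and the factorisation also excludes further zeros.
module Submission where

open import Defs
open import Data.Nat using (ℕ; NonZero; _≤_; _<_; _∸_; ⌊_/2⌋)
open import Data.Product using (Σ-syntax; _×_)
open import Algebra.Bundles using (RawRing)

open import Algebra.Bundles using (CommutativeRing)
import Algebra.Construct.Pointwise as Pointwise
import Algebra.Morphism.RingMonomorphism as RingMonomorphism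
open import Algebra.Morphism.Structures using (IsRingMonomorphism)
import Algebra.Properties.Ring
import Algebra.Properties.Semiring.Exp
import Algebra.Solver.Ring.NaturalCoefficients.Default as NaturalSolver
open import Data.Bool.Base using (Bool; true; false; if_then_else_; _∧_)
open import Data.Fin.Base as Fin using (Fin; zero; suc; toℕ; fromℕ; fromℕ<; inject₁)
import Data.Fin.Properties as Fin
open import Data.Integer.Base as ℤ using (ℤ; +_; -[1+_]; 0ℤ; 1ℤ)
import Data.Integer.Properties as ℤ
import Data.Integer.Solver as ℤSolver
open import Data.List.Base using (List; []; _∷_; _++_; map; mapMaybe; foldr; filter; length; tabulate; allFin; applyUpTo; upTo; cartesianProduct; cartesianProductWith)
import Data.List.Properties as List
open import Data.Maybe.Base using (Maybe; just; nothing; maybe′)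
open import Data.Nat.Base as ℕ using (zero; suc; z≤n; s≤s)
open import Data.Nat.Combinatorics using (_C_; nCk+nC[k+1]≡[n+1]C[k+1]; k>n⇒nCk≡0)
import Data.Nat.ListAction as ℕ
import Data.Nat.Properties as ℕ
import Data.Nat.Solver as ℕSolver
open import Data.Product.Base using (∃-syntax; _,_; proj₁; proj₂)
open import Data.Rational.Base as ℚ using (ℚ; 0ℚ; 1ℚ; ½)
import Data.Rational.Properties as ℚ
import Data.Rational.Solver as ℚSolver
import Data.Rational.Unnormalised.Base as ℚᵘ
import Data.Rational.Unnormalised.Properties as ℚᵘ
open import Data.Sum.Base using (_⊎_; inj₁; inj₂)
open import Data.Vec.Base as Vec using (Vec; []; _∷_; lookup)
import Data.Vec.Relation.Unary.Linked as Linked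
open import Function.Base using (_∘_; id)
open import Function.Bundles using (_⇔_; mk⇔; module Equivalence)
open import Level using (0ℓ)
open import Relation.Binary.Definitions using (Tri; tri<; tri≈; tri>) renaming (Decidable to Decidable₂)
open import Relation.Binary.PropositionalEquality as ≡ using (_≡_; _≢_)
import Relation.Binary.Reasoning.Setoid as SetoidReasoning
open import Relation.Nullary using (¬_; Dec; yes; no; does; contradiction)
open import Relation.Nullary.Decidable using (_×-dec_; dec-true; dec-false; does-⇔)
open import Relation.Unary using (Decidable)

-- Sums, formal power series and polynomials over a commutative ring

-- Recurrences are written as `x (2 + n) + x n = 2 x (1 + n) + Φ`, with no subtraction, so that most
-- of the algebra consists of semiring identities. `Recurrence.unique` then identifies sequences of
-- series, coefficients, integers, polynomials or real values from two initial terms. The two lower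
-- covers never occur as roots. The order is containment of index intervals, so n - e + 1 roots of
-- rank e lie below a root of rank n; chain sums are therefore iterated partial sums, and their
-- second difference is the single term of the top root. The second half is shaped by the
-- undecidable order of the reals. Signs are carried as witnesses that (-1)^j x is positive and are
-- never tested. Case distinctions on real numbers come from cotransitivity. The intermediate value
-- theorem bisects between rational points, where signs are decidable, after a Lipschitz estimate
-- has moved the real end points to rational ones. The Sturm argument only sees a ring with a
-- positive cone, so the analysis enters it through that interface and the intermediate value
-- property alone.

module Sums (𝓡 : CommutativeRing 0ℓ 0ℓ) where
  open CommutativeRing 𝓡 hiding (zero)
  open Ring rawRing using (∑; ∏)
  open SetoidReasoning setoid
  open NaturalSolver commutativeSemiring using (solve; _:=_; _:+_; _:*_)

  private variable
    A B T : Set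

  ∑-cong : ∀ (xs : List A) {f g : A → Carrier} → (∀ x → f x ≈ g x) → ∑ xs f ≈ ∑ xs g
  ∑-cong []       f≈g = refl
  ∑-cong (x ∷ xs) f≈g = +-cong (f≈g x) (∑-cong xs f≈g)

  ∑-0 : ∀ (xs : List A) {f : A → Carrier} → (∀ x → f x ≈ 0#) → ∑ xs f ≈ 0#
  ∑-0 []       f≈0 = refl
  ∑-0 (x ∷ xs) f≈0 = trans (+-cong (f≈0 x) (∑-0 xs f≈0)) (+-identityˡ 0#)

  ∑-+ : ∀ (xs : List A) (f g : A → Carrier) → ∑ xs (λ x → f x + g x) ≈ ∑ xs f + ∑ xs g
  ∑-+ []       f g = sym (+-identityˡ 0#)
  ∑-+ (x ∷ xs) f g = begin
    f x + g x + ∑ xs (λ y → f y + g y)  ≈⟨ +-congˡ (∑-+ xs f g) ⟩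
    f x + g x + (∑ xs f + ∑ xs g)       ≈⟨ solve 4 (λ a b c d → (a :+ b) :+ (c :+ d) := (a :+ c) :+ (b :+ d)) refl _ _ _ _ ⟩
    f x + ∑ xs f + (g x + ∑ xs g)       ∎

  ∑-*ˡ : ∀ (xs : List A) a (f : A → Carrier) → ∑ xs (λ x → a * f x) ≈ a * ∑ xs f
  ∑-*ˡ []       a f = sym (zeroʳ a)
  ∑-*ˡ (x ∷ xs) a f = trans (+-congˡ (∑-*ˡ xs a f)) (sym (distribˡ a (f x) (∑ xs f)))

  ∑-*ʳ : ∀ (xs : List A) a (f : A → Carrier) → ∑ xs (λ x → f x * a) ≈ ∑ xs f * a
  ∑-*ʳ xs a f = trans (∑-cong xs (λ x → *-comm (f x) a)) (trans (∑-*ˡ xs a f) (*-comm a (∑ xs f)))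

  ∑-++ : ∀ (xs ys : List A) (f : A → Carrier) → ∑ (xs ++ ys) f ≈ ∑ xs f + ∑ ys f
  ∑-++ []       ys f = sym (+-identityˡ _)
  ∑-++ (x ∷ xs) ys f = trans (+-congˡ (∑-++ xs ys f)) (sym (+-assoc _ _ _))

  ∏-++ : ∀ (xs ys : List A) (f : A → Carrier) → ∏ (xs ++ ys) f ≈ ∏ xs f * ∏ ys f
  ∏-++ []       ys f = sym (*-identityˡ _)
  ∏-++ (x ∷ xs) ys f = trans (*-congˡ (∏-++ xs ys f)) (sym (*-assoc _ _ _))

  ∑-map : ∀ (h : B → A) xs (f : A → Carrier) → ∑ (map h xs) f ≡ ∑ xs (f ∘ h)
  ∑-map h xs f = ≡.cong (foldr _+_ 0#) (≡.sym (List.map-∘ xs))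

  ∑-swap : ∀ (xs : List A) (ys : List B) (f : A → B → Carrier) →
    ∑ xs (λ x → ∑ ys (f x)) ≈ ∑ ys (λ y → ∑ xs (λ x → f x y))
  ∑-swap []       ys f = sym (∑-0 ys (λ _ → refl))
  ∑-swap (x ∷ xs) ys f = begin
    ∑ ys (f x) + ∑ xs (λ z → ∑ ys (f z))          ≈⟨ +-congˡ (∑-swap xs ys f) ⟩
    ∑ ys (f x) + ∑ ys (λ y → ∑ xs (λ z → f z y))  ≈⟨ sym (∑-+ ys (f x) _) ⟩
    ∑ ys (λ y → f x y + ∑ xs (λ z → f z y))       ∎

  ∑-cartesianProductWith : ∀ (h : A → B → T) xs ys (f : T → Carrier) →
    ∑ (cartesianProductWith h xs ys) f ≈ ∑ xs (λ x → ∑ ys (λ y → f (h x y)))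
  ∑-cartesianProductWith h []       ys f = refl
  ∑-cartesianProductWith h (x ∷ xs) ys f = begin
    ∑ (map (h x) ys ++ cartesianProductWith h xs ys) f
      ≈⟨ ∑-++ (map (h x) ys) _ f ⟩
    ∑ (map (h x) ys) f + ∑ (cartesianProductWith h xs ys) f
      ≈⟨ +-cong (reflexive (∑-map (h x) ys f)) (∑-cartesianProductWith h xs ys f) ⟩
    ∑ ys (λ y → f (h x y)) + ∑ xs (λ x → ∑ ys (λ y → f (h x y)))
      ∎

  ∑-upTo-suc : ∀ n (f : ℕ → Carrier) → ∑ (upTo (suc n)) f ≡ f 0 + ∑ (upTo n) (f ∘ suc)
  ∑-upTo-suc n f = ≡.cong (λ xs → f 0 + foldr _+_ 0# xs)
    (≡.trans (List.map-applyUpTo suc f n) (≡.sym (List.map-upTo (f ∘ suc) n)))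

  ∑-upTo-∷ʳ : ∀ n (f : ℕ → Carrier) → ∑ (upTo (suc n)) f ≈ ∑ (upTo n) f + f n
  ∑-upTo-∷ʳ n f = begin
    ∑ (upTo (suc n)) f              ≡⟨ ≡.cong (λ xs → ∑ xs f) (≡.sym (List.upTo-∷ʳ n)) ⟩
    ∑ (upTo n ++ n ∷ []) f          ≈⟨ ∑-++ (upTo n) _ f ⟩
    ∑ (upTo n) f + (f n + 0#)       ≈⟨ +-congˡ (+-identityʳ (f n)) ⟩
    ∑ (upTo n) f + f n              ∎

  ∑-upTo-cong : ∀ n {f g : ℕ → Carrier} → (∀ i → i ℕ.< n → f i ≈ g i) → ∑ (upTo n) f ≈ ∑ (upTo n) g
  ∑-upTo-cong zero    f≈g = refl
  ∑-upTo-cong (suc n) {f} {g} f≈g = begin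
    ∑ (upTo (suc n)) f       ≈⟨ ∑-upTo-∷ʳ n f ⟩
    ∑ (upTo n) f + f n       ≈⟨ +-cong (∑-upTo-cong n (λ i i<n → f≈g i (ℕ.m<n⇒m<1+n i<n))) (f≈g n ℕ.≤-refl) ⟩
    ∑ (upTo n) g + g n       ≈⟨ sym (∑-upTo-∷ʳ n g) ⟩
    ∑ (upTo (suc n)) g       ∎

  ∑-upTo-+ : ∀ m n (f : ℕ → Carrier) → ∑ (upTo (m ℕ.+ n)) f ≈ ∑ (upTo m) f + ∑ (upTo n) (λ i → f (m ℕ.+ i))
  ∑-upTo-+ zero    n f = sym (+-identityˡ _)
  ∑-upTo-+ (suc m) n f = begin
    ∑ (upTo (suc (m ℕ.+ n))) f
      ≡⟨ ∑-upTo-suc (m ℕ.+ n) f ⟩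
    f 0 + ∑ (upTo (m ℕ.+ n)) (f ∘ suc)
      ≈⟨ +-congˡ (∑-upTo-+ m n (f ∘ suc)) ⟩
    f 0 + (∑ (upTo m) (f ∘ suc) + ∑ (upTo n) (λ i → f (suc (m ℕ.+ i))))
      ≈⟨ sym (+-assoc _ _ _) ⟩
    f 0 + ∑ (upTo m) (f ∘ suc) + ∑ (upTo n) (λ i → f (suc (m ℕ.+ i)))
      ≡⟨ ≡.cong (_+ ∑ (upTo n) (λ i → f (suc (m ℕ.+ i)))) (≡.sym (∑-upTo-suc m f)) ⟩
    ∑ (upTo (suc m)) f + ∑ (upTo n) (λ i → f (suc m ℕ.+ i))
      ∎

  ∑-upTo-0 : ∀ n {f : ℕ → Carrier} → (∀ i → i ℕ.< n → f i ≈ 0#) → ∑ (upTo n) f ≈ 0#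
  ∑-upTo-0 n f≈0 = trans (∑-upTo-cong n f≈0) (∑-0 (upTo n) (λ _ → refl))

  ∑-upTo-reverse : ∀ n (f : ℕ → Carrier) → ∑ (upTo (suc n)) (λ i → f (n ∸ i)) ≈ ∑ (upTo (suc n)) f
  ∑-upTo-reverse zero    f = refl
  ∑-upTo-reverse (suc n) f = begin
    ∑ (upTo (suc (suc n))) (λ i → f (suc n ∸ i))       ≡⟨ ∑-upTo-suc (suc n) _ ⟩
    f (suc n) + ∑ (upTo (suc n)) (λ i → f (n ∸ i))     ≈⟨ +-congˡ (∑-upTo-reverse n f) ⟩
    f (suc n) + ∑ (upTo (suc n)) f                     ≈⟨ +-comm _ _ ⟩
    ∑ (upTo (suc n)) f + f (suc n)                     ≈⟨ sym (∑-upTo-∷ʳ (suc n) f) ⟩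
    ∑ (upTo (suc (suc n))) f                           ∎

module SeriesRing (𝓡 : CommutativeRing 0ℓ 0ℓ) where
  open CommutativeRing 𝓡 hiding (zero)
  open Ring rawRing using (Series; _⊛_; ∑)
  open Sums 𝓡
  open SetoidReasoning setoid
  open NaturalSolver commutativeSemiring using (solve; _:=_; _:+_; _:*_)

  infix 4 _≈ₛ_
  _≈ₛ_ : Series → Series → Set
  f ≈ₛ g = ∀ n → f n ≈ g n

  infixl 6 _+ₛ_
  _+ₛ_ : Series → Series → Series
  (f +ₛ g) n = f n + g n

  0ₛ : Series
  0ₛ _ = 0#

  embed : Carrier → Series
  embed a zero    = a
  embed a (suc n) = 0#

  1ₛ : Series
  1ₛ = embed 1#

  -ₛ_ : Series → Series
  (-ₛ f) n = - f n

  ⊛-zero : ∀ f g → (f ⊛ g) 0 ≈ f 0 * g 0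
  ⊛-zero f g = +-identityʳ _

  ⊛-suc : ∀ f g n → (f ⊛ g) (suc n) ≡ f 0 * g (suc n) + ((f ∘ suc) ⊛ g) n
  ⊛-suc f g n = ∑-upTo-suc (suc n) _

  ⊛-cong : ∀ {f f′ g g′} → f ≈ₛ f′ → g ≈ₛ g′ → f ⊛ g ≈ₛ f′ ⊛ g′
  ⊛-cong f≈ g≈ n = ∑-cong (upTo (suc n)) (λ i → *-cong (f≈ i) (g≈ (n ∸ i)))

  ⊛-distribʳ : ∀ h f g → (f +ₛ g) ⊛ h ≈ₛ (f ⊛ h) +ₛ (g ⊛ h)
  ⊛-distribʳ h f g n = trans (∑-cong (upTo (suc n)) (λ i → distribʳ (h (n ∸ i)) (f i) (g i))) (∑-+ (upTo (suc n)) _ _)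

  ⊛-zeroˡ : ∀ f → 0ₛ ⊛ f ≈ₛ 0ₛ
  ⊛-zeroˡ f n = ∑-0 (upTo (suc n)) (λ i → zeroˡ (f (n ∸ i)))

  ⊛-scaleˡ : ∀ a f g → (λ i → a * f i) ⊛ g ≈ₛ (λ n → a * (f ⊛ g) n)
  ⊛-scaleˡ a f g n = trans (∑-cong (upTo (suc n)) (λ i → *-assoc a (f i) (g (n ∸ i)))) (∑-*ˡ (upTo (suc n)) a _)

  -- Induction on the index, peeling off the first coefficient by `⊛-suc` and applying the
  -- hypothesis to `f ∘ suc`; this avoids reindexing a triangular double sum.
  ⊛-assoc : ∀ f g h → (f ⊛ g) ⊛ h ≈ₛ f ⊛ (g ⊛ h)
  ⊛-assoc f g h zero = begin
    ((f ⊛ g) ⊛ h) 0       ≈⟨ ⊛-zero (f ⊛ g) h ⟩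
    (f ⊛ g) 0 * h 0       ≈⟨ *-congʳ (⊛-zero f g) ⟩
    f 0 * g 0 * h 0       ≈⟨ *-assoc _ _ _ ⟩
    f 0 * (g 0 * h 0)     ≈⟨ *-congˡ (sym (⊛-zero g h)) ⟩
    f 0 * (g ⊛ h) 0       ≈⟨ sym (⊛-zero f (g ⊛ h)) ⟩
    (f ⊛ (g ⊛ h)) 0       ∎
  ⊛-assoc f g h (suc n) = begin
    ((f ⊛ g) ⊛ h) (suc n)
      ≡⟨ ⊛-suc (f ⊛ g) h n ⟩
    (f ⊛ g) 0 * h (suc n) + (((f ⊛ g) ∘ suc) ⊛ h) n
      ≈⟨ +-cong (*-congʳ (⊛-zero f g)) (⊛-cong {g = h} (λ k → reflexive (⊛-suc f g k)) (λ _ → refl) n) ⟩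
    f 0 * g 0 * h (suc n) + (((λ k → f 0 * g (suc k)) +ₛ ((f ∘ suc) ⊛ g)) ⊛ h) n
      ≈⟨ +-congˡ (⊛-distribʳ h (λ k → f 0 * g (suc k)) ((f ∘ suc) ⊛ g) n) ⟩
    f 0 * g 0 * h (suc n) + (((λ k → f 0 * g (suc k)) ⊛ h) n + (((f ∘ suc) ⊛ g) ⊛ h) n)
      ≈⟨ +-congˡ (+-cong (⊛-scaleˡ (f 0) (g ∘ suc) h n) (⊛-assoc (f ∘ suc) g h n)) ⟩
    f 0 * g 0 * h (suc n) + (f 0 * ((g ∘ suc) ⊛ h) n + ((f ∘ suc) ⊛ (g ⊛ h)) n)
      ≈⟨ solve 5 (λ a b c d e → ((a :* b) :* c) :+ ((a :* d) :+ e) := (a :* ((b :* c) :+ d)) :+ e) refl _ _ _ _ _ ⟩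
    f 0 * (g 0 * h (suc n) + ((g ∘ suc) ⊛ h) n) + ((f ∘ suc) ⊛ (g ⊛ h)) n
      ≡⟨ ≡.cong (λ x → f 0 * x + ((f ∘ suc) ⊛ (g ⊛ h)) n) (≡.sym (⊛-suc g h n)) ⟩
    f 0 * (g ⊛ h) (suc n) + ((f ∘ suc) ⊛ (g ⊛ h)) n
      ≡⟨ ≡.sym (⊛-suc f (g ⊛ h) n) ⟩
    (f ⊛ (g ⊛ h)) (suc n)
      ∎

  ⊛-comm : ∀ f g → f ⊛ g ≈ₛ g ⊛ f
  ⊛-comm f g n = begin
    ∑ (upTo (suc n)) (λ i → f i * g (n ∸ i))                  ≈⟨ ∑-upTo-cong (suc n) (λ { i (ℕ.s≤s i≤n) →
                                                                   trans (*-comm _ _) (*-congˡ (reflexive (≡.cong f (≡.sym (ℕ.m∸[m∸n]≡n i≤n))))) }) ⟩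
    ∑ (upTo (suc n)) (λ i → g (n ∸ i) * f (n ∸ (n ∸ i)))      ≈⟨ ∑-upTo-reverse n (λ i → g i * f (n ∸ i)) ⟩
    ∑ (upTo (suc n)) (λ i → g i * f (n ∸ i))                  ∎

  ⊛-embedˡ : ∀ a f n → (embed a ⊛ f) n ≈ a * f n
  ⊛-embedˡ a f zero    = ⊛-zero (embed a) f
  ⊛-embedˡ a f (suc n) = begin
    (embed a ⊛ f) (suc n)              ≡⟨ ⊛-suc (embed a) f n ⟩
    a * f (suc n) + (0ₛ ⊛ f) n         ≈⟨ +-congˡ (⊛-zeroˡ f n) ⟩
    a * f (suc n) + 0#                 ≈⟨ +-identityʳ _ ⟩
    a * f (suc n)                      ∎

  ⊛-identityˡ : ∀ f → 1ₛ ⊛ f ≈ₛ f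
  ⊛-identityˡ f n = trans (⊛-embedˡ 1# f n) (*-identityˡ (f n))

  seriesRing : CommutativeRing 0ℓ 0ℓ
  seriesRing = record
    { Carrier = Series
    ; _≈_     = _≈ₛ_
    ; _+_     = _+ₛ_
    ; _*_     = _⊛_
    ; -_      = -ₛ_
    ; 0#      = 0ₛ
    ; 1#      = 1ₛ
    ; isCommutativeRing = record
      { isRing = record
        { +-isAbelianGroup = Pointwise.isAbelianGroup ℕ +-isAbelianGroup
        ; *-cong     = λ {f} {f′} {g} {g′} → ⊛-cong {f} {f′} {g} {g′}
        ; *-assoc    = ⊛-assoc
        ; *-identity = ⊛-identityˡ , λ f n → trans (⊛-comm f 1ₛ n) (⊛-identityˡ f n)
        ; distrib    = (λ h f g n → trans (⊛-comm h (f +ₛ g) n)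
                          (trans (⊛-distribʳ h f g n) (+-cong (⊛-comm f h n) (⊛-comm g h n))))
                     , ⊛-distribʳ
        }
      ; *-comm = ⊛-comm
      }
    }

module PolyRing (𝓡 : CommutativeRing 0ℓ 0ℓ) where
  open CommutativeRing 𝓡 hiding (zero)
  open Ring rawRing
  open SeriesRing 𝓡
  open SetoidReasoning setoid

  coeff-+ : ∀ p p′ n → coeff (p +ₚ p′) n ≈ coeff p n + coeff p′ n
  coeff-+ []      p′       n       = sym (+-identityˡ _)
  coeff-+ (a ∷ p) []       n       = sym (+-identityʳ _)
  coeff-+ (a ∷ p) (b ∷ p′) zero    = refl
  coeff-+ (a ∷ p) (b ∷ p′) (suc n) = coeff-+ p p′ n

  coeff-map : ∀ (h : Carrier → Carrier) → h 0# ≈ 0# → ∀ p n → coeff (map h p) n ≈ h (coeff p n)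
  coeff-map h h0≈0 []      n       = sym h0≈0
  coeff-map h h0≈0 (a ∷ p) zero    = refl
  coeff-map h h0≈0 (a ∷ p) (suc n) = coeff-map h h0≈0 p n

  coeff-* : ∀ p p′ n → coeff (p *ₚ p′) n ≈ (coeff p ⊛ coeff p′) n
  coeff-* []      p′ n       = sym (⊛-zeroˡ (coeff p′) n)
  coeff-* (a ∷ p) p′ zero    = begin
    coeff (map (a *_) p′ +ₚ (0# ∷ p *ₚ p′)) 0  ≈⟨ coeff-+ (map (a *_) p′) _ 0 ⟩
    coeff (map (a *_) p′) 0 + 0#               ≈⟨ +-congʳ (coeff-map (a *_) (zeroʳ a) p′ 0) ⟩
    a * coeff p′ 0 + 0#                        ∎
  coeff-* (a ∷ p) p′ (suc n) = begin
    coeff (map (a *_) p′ +ₚ (0# ∷ p *ₚ p′)) (suc n)          ≈⟨ coeff-+ (map (a *_) p′) _ (suc n) ⟩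
    coeff (map (a *_) p′) (suc n) + coeff (p *ₚ p′) n        ≈⟨ +-cong (coeff-map (a *_) (zeroʳ a) p′ (suc n)) (coeff-* p p′ n) ⟩
    a * coeff p′ (suc n) + (coeff p ⊛ coeff p′) n            ≡⟨ ≡.sym (⊛-suc (coeff (a ∷ p)) (coeff p′) n) ⟩
    (coeff (a ∷ p) ⊛ coeff p′) (suc n)                       ∎

  coeff-constant : ∀ a n → coeff (constant a) n ≈ embed a n
  coeff-constant a zero    = refl
  coeff-constant a (suc n) = refl

  -- Equality of coefficient lists is by definition equality of their series, so all ring laws of
  -- polynomials are pulled back from series along `coeff`.
  coeff-isRingMonomorphism : IsRingMonomorphism polynomials (CommutativeRing.rawRing seriesRing) coeff
  coeff-isRingMonomorphism = record
    { isRingHomomorphism = record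
      { isSemiringHomomorphism = record
        { isNearSemiringHomomorphism = record
          { +-isMonoidHomomorphism = record
            { isMagmaHomomorphism = record
              { isRelHomomorphism = record { cong = λ p≈p′ → p≈p′ }
              ; homo = coeff-+
              }
            ; ε-homo = λ _ → refl
            }
          ; *-homo = coeff-*
          }
        ; 1#-homo = coeff-constant 1#
        }
      ; -‿homo = coeff-map -_ (Algebra.Properties.Ring.-0#≈0# ring)
      }
    ; injective = λ p≈p′ → p≈p′
    }

  polyRing : CommutativeRing 0ℓ 0ℓ
  polyRing = record
    { isCommutativeRing = RingMonomorphism.isCommutativeRing coeff-isRingMonomorphism
        (CommutativeRing.isCommutativeRing seriesRing)
    }

  coeff-X*-zero : ∀ p → coeff (X *ₚ p) 0 ≈ 0#
  coeff-X*-zero p = trans (coeff-* X p 0) (trans (⊛-zero (coeff X) (coeff p)) (zeroˡ _))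

  coeff-X*-suc : ∀ p n → coeff (X *ₚ p) (suc n) ≈ coeff p n
  coeff-X*-suc p n = begin
    coeff (X *ₚ p) (suc n)                                   ≈⟨ coeff-* X p (suc n) ⟩
    (coeff X ⊛ coeff p) (suc n)                              ≡⟨ ⊛-suc (coeff X) (coeff p) n ⟩
    0# * coeff p (suc n) + (coeff (constant 1#) ⊛ coeff p) n ≈⟨ +-cong (zeroˡ _) (⊛-cong {g = coeff p} (coeff-constant 1#) (λ _ → refl) n) ⟩
    0# + (1ₛ ⊛ coeff p) n                                    ≈⟨ +-identityˡ _ ⟩
    (1ₛ ⊛ coeff p) n                                         ≈⟨ ⊛-identityˡ (coeff p) n ⟩
    coeff p n                                                ∎

  coeff-constant-* : ∀ a p n → coeff (constant a *ₚ p) n ≈ a * coeff p n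
  coeff-constant-* a p n = begin
    coeff (constant a *ₚ p) n            ≈⟨ coeff-* (constant a) p n ⟩
    (coeff (constant a) ⊛ coeff p) n     ≈⟨ ⊛-cong {g = coeff p} (coeff-constant a) (λ _ → refl) n ⟩
    (embed a ⊛ coeff p) n                ≈⟨ ⊛-embedˡ a (coeff p) n ⟩
    a * coeff p n                        ∎

  constant-* : ∀ a b → constant (a * b) ≈ₚ constant a *ₚ constant b
  constant-* a b zero    = sym (coeff-constant-* a (constant b) 0)
  constant-* a b (suc n) = sym (trans (coeff-constant-* a (constant b) (suc n)) (zeroʳ a))

  constant-cong : ∀ {a b} → a ≈ b → constant a ≈ₚ constant b
  constant-cong a≈b zero    = a≈b
  constant-cong a≈b (suc n) = refl

-- Serves three substitutions: q = 1, t = s² and a real value for t. They are applied to recurrences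
-- whose only products are with powers of the variable, so an additive `φ` is enough.
module Evaluation (𝓢 𝓡 : CommutativeRing 0ℓ 0ℓ) (φ : CommutativeRing.Carrier 𝓢 → CommutativeRing.Carrier 𝓡)
  (φ-cong : ∀ {a b} → CommutativeRing._≈_ 𝓢 a b → CommutativeRing._≈_ 𝓡 (φ a) (φ b))
  (φ-0 : CommutativeRing._≈_ 𝓡 (φ (CommutativeRing.0# 𝓢)) (CommutativeRing.0# 𝓡))
  (φ-+ : ∀ a b → CommutativeRing._≈_ 𝓡 (φ (CommutativeRing._+_ 𝓢 a b)) (CommutativeRing._+_ 𝓡 (φ a) (φ b)))
  (x : CommutativeRing.Carrier 𝓡) where
  open CommutativeRing 𝓡 hiding (zero)
  open Ring (CommutativeRing.rawRing 𝓢) using (Poly; coeff; X; _+ₚ_; _*ₚ_; _≈ₚ_)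
  open PolyRing 𝓢 using (coeff-X*-zero; coeff-X*-suc)
  open SetoidReasoning setoid
  open NaturalSolver commutativeSemiring using (solve; _:=_; _:+_; _:*_)
  private module 𝓢 = CommutativeRing 𝓢

  evaluate : Poly → Carrier
  evaluate p = Ring.eval rawRing (map φ p) x

  evaluate-0 : ∀ p → (∀ n → coeff p n 𝓢.≈ 𝓢.0#) → evaluate p ≈ 0#
  evaluate-0 []      p≈0 = refl
  evaluate-0 (a ∷ p) p≈0 = begin
    φ a + x * evaluate p   ≈⟨ +-cong (trans (φ-cong (p≈0 0)) φ-0) (*-congˡ (evaluate-0 p (p≈0 ∘ suc))) ⟩
    0# + x * 0#            ≈⟨ +-identityˡ _ ⟩
    x * 0#                 ≈⟨ zeroʳ x ⟩
    0#                     ∎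

  evaluate-cong : ∀ p p′ → p ≈ₚ p′ → evaluate p ≈ evaluate p′
  evaluate-cong []      p′       p≈p′ = sym (evaluate-0 p′ (λ n → 𝓢.sym (p≈p′ n)))
  evaluate-cong (a ∷ p) []       p≈p′ = evaluate-0 (a ∷ p) p≈p′
  evaluate-cong (a ∷ p) (b ∷ p′) p≈p′ = +-cong (φ-cong (p≈p′ 0)) (*-congˡ (evaluate-cong p p′ (p≈p′ ∘ suc)))

  evaluate-+ : ∀ p p′ → evaluate (p +ₚ p′) ≈ evaluate p + evaluate p′
  evaluate-+ []      p′       = sym (+-identityˡ _)
  evaluate-+ (a ∷ p) []       = sym (+-identityʳ _)
  evaluate-+ (a ∷ p) (b ∷ p′) = begin
    φ (a 𝓢.+ b) + x * evaluate (p +ₚ p′)                ≈⟨ +-cong (φ-+ a b) (*-congˡ (evaluate-+ p p′)) ⟩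
    φ a + φ b + x * (evaluate p + evaluate p′)          ≈⟨ solve 5 (λ a b x u v → (a :+ b) :+ (x :* (u :+ v)) := (a :+ (x :* u)) :+ (b :+ (x :* v))) refl _ _ _ _ _ ⟩
    φ a + x * evaluate p + (φ b + x * evaluate p′)      ∎

  evaluate-X* : ∀ p → evaluate (X *ₚ p) ≈ x * evaluate p
  evaluate-X* p = begin
    evaluate (X *ₚ p)             ≈⟨ evaluate-cong (X *ₚ p) (𝓢.0# ∷ p) (λ { zero → coeff-X*-zero p ; (suc n) → coeff-X*-suc p n }) ⟩
    φ 𝓢.0# + x * evaluate p       ≈⟨ +-congʳ φ-0 ⟩
    0# + x * evaluate p           ≈⟨ +-identityˡ _ ⟩
    x * evaluate p                ∎

-- Second-order recurrences

module Recurrence (𝓡 : CommutativeRing 0ℓ 0ℓ) where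
  open CommutativeRing 𝓡 hiding (zero)
  open Ring rawRing using (∏)
  open Sums 𝓡
  open Algebra.Properties.Ring ring using (+-cancelʳ)
  open SetoidReasoning setoid
  open NaturalSolver commutativeSemiring using (solve; con; _:=_; _:+_; _:*_)

  -- Letting `Φ` depend on both n and `x n` covers a multiple of the sequence itself as well as a
  -- prescribed inhomogeneous term.
  SecondDifference : (ℕ → Carrier → Carrier) → (ℕ → Carrier) → Set
  SecondDifference Φ x = ∀ n → x (2 ℕ.+ n) + x n ≈ x (1 ℕ.+ n) + x (1 ℕ.+ n) + Φ n (x n)

  unique : ∀ {Φ x y} → (∀ n {u v} → u ≈ v → Φ n u ≈ Φ n v) →
    SecondDifference Φ x → SecondDifference Φ y → x 0 ≈ y 0 → x 1 ≈ y 1 → ∀ n → x n ≈ y n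
  unique {Φ} {x} {y} Φ-cong x-rec y-rec x₀≈y₀ x₁≈y₁ = go
    where
    go : ∀ n → x n ≈ y n
    go zero          = x₀≈y₀
    go (suc zero)    = x₁≈y₁
    go (suc (suc n)) = +-cancelʳ (x n) _ _ (begin
      x (2 ℕ.+ n) + x n                        ≈⟨ x-rec n ⟩
      x (1 ℕ.+ n) + x (1 ℕ.+ n) + Φ n (x n)    ≈⟨ +-cong (+-cong (go (suc n)) (go (suc n))) (Φ-cong n (go n)) ⟩
      y (1 ℕ.+ n) + y (1 ℕ.+ n) + Φ n (y n)    ≈⟨ sym (y-rec n) ⟩
      y (2 ℕ.+ n) + y n                        ≈⟨ +-congˡ (sym (go n)) ⟩
      y (2 ℕ.+ n) + x n                        ∎)

  -- Here d n stands for 1 − τ n; the relations for S say that (1 − τ n) S n = 2 S (n−1) − S (n−2).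
  module ClearDenominators (τ d : ℕ → Carrier) (d+τ≈1 : ∀ n → d n + τ n ≈ 1#) (S : ℕ → Carrier)
    (S-0 : S 0 ≈ 1# + τ 0 * S 0) (S-1 : S 1 + 1# ≈ S 0 + S 0 + τ 1 * S 1)
    (S-rec : ∀ n → S (2 ℕ.+ n) + S n ≈ S (1 ℕ.+ n) + S (1 ℕ.+ n) + τ (2 ℕ.+ n) * S (2 ℕ.+ n)) where

    denom N : ℕ → Carrier
    denom n = ∏ (upTo (suc n)) d
    N n = S n * denom n

    denom-suc : ∀ n → denom (suc n) ≈ denom n * d (suc n)
    denom-suc n = begin
      ∏ (upTo (2 ℕ.+ n)) d                   ≡⟨ ≡.cong (λ xs → ∏ xs d) (≡.sym (List.upTo-∷ʳ (suc n))) ⟩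
      ∏ (upTo (suc n) ++ suc n ∷ []) d       ≈⟨ ∏-++ (upTo (suc n)) _ d ⟩
      denom n * (d (suc n) * 1#)             ≈⟨ *-congˡ (*-identityʳ _) ⟩
      denom n * d (suc n)                    ∎

    split : ∀ n x → x ≈ x * d n + τ n * x
    split n x = begin
      x                     ≈⟨ sym (*-identityʳ x) ⟩
      x * 1#                ≈⟨ *-congˡ (sym (d+τ≈1 n)) ⟩
      x * (d n + τ n)       ≈⟨ solve 3 (λ x d t → x :* (d :+ t) := (x :* d) :+ (t :* x)) refl _ _ _ ⟩
      x * d n + τ n * x     ∎

    peel : ∀ n {u v} → S n + u ≈ v + τ n * S n → S n * d n + u ≈ v
    peel n {u} {v} eq = +-cancelʳ (τ n * S n) _ _ (begin
      S n * d n + u + τ n * S n     ≈⟨ solve 3 (λ a b c → (a :+ b) :+ c := (a :+ c) :+ b) refl _ _ _ ⟩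
      S n * d n + τ n * S n + u     ≈⟨ +-congʳ (sym (split n (S n))) ⟩
      S n + u                       ≈⟨ eq ⟩
      v + τ n * S n                 ∎)

    N-0 : N 0 ≈ 1#
    N-0 = begin
      S 0 * (d 0 * 1#)     ≈⟨ *-congˡ (*-identityʳ _) ⟩
      S 0 * d 0            ≈⟨ sym (+-identityʳ _) ⟩
      S 0 * d 0 + 0#       ≈⟨ peel 0 (trans (+-identityʳ _) S-0) ⟩
      1#                   ∎

    -- Since `S 0 * d 0` is 1, multiplying S 1 d 1 = 2 S 0 - 1 by d 0 gives 2 - d 0 = 1 + τ 0.
    N-1 : N 1 ≈ 1# + τ 0
    N-1 = +-cancelʳ 1# _ _ (begin
      N 1 + 1#                                ≈⟨ +-cong (*-congˡ (denom-suc 0)) (sym (d+τ≈1 0)) ⟩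
      S 1 * (denom 0 * d 1) + (d 0 + τ 0)     ≈⟨ +-congˡ (+-congʳ (sym (*-identityʳ (d 0)))) ⟩
      S 1 * (denom 0 * d 1) + (denom 0 + τ 0)
        ≈⟨ solve 4 (λ s e f t → (s :* (e :* f)) :+ (e :+ t) := (((s :* f) :+ con 1) :* e) :+ t) refl _ _ _ _ ⟩
      (S 1 * d 1 + 1#) * denom 0 + τ 0        ≈⟨ +-congʳ (*-congʳ (peel 1 S-1)) ⟩
      (S 0 + S 0) * denom 0 + τ 0             ≈⟨ +-congʳ (trans (distribʳ _ _ _) (+-cong N-0 N-0)) ⟩
      1# + 1# + τ 0                           ≈⟨ solve 1 (λ t → (con 1 :+ con 1) :+ t := (con 1 :+ t) :+ con 1) refl _ ⟩
      1# + τ 0 + 1#                           ∎)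

    -- After multiplication by `denom (2 + n)` the factor d (2 + n) is absorbed by the relation for
    -- S, leaving `denom (suc n)` as common denominator. `N n` lacks one factor of it; writing 1 as
    -- d (suc n) + τ (suc n) supplies the factor and leaves the last term.
    N-rec : SecondDifference (λ n x → τ (suc n) * x) N
    N-rec n = begin
      N (2 ℕ.+ n) + N n
        ≈⟨ +-cong (*-congˡ (denom-suc (suc n))) (split (suc n) (N n)) ⟩
      S (2 ℕ.+ n) * (denom (suc n) * d (2 ℕ.+ n)) + (S n * denom n * d (suc n) + τ (suc n) * N n)
        ≈⟨ solve 7 (λ s u v w x y z → (s :* (u :* v)) :+ (((w :* x) :* y) :+ z) := (((s :* v) :* u) :+ (w :* (x :* y))) :+ z)
             refl _ _ _ _ _ _ _ ⟩
      S (2 ℕ.+ n) * d (2 ℕ.+ n) * denom (suc n) + S n * (denom n * d (suc n)) + τ (suc n) * N n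
        ≈⟨ +-congʳ (trans (+-congˡ (*-congˡ (sym (denom-suc n)))) (sym (distribʳ _ _ _))) ⟩
      (S (2 ℕ.+ n) * d (2 ℕ.+ n) + S n) * denom (suc n) + τ (suc n) * N n
        ≈⟨ +-congʳ (trans (*-congʳ (peel (2 ℕ.+ n) (S-rec n))) (distribʳ _ _ _)) ⟩
      N (1 ℕ.+ n) + N (1 ℕ.+ n) + τ (suc n) * N n ∎

-- Words

starts? : ∀ p a → Dec (a ≡ L × p ≡ R)
starts? p a = (a ≟ᴸ L) ×-dec (p ≟ᴸ R)

-- Reading a word as if R preceded it merges the two alternatives of `StartsLBlock`: the first
-- position then needs no separate clause. A general preceding letter is what the tails of a word
-- require.
previous : ∀ {m} → Letter → Vec Letter m → Fin m → Letter
previous p w       zero    = p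
previous p (a ∷ w) (suc j) = previous a w j

previous-suc : ∀ {m} p (w : Vec Letter (suc m)) j → previous p w (suc j) ≡ lookup w (inject₁ j)
previous-suc p (a ∷ b ∷ w) zero    = ≡.refl
previous-suc p (a ∷ b ∷ w) (suc j) = previous-suc a (b ∷ w) j

previous≡R⇔ : ∀ {m} (w : Vec Letter m) j →
  previous R w j ≡ R ⇔ (toℕ j ≡ 0 ⊎ ∃[ i ] (suc (toℕ i) ≡ toℕ j × lookup w i ≡ R))
previous≡R⇔ w           zero    = mk⇔ (λ _ → inj₁ ≡.refl) (λ _ → ≡.refl)
previous≡R⇔ {suc (suc m)} w (suc j) = mk⇔
  (λ eq → inj₂ (inject₁ j , ≡.cong suc (Fin.toℕ-inject₁ j) , ≡.trans (≡.sym (previous-suc R w j)) eq))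
  λ { (inj₂ (i , i+1≡j+1 , wᵢ≡R)) → ≡.trans (previous-suc R w j)
        (≡.subst (λ k → lookup w k ≡ R)
          (Fin.toℕ-injective (≡.trans (ℕ.suc-injective i+1≡j+1) (≡.sym (Fin.toℕ-inject₁ j)))) wᵢ≡R) }

does-startsLBlock? : ∀ {m} (w : Vec Letter m) j →
  does (startsLBlock? w j) ≡ does (starts? (previous R w j) (lookup w j))
does-startsLBlock? w j = does-⇔
  (mk⇔ (λ (wⱼ≡L , eq) → wⱼ≡L , Equivalence.from (previous≡R⇔ w j) eq)
       (λ (wⱼ≡L , eq) → wⱼ≡L , Equivalence.to (previous≡R⇔ w j) eq))
  (startsLBlock? w j) (starts? (previous R w j) (lookup w j))

module WordSums (𝓡 : CommutativeRing 0ℓ 0ℓ) (τ : ℕ → CommutativeRing.Carrier 𝓡) where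
  open CommutativeRing 𝓡 hiding (zero)
  open Ring rawRing using (∑; ∏)
  open Sums 𝓡
  open SetoidReasoning setoid
  open NaturalSolver commutativeSemiring using (solve; con; _:=_; _:+_; _:*_)

  factor : Letter → Letter → ℕ → Carrier
  factor p a s = if does (starts? p a) then τ s else 1#

  -- The weight of a word placed at position s after the letter p.
  weight : ∀ {m} → Letter → ℕ → Vec Letter m → Carrier
  weight p s []      = 1#
  weight p s (a ∷ w) = factor p a s * weight a (suc s) w

  -- Stated for `tabulate f` with arbitrary f, because the tail of `allFin` is not itself an
  -- `allFin`; the two hypotheses transport the decision and the position through f.
  ∏-filter : ∀ {m} {A : Set} {Q : A → Set} (Q? : Decidable Q) (g : A → Carrier) (f : Fin m → A) p s w →
    (∀ j → does (Q? (f j)) ≡ does (starts? (previous p w j) (lookup w j))) →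
    (∀ j → g (f j) ≈ τ (s ℕ.+ toℕ j)) →
    ∏ (filter Q? (tabulate f)) g ≈ weight p s w
  ∏-filter Q? g f p s []      eq g≈ = refl
  ∏-filter {A = A} Q? g f p s (a ∷ w) eq g≈ = begin
    ∏ (filter Q? (f zero ∷ tabulate (f ∘ suc))) g                                    ≈⟨ split ⟩
    (if does (Q? (f zero)) then g (f zero) else 1#) * ∏ (filter Q? (tabulate (f ∘ suc))) g
      ≈⟨ *-cong (first (eq zero)) (∏-filter Q? g (f ∘ suc) a (suc s) w (eq ∘ suc)
           (λ j → trans (g≈ (suc j)) (reflexive (≡.cong τ (ℕ.+-suc s (toℕ j)))))) ⟩
    factor p a s * weight a (suc s) w ∎
    where
    split : ∏ (filter Q? (f zero ∷ tabulate (f ∘ suc))) g ≈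
            (if does (Q? (f zero)) then g (f zero) else 1#) * ∏ (filter Q? (tabulate (f ∘ suc))) g
    split with does (Q? (f zero))
    ... | true  = refl
    ... | false = sym (*-identityˡ _)
    first : ∀ {b c} → b ≡ c → (if b then g (f zero) else 1#) ≈ (if c then τ s else 1#)
    first {true}  ≡.refl = trans (g≈ zero) (reflexive (≡.cong τ (ℕ.+-identityʳ s)))
    first {false} ≡.refl = refl

  U : Letter → ℕ → ℕ → Carrier
  U p s m = ∑ (words m) (weight p s)

  U-0 : ∀ p s → U p s 0 ≈ 1#
  U-0 p s = +-identityʳ 1#

  U-suc : ∀ p s m → U p s (suc m) ≈ factor p L s * U L (suc s) m + factor p R s * U R (suc s) m
  U-suc p s m = begin
    ∑ (words (suc m)) (weight p s)
      ≈⟨ ∑-cartesianProductWith _∷_ (L ∷ R ∷ []) (words m) (weight p s) ⟩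
    ∑ (words m) (λ w → factor p L s * weight L (suc s) w) + (∑ (words m) (λ w → factor p R s * weight R (suc s) w) + 0#)
      ≈⟨ +-cong (∑-*ˡ (words m) _ _) (trans (+-identityʳ _) (∑-*ˡ (words m) _ _)) ⟩
    factor p L s * U L (suc s) m + factor p R s * U R (suc s) m ∎

  U-1 : ∀ p s → U p s 1 ≈ factor p L s + factor p R s
  U-1 p s = trans (U-suc p s 0) (+-cong (trans (*-congˡ (U-0 L (suc s))) (*-identityʳ _)) (trans (*-congˡ (U-0 R (suc s))) (*-identityʳ _)))

  -- The argument s + suc m is the last position of a word of length 2 + m placed at s. Removing the
  -- first letter does not move that position, so the same value of `τ` factors out of both
  -- branches.
  U-recurrence : ∀ p s m →
    U p s (2 ℕ.+ m) + U p s m ≈ U p s (1 ℕ.+ m) + U p s (1 ℕ.+ m) + τ (s ℕ.+ suc m) * U p s m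
  U-recurrence p s zero = begin
    U p s 2 + U p s 0
      ≈⟨ +-cong (trans (U-suc p s 1) (+-cong (*-congˡ (U-1 L (suc s))) (*-congˡ (U-1 R (suc s))))) (U-0 p s) ⟩
    factor p L s * (1# + 1#) + factor p R s * (τ (suc s) + 1#) + 1#
      ≈⟨ base p ⟩
    factor p L s + factor p R s + (factor p L s + factor p R s) + τ (suc s) * 1#
      ≈⟨ sym (+-cong (+-cong (U-1 p s) (U-1 p s)) (*-cong (reflexive (≡.cong τ (ℕ.+-comm s 1))) (U-0 p s))) ⟩
    U p s 1 + U p s 1 + τ (s ℕ.+ 1) * U p s 0 ∎
    where
    base : ∀ p → factor p L s * (1# + 1#) + factor p R s * (τ (suc s) + 1#) + 1# ≈
      factor p L s + factor p R s + (factor p L s + factor p R s) + τ (suc s) * 1#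
    base L = solve 1 (λ y → ((con 1 :* (con 1 :+ con 1)) :+ (con 1 :* (y :+ con 1))) :+ con 1
                         := ((con 1 :+ con 1) :+ (con 1 :+ con 1)) :+ (y :* con 1)) refl (τ (suc s))
    base R = solve 2 (λ x y → ((x :* (con 1 :+ con 1)) :+ (con 1 :* (y :+ con 1))) :+ con 1
                         := ((x :+ con 1) :+ (x :+ con 1)) :+ (y :* con 1)) refl (τ s) (τ (suc s))
  U-recurrence p s (suc m) = begin
    U p s (3 ℕ.+ m) + U p s (1 ℕ.+ m)
      ≈⟨ +-cong (U-suc p s (2 ℕ.+ m)) (U-suc p s m) ⟩
    c * U L s′ (2 ℕ.+ m) + d * U R s′ (2 ℕ.+ m) + (c * U L s′ m + d * U R s′ m)
      ≈⟨ solve 6 (λ c d u v x y → ((c :* u) :+ (d :* v)) :+ ((c :* x) :+ (d :* y))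
                     := (c :* (u :+ x)) :+ (d :* (v :+ y))) refl _ _ _ _ _ _ ⟩
    c * (U L s′ (2 ℕ.+ m) + U L s′ m) + d * (U R s′ (2 ℕ.+ m) + U R s′ m)
      ≈⟨ +-cong (*-congˡ (U-recurrence L s′ m)) (*-congˡ (U-recurrence R s′ m)) ⟩
    c * (U L s′ (1 ℕ.+ m) + U L s′ (1 ℕ.+ m) + t * U L s′ m) + d * (U R s′ (1 ℕ.+ m) + U R s′ (1 ℕ.+ m) + t * U R s′ m)
      ≈⟨ solve 7 (λ c d u v x y t → (c :* ((u :+ u) :+ (t :* x))) :+ (d :* ((v :+ v) :+ (t :* y)))
                     := (((c :* u) :+ (d :* v)) :+ ((c :* u) :+ (d :* v))) :+ (t :* ((c :* x) :+ (d :* y)))) refl _ _ _ _ _ _ _ ⟩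
    c * U L s′ (1 ℕ.+ m) + d * U R s′ (1 ℕ.+ m) + (c * U L s′ (1 ℕ.+ m) + d * U R s′ (1 ℕ.+ m)) + t * (c * U L s′ m + d * U R s′ m)
      ≈⟨ sym (+-cong (+-cong (U-suc p s (1 ℕ.+ m)) (U-suc p s (1 ℕ.+ m)))
           (*-cong (reflexive (≡.cong τ (ℕ.+-suc s (suc m)))) (U-suc p s m))) ⟩
    U p s (2 ℕ.+ m) + U p s (2 ℕ.+ m) + τ (s ℕ.+ suc (suc m)) * U p s (1 ℕ.+ m) ∎
    where
    s′ = suc s
    c = factor p L s
    d = factor p R s
    t = τ (s′ ℕ.+ suc m)

-- Weak chains

module Restriction (𝓡 : CommutativeRing 0ℓ 0ℓ) where
  open CommutativeRing 𝓡 hiding (zero)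
  open Ring rawRing using (∑)
  open Sums 𝓡

  restrict : Bool → Carrier → Carrier
  restrict b x = if b then x else 0#

  restrict-cong : ∀ b {x y} → x ≈ y → restrict b x ≈ restrict b y
  restrict-cong true  x≈y = x≈y
  restrict-cong false x≈y = refl

  restrict-*ʳ : ∀ b x y → restrict b x * y ≈ restrict b (x * y)
  restrict-*ʳ true  x y = refl
  restrict-*ʳ false x y = zeroˡ y

  restrict-*ˡ : ∀ b x y → x * restrict b y ≈ restrict b (x * y)
  restrict-*ˡ true  x y = refl
  restrict-*ˡ false x y = zeroʳ x

  restrict-∑ : ∀ {A : Set} b (xs : List A) f → ∑ xs (λ x → restrict b (f x)) ≈ restrict b (∑ xs f)
  restrict-∑ true  xs f = refl
  restrict-∑ false xs f = ∑-0 xs (λ _ → refl)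

  ∑-filter : ∀ {A : Set} {Q : A → Set} (Q? : Decidable Q) xs f →
    ∑ (filter Q? xs) f ≈ ∑ xs (λ x → restrict (does (Q? x)) (f x))
  ∑-filter Q? []       f = refl
  ∑-filter Q? (x ∷ xs) f with does (Q? x)
  ... | true  = +-congˡ (∑-filter Q? xs f)
  ... | false = trans (∑-filter Q? xs f) (sym (+-identityˡ _))

  ∑-mapMaybe : ∀ {A B : Set} (h : A → Maybe B) xs f →
    ∑ (mapMaybe h xs) f ≈ ∑ xs (maybe′ f 0# ∘ h)
  ∑-mapMaybe h []       f = refl
  ∑-mapMaybe h (x ∷ xs) f with h x
  ... | just y  = +-congˡ (∑-mapMaybe h xs f)
  ... | nothing = trans (∑-mapMaybe h xs f) (sym (+-identityˡ _))

  ∑-allFin : ∀ n (f : ℕ → Carrier) → ∑ (allFin n) (f ∘ toℕ) ≡ ∑ (upTo n) f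
  ∑-allFin n f = ≡.cong (foldr _+_ 0#)
    (≡.trans (List.map-tabulate id (f ∘ toℕ)) (≡.trans (tabulate-toℕ n f) (≡.sym (List.map-upTo f n))))
    where
    tabulate-toℕ : ∀ n (f : ℕ → Carrier) → tabulate {n = n} (f ∘ toℕ) ≡ applyUpTo f n
    tabulate-toℕ zero    f = ≡.refl
    tabulate-toℕ (suc n) f = ≡.cong (f 0 ∷_) (tabulate-toℕ n (f ∘ suc))

  within? : ∀ i j b → Dec (i ℕ.≤ b × b ℕ.≤ j)
  within? i j b = (i ℕ.≤? b) ×-dec (b ℕ.≤? j)

  ∑-interval : ∀ {i j r} → i ℕ.≤ j → j ℕ.< r → ∀ (f : ℕ → Carrier) →
    ∑ (upTo r) (λ b → restrict (does (within? i j b)) (f b)) ≈ ∑ (upTo (suc (j ∸ i))) (λ d → f (i ℕ.+ d))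
  ∑-interval {i} {j} {r} i≤j j<r f = begin
    ∑ (upTo r) g
      ≡⟨ ≡.cong (λ m → ∑ (upTo m) g) (≡.sym r≡) ⟩
    ∑ (upTo (i ℕ.+ (l ℕ.+ (r ∸ suc j)))) g
      ≈⟨ trans (∑-upTo-+ i _ g) (+-congˡ (∑-upTo-+ l (r ∸ suc j) _)) ⟩
    ∑ (upTo i) g + (∑ (upTo l) (λ d → g (i ℕ.+ d)) + ∑ (upTo (r ∸ suc j)) (λ d → g (i ℕ.+ (l ℕ.+ d))))
      ≈⟨ +-cong (∑-upTo-0 i (λ b b<i → outside b (λ (i≤b , _) → ℕ.<⇒≱ b<i i≤b)))
           (+-cong (∑-upTo-cong l (λ d → inside d))
             (∑-upTo-0 (r ∸ suc j) (λ d _ → outside _ (λ (_ , b≤j) → ℕ.<⇒≱ (above d) b≤j)))) ⟩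
    0# + (∑ (upTo l) (λ d → f (i ℕ.+ d)) + 0#)
      ≈⟨ trans (+-identityˡ _) (+-identityʳ _) ⟩
    ∑ (upTo l) (λ d → f (i ℕ.+ d)) ∎
    where
    open SetoidReasoning setoid
    l = suc (j ∸ i)
    g : ℕ → Carrier
    g b = restrict (does (within? i j b)) (f b)
    i+l≡ : i ℕ.+ l ≡ suc j
    i+l≡ = ≡.trans (ℕ.+-suc i (j ∸ i)) (≡.cong suc (ℕ.m+[n∸m]≡n i≤j))
    r≡ : i ℕ.+ (l ℕ.+ (r ∸ suc j)) ≡ r
    r≡ = ≡.trans (≡.sym (ℕ.+-assoc i l _)) (≡.trans (≡.cong (ℕ._+ (r ∸ suc j)) i+l≡) (ℕ.m+[n∸m]≡n j<r))
    outside : ∀ b → ¬ (i ℕ.≤ b × b ℕ.≤ j) → g b ≈ 0#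
    outside b ¬p = reflexive (≡.cong (λ c → restrict c (f b)) (dec-false (within? i j b) ¬p))
    inside : ∀ d → d ℕ.< l → g (i ℕ.+ d) ≈ f (i ℕ.+ d)
    inside d (ℕ.s≤s d≤) = reflexive (≡.cong (λ c → restrict c (f (i ℕ.+ d)))
      (dec-true (within? i j (i ℕ.+ d)) (ℕ.m≤m+n i d , ℕ.≤-trans (ℕ.+-monoʳ-≤ i d≤) (ℕ.≤-reflexive (ℕ.m+[n∸m]≡n i≤j)))))
    above : ∀ d → j ℕ.< i ℕ.+ (l ℕ.+ d)
    above d = ℕ.≤-trans (ℕ.≤-reflexive (≡.sym i+l≡)) (ℕ.+-monoʳ-≤ i (ℕ.m≤m+n l d))

module ChainSums (𝓡 : CommutativeRing 0ℓ 0ℓ) {A : Set} {_≼_ : A → A → Set} (_≼?_ : Decidable₂ _≼_)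
                 (es : List A) (ω : A → CommutativeRing.Carrier 𝓡) where
  open CommutativeRing 𝓡 hiding (zero)
  open Ring rawRing using (∑)
  open Sums 𝓡
  open Restriction 𝓡
  open SetoidReasoning setoid
  open NaturalSolver commutativeSemiring using (solve; _:=_; _:+_; _:*_)

  weight : ∀ {m} → Vec A m → Carrier
  weight []      = 1#
  weight (x ∷ v) = ω x * weight v

  total : ℕ → Carrier
  total m = ∑ (filter (Linked.linked? _≼?_) (tuples es m)) weight

  -- Tuples are built by prepending, so `above` follows their enumeration, while a maximum bounds
  -- the last entry of a chain, which is what `below` tracks. Chains cut at an entry mediate between
  -- the two.
  above below : ℕ → A → Carrier
  above m x = ∑ (tuples es m) (λ v → restrict (does (Linked.linked? _≼?_ (x ∷ v))) (weight v))
  below zero    y = 1#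
  below (suc m) y = ∑ es (λ x → restrict (does (x ≼? y)) (ω x * below m x))

  above-zero : ∀ x → above 0 x ≈ 1#
  above-zero x = +-identityʳ 1#

  above-suc : ∀ m x → above (suc m) x ≈ ∑ es (λ y → restrict (does (x ≼? y)) (ω y * above m y))
  above-suc m x = trans (∑-cartesianProductWith _∷_ es (tuples es m) _) (∑-cong es λ y → begin
    ∑ (tuples es m) (λ v → restrict (does (x ≼? y) ∧ does (Linked.linked? _≼?_ (y ∷ v))) (ω y * weight v))
      ≈⟨ ∑-cong (tuples es m) (λ v → split (does (x ≼? y)) _ (ω y) (weight v)) ⟩
    ∑ (tuples es m) (λ v → restrict (does (x ≼? y)) (ω y * restrict (does (Linked.linked? _≼?_ (y ∷ v))) (weight v)))
      ≈⟨ trans (restrict-∑ (does (x ≼? y)) (tuples es m) _) (restrict-cong (does (x ≼? y)) (∑-*ˡ (tuples es m) _ _)) ⟩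
    restrict (does (x ≼? y)) (ω y * above m y) ∎)
    where
    split : ∀ b c u v → restrict (b ∧ c) (u * v) ≈ restrict b (u * restrict c v)
    split true  c u v = sym (restrict-*ˡ c u v)
    split false c u v = refl

  total-zero : total 0 ≈ 1#
  total-zero = +-identityʳ 1#

  total-suc : ∀ m → total (suc m) ≈ ∑ es (λ y → ω y * above m y)
  total-suc m = begin
    total (suc m)
      ≈⟨ ∑-filter (Linked.linked? _≼?_) (tuples es (suc m)) weight ⟩
    ∑ (tuples es (suc m)) (λ v → restrict (does (Linked.linked? _≼?_ v)) (weight v))
      ≈⟨ ∑-cartesianProductWith _∷_ es (tuples es m) _ ⟩
    ∑ es (λ y → ∑ (tuples es m) (λ v → restrict (does (Linked.linked? _≼?_ (y ∷ v))) (ω y * weight v)))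
      ≈⟨ ∑-cong es (λ y → trans (∑-cong (tuples es m) (λ v → sym (restrict-*ˡ _ (ω y) (weight v)))) (∑-*ˡ (tuples es m) _ _)) ⟩
    ∑ es (λ y → ω y * above m y) ∎

  -- A chain of length a + 1 + b, cut at its element number a + 1.
  pairing : ℕ → ℕ → Carrier
  pairing a b = ∑ es (λ y → ω y * (below a y * above b y))

  -- Both sides run over adjacent entries y ≼ z of a chain; exchanging the two sums moves the cut
  -- from y to z.
  pairing-shift : ∀ a b → pairing a (suc b) ≈ pairing (suc a) b
  pairing-shift a b = begin
    ∑ es (λ y → ω y * (below a y * above (suc b) y))
      ≈⟨ ∑-cong es (λ y → trans (*-congˡ (*-congˡ (above-suc b y))) (trans (sym (*-assoc _ _ _)) (sym (∑-*ˡ es _ _)))) ⟩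
    ∑ es (λ y → ∑ es (λ z → ω y * below a y * restrict (does (y ≼? z)) (ω z * above b z)))
      ≈⟨ ∑-swap es es _ ⟩
    ∑ es (λ z → ∑ es (λ y → ω y * below a y * restrict (does (y ≼? z)) (ω z * above b z)))
      ≈⟨ ∑-cong es (λ z → ∑-cong es (λ y → begin
           ω y * below a y * restrict (does (y ≼? z)) (ω z * above b z)     ≈⟨ restrict-*ˡ (does (y ≼? z)) _ _ ⟩
           restrict (does (y ≼? z)) (ω y * below a y * (ω z * above b z))   ≈⟨ sym (restrict-*ʳ (does (y ≼? z)) _ _) ⟩
           restrict (does (y ≼? z)) (ω y * below a y) * (ω z * above b z)   ∎)) ⟩
    ∑ es (λ z → ∑ es (λ y → restrict (does (y ≼? z)) (ω y * below a y) * (ω z * above b z)))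
      ≈⟨ ∑-cong es (λ z → trans (∑-*ʳ es _ _) (solve 3 (λ x u v → x :* (u :* v) := u :* (x :* v)) refl _ _ _)) ⟩
    ∑ es (λ z → ω z * (below (suc a) z * above b z)) ∎

  pairing-0 : ∀ a b → pairing a b ≈ pairing (a ℕ.+ b) 0
  pairing-0 a zero    = reflexive (≡.cong (λ c → pairing c 0) (≡.sym (ℕ.+-identityʳ a)))
  pairing-0 a (suc b) = trans (pairing-shift a b)
    (trans (pairing-0 (suc a) b) (reflexive (≡.cong (λ c → pairing c 0) (≡.sym (ℕ.+-suc a b)))))

  total≈below-maximum : ∀ ⊤ → (∀ x → x ≼ ⊤) → ∀ m → total m ≈ below m ⊤
  total≈below-maximum ⊤ max zero    = total-zero
  total≈below-maximum ⊤ max (suc m) = begin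
    total (suc m)                                              ≈⟨ total-suc m ⟩
    ∑ es (λ y → ω y * above m y)                               ≈⟨ ∑-cong es (λ y → *-congˡ (sym (*-identityˡ _))) ⟩
    pairing 0 m                                                ≈⟨ pairing-0 0 m ⟩
    pairing m 0                                                ≈⟨ ∑-cong es (λ y → *-congˡ (trans (*-congˡ (above-zero y)) (*-identityʳ _))) ⟩
    ∑ es (λ y → ω y * below m y)                               ≈⟨ ∑-cong es (λ y → reflexive (≡.cong (λ b → restrict b (ω y * below m y)) (≡.sym (dec-true (y ≼? ⊤) (max y))))) ⟩
    below (suc m) ⊤                                            ∎

-- The partial map through which posRoots is defined is private there; unification recovers it.
rootEnumeration : ∀ r → Σ[ h ∈ (Fin r × Fin r → Maybe (PosRoot r)) ]
  posRoots r ≡ mapMaybe h (cartesianProduct (allFin r) (allFin r))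
rootEnumeration r = _ , ≡.refl

module RootSums (𝓡 : CommutativeRing 0ℓ 0ℓ) where
  open CommutativeRing 𝓡 hiding (zero)
  open Ring rawRing using (∑)
  open Sums 𝓡
  open Restriction 𝓡
  open SetoidReasoning setoid

  ∑-posRoots : ∀ r (f : PosRoot r → Carrier) (g : ℕ → ℕ → Carrier) →
    (∀ i j i≤j → f (root i j i≤j) ≈ g (toℕ i) (toℕ j)) →
    ∑ (posRoots r) f ≈ ∑ (upTo r) (λ a → ∑ (upTo r) (λ b → restrict (does (a ℕ.≤? b)) (g a b)))
  ∑-posRoots r f g f≈g = begin
    ∑ (posRoots r) f
      ≡⟨ ≡.cong (λ xs → ∑ xs f) (proj₂ (rootEnumeration r)) ⟩
    ∑ (mapMaybe h (cartesianProduct (allFin r) (allFin r))) f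
      ≈⟨ ∑-mapMaybe h (cartesianProduct (allFin r) (allFin r)) f ⟩
    ∑ (cartesianProduct (allFin r) (allFin r)) (maybe′ f 0# ∘ h)
      ≈⟨ ∑-cartesianProductWith _,_ (allFin r) (allFin r) _ ⟩
    ∑ (allFin r) (λ i → ∑ (allFin r) (λ j → maybe′ f 0# (h (i , j))))
      ≈⟨ ∑-cong (allFin r) (λ i → trans (∑-cong (allFin r) (entry i)) (reflexive (∑-allFin r (G (toℕ i))))) ⟩
    ∑ (allFin r) (λ i → ∑ (upTo r) (G (toℕ i)))
      ≡⟨ ∑-allFin r (λ a → ∑ (upTo r) (G a)) ⟩
    ∑ (upTo r) (λ a → ∑ (upTo r) (G a)) ∎
    where
    h = proj₁ (rootEnumeration r)
    G : ℕ → ℕ → Carrier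
    G a b = restrict (does (a ℕ.≤? b)) (g a b)
    entry : ∀ i j → maybe′ f 0# (h (i , j)) ≈ G (toℕ i) (toℕ j)
    entry i j with i Fin.≤? j
    ... | yes i≤j = trans (f≈g i j i≤j)
      (reflexive (≡.cong (λ c → restrict c (g (toℕ i) (toℕ j))) (≡.sym (dec-true (toℕ i ℕ.≤? toℕ j) i≤j))))
    ... | no  i≰j =
      reflexive (≡.cong (λ c → restrict c (g (toℕ i) (toℕ j))) (≡.sym (dec-false (toℕ i ℕ.≤? toℕ j) i≰j)))

  -- Here g e occurs n - e + 1 times, the number of roots of rank e below a root of rank n. As an
  -- iterated partial sum it has a second difference consisting of one term.
  ∑∑ : (ℕ → Carrier) → ℕ → Carrier
  ∑∑ g n = ∑ (upTo (suc n)) (λ e → ∑ (upTo (suc e)) g)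

  ∑-below-root : ∀ r (β : PosRoot r) (f : PosRoot r → Carrier) (g : ℕ → Carrier) →
    (∀ α → f α ≈ g (toℕ (PosRoot.j α) ∸ toℕ (PosRoot.i α))) → (_≤?_ : Decidable₂ (_⊑_ {r})) →
    (∀ α → does (α ≤? β) ≡ does (toℕ (PosRoot.i β) ℕ.≤? toℕ (PosRoot.i α)) ∧ does (toℕ (PosRoot.j α) ℕ.≤? toℕ (PosRoot.j β))) →
    ∑ (posRoots r) (λ α → restrict (does (α ≤? β)) (f α)) ≈ ∑∑ g (toℕ (PosRoot.j β) ∸ toℕ (PosRoot.i β))
  ∑-below-root r (root i′ j′ i′≤j′) f g f≈g _≤?_ does≡ = begin
    ∑ (posRoots r) (λ α → restrict (does (α ≤? root i′ j′ i′≤j′)) (f α))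
      ≈⟨ ∑-posRoots r _ (λ a b → restrict (does (i ℕ.≤? a) ∧ does (b ℕ.≤? j)) (g (b ∸ a)))
           (λ a b a≤b → trans (reflexive (≡.cong (λ c → restrict c _) (does≡ (root a b a≤b)))) (restrict-cong (does (i ℕ.≤? toℕ a) ∧ does (toℕ b ℕ.≤? j)) (f≈g _))) ⟩
    ∑ (upTo r) (λ a → ∑ (upTo r) (λ b → restrict (does (a ℕ.≤? b)) (restrict (does (i ℕ.≤? a) ∧ does (b ℕ.≤? j)) (g (b ∸ a)))))
      ≈⟨ ∑-cong (upTo r) (λ a → trans (∑-cong (upTo r) (λ b → regroup a b (g (b ∸ a)))) (restrict-∑ (does (within? i j a)) (upTo r) _)) ⟩
    ∑ (upTo r) (λ a → restrict (does (within? i j a)) (∑ (upTo r) (λ b → restrict (does (within? a j b)) (g (b ∸ a)))))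
      ≈⟨ ∑-interval i′≤j′ (Fin.toℕ<n j′) _ ⟩
    ∑ (upTo (suc (j ∸ i))) (λ d → ∑ (upTo r) (λ b → restrict (does (within? (i ℕ.+ d) j b)) (g (b ∸ (i ℕ.+ d)))))
      ≈⟨ ∑-upTo-cong (suc (j ∸ i)) (λ { d (ℕ.s≤s d≤) → ∑-interval
           (ℕ.≤-trans (ℕ.+-monoʳ-≤ i d≤) (ℕ.≤-reflexive (ℕ.m+[n∸m]≡n i′≤j′))) (Fin.toℕ<n j′) _ }) ⟩
    ∑ (upTo (suc (j ∸ i))) (λ d → ∑ (upTo (suc (j ∸ (i ℕ.+ d)))) (λ e → g ((i ℕ.+ d) ℕ.+ e ∸ (i ℕ.+ d))))
      ≈⟨ ∑-cong (upTo (suc (j ∸ i))) (λ d → trans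
           (∑-cong (upTo (suc (j ∸ (i ℕ.+ d)))) (λ e → reflexive (≡.cong g (ℕ.m+n∸m≡n (i ℕ.+ d) e))))
           (reflexive (≡.cong (λ m → ∑ (upTo (suc m)) g) (≡.sym (ℕ.∸-+-assoc j i d))))) ⟩
    ∑ (upTo (suc (j ∸ i))) (λ d → ∑ (upTo (suc ((j ∸ i) ∸ d))) g)
      -- The offset d of the left end limits the rank to (j - i) - d; reversing d lists the partial
      -- sums in increasing order.
      ≈⟨ ∑-upTo-reverse (j ∸ i) (λ e → ∑ (upTo (suc e)) g) ⟩
    ∑∑ g (j ∸ i) ∎
    where
    i = toℕ i′
    j = toℕ j′
    -- The bound a ≤ j, implied by a ≤ b ≤ j, is inserted so that the outer index also runs over an
    -- interval.
    regroup : ∀ a b x → restrict (does (a ℕ.≤? b)) (restrict (does (i ℕ.≤? a) ∧ does (b ℕ.≤? j)) x) ≈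
                        restrict (does (within? i j a)) (restrict (does (within? a j b)) x)
    regroup a b x = by-cases (a ℕ.≤? b) (i ℕ.≤? a) (b ℕ.≤? j) (a ℕ.≤? j)
      where
      by-cases : (p : Dec (a ℕ.≤ b)) (q : Dec (i ℕ.≤ a)) (u : Dec (b ℕ.≤ j)) (v : Dec (a ℕ.≤ j)) →
        restrict (does p) (restrict (does q ∧ does u) x) ≈ restrict (does q ∧ does v) (restrict (does p ∧ does u) x)
      by-cases (yes a≤b) (yes _) (yes b≤j) (yes _)  = refl
      by-cases (yes a≤b) (yes _) (yes b≤j) (no a≰j) = contradiction (ℕ.≤-trans a≤b b≤j) a≰j
      by-cases (yes a≤b) (yes _) (no _)    (yes _)  = refl
      by-cases (yes a≤b) (yes _) (no _)    (no _)   = refl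
      by-cases (yes a≤b) (no _)  _         _        = refl
      by-cases (no _)    (yes _) _         (yes _)  = refl
      by-cases (no _)    (yes _) _         (no _)   = refl
      by-cases (no _)    (no _)  _         _        = refl

-- The numerator of the root poset

module _ (𝓡 : CommutativeRing 0ℓ 0ℓ) where
  open CommutativeRing 𝓡 hiding (zero)
  open NaturalSolver commutativeSemiring using (solve; con; _:=_; _:*_)

  -- The factor `t * 1#` is the unfolded `X ^ 1` occurring in `τ`.
  *-regroup : ∀ a b t u → (a * b) * (t * u) ≈ (a * (t * 1#)) * (b * u)
  *-regroup = solve 4 (λ a b t u → (a :* b) :* (t :* u) := (a :* (t :* con 1)) :* (b :* u)) refl

module RootNumerator (𝓠 : CommutativeRing 0ℓ 0ℓ) (x : CommutativeRing.Carrier 𝓠) where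
  open CommutativeRing 𝓠 hiding (zero)
  open Ring rawRing
  open Sums 𝓠 using (∑-cong; ∑-+; ∑-upTo-∷ʳ; ∑-upTo-cong)
  open Restriction 𝓠
  open RootSums 𝓠
  open SeriesRing 𝓠
  open PolyRing 𝓠
  open Algebra.Properties.Semiring.Exp semiring using (^-homo-*; ^-congʳ)
  open NaturalSolver commutativeSemiring using (solve; con; _:=_; _:+_; _:*_)
  module 𝕊 = CommutativeRing seriesRing
  module ℙ where
    open CommutativeRing polyRing public
    open Ring polynomials public using (_^_; ∑; ∏)

  τ : ℕ → Poly
  τ n = constant (x ^ n) *ₚ X ℙ.^ 1

  wordPoly : ℕ → Poly
  wordPoly m = ℙ.∑ (words m) (λ w → constant (x ^ qExponent w) *ₚ X ℙ.^ length (D w))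

  open WordSums polyRing τ using (U; U-0; U-1; U-recurrence; ∏-filter) renaming (weight to wordWeight)

  monomial-∏ : ∀ {m} (js : List (Fin m)) →
    constant (x ^ ℕ.sum (map toℕ js)) *ₚ X ℙ.^ length js ≈ₚ ℙ.∏ js (τ ∘ toℕ)
  monomial-∏ []       = ℙ.*-identityˡ ℙ.1#
  monomial-∏ (j ∷ js) = begin
    constant (x ^ (toℕ j ℕ.+ s)) *ₚ (X *ₚ X ℙ.^ l)
      ≈⟨ ℙ.*-congʳ {X *ₚ X ℙ.^ l} {constant (x ^ (toℕ j ℕ.+ s))} {constant (x ^ toℕ j) *ₚ constant (x ^ s)}
           (ℙ.trans {constant (x ^ (toℕ j ℕ.+ s))} {constant (x ^ toℕ j * x ^ s)} {constant (x ^ toℕ j) *ₚ constant (x ^ s)}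
             (constant-cong (^-homo-* x (toℕ j) s)) (constant-* _ _)) ⟩
    constant (x ^ toℕ j) *ₚ constant (x ^ s) *ₚ (X *ₚ X ℙ.^ l)
      ≈⟨ *-regroup polyRing (constant (x ^ toℕ j)) (constant (x ^ s)) X (X ℙ.^ l) ⟩
    τ (toℕ j) *ₚ (constant (x ^ s) *ₚ X ℙ.^ l)
      ≈⟨ ℙ.*-congˡ {τ (toℕ j)} {constant (x ^ s) *ₚ X ℙ.^ l} {ℙ.∏ js (τ ∘ toℕ)} (monomial-∏ js) ⟩
    τ (toℕ j) *ₚ ℙ.∏ js (τ ∘ toℕ) ∎
    where
    s = ℕ.sum (map toℕ js)
    l = length js
    open SetoidReasoning ℙ.setoid

  wordPoly≈U : ∀ m → wordPoly m ≈ₚ U R 0 m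
  wordPoly≈U m = Sums.∑-cong polyRing (words m) λ w → begin
    constant (x ^ qExponent w) *ₚ X ℙ.^ length (D w)   ≈⟨ monomial-∏ (D w) ⟩
    ℙ.∏ (D w) (τ ∘ toℕ)                                ≈⟨ ∏-filter (startsLBlock? w) (τ ∘ toℕ) id R 0 w (does-startsLBlock? w) (λ j → ℙ.refl {τ (toℕ j)}) ⟩
    wordWeight R 0 w                                   ∎
    where open SetoidReasoning ℙ.setoid

  -- The weighted count of weak chains of length m below a root of rank n. What lies below a root
  -- depends, up to translation of the indices, only on its rank, so one array serves all roots and
  -- all r.
  κ : ℕ → ℕ → Carrier
  κ zero    n = 1#
  κ (suc m) n = ∑∑ (λ e → x ^ e * κ m e) n

  below≈κ : ∀ r (_≤?_ : Decidable₂ (_⊑_ {r})) →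
    (∀ α β → does (α ≤? β) ≡ does (toℕ (PosRoot.i β) ℕ.≤? toℕ (PosRoot.i α)) ∧ does (toℕ (PosRoot.j α) ℕ.≤? toℕ (PosRoot.j β))) →
    ∀ m α → ChainSums.below 𝓠 _≤?_ (posRoots r) (λ β → x ^ (height β ∸ 1)) m α ≈ κ m (toℕ (PosRoot.j α) ∸ toℕ (PosRoot.i α))
  below≈κ r _≤?_ does≡ zero    α = refl
  below≈κ r _≤?_ does≡ (suc m) α = ∑-below-root r α _ (λ e → x ^ e * κ m e)
    (λ β → *-cong (^-congʳ x (≡.cong (_∸ 1) (height-formula β))) (below≈κ r _≤?_ does≡ m β))
    _≤?_ (λ β → does≡ β α)

  S : ℕ → Series
  S n m = κ m n

  monomial-⊛-zero : ∀ a f → (coeff (constant a *ₚ X ℙ.^ 1) ⊛ f) 0 ≈ 0#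
  monomial-⊛-suc : ∀ a f n → (coeff (constant a *ₚ X ℙ.^ 1) ⊛ f) (suc n) ≈ a * f n
  monomial-⊛-zero a f = trans (⊛-zero (coeff (constant a *ₚ X ℙ.^ 1)) f) (trans (*-congʳ (trans (coeff-constant-* a (X ℙ.^ 1) 0)
    (trans (*-congˡ (coeff-X*-zero ℙ.1#)) (zeroʳ a)))) (zeroˡ (f 0)))
  monomial-⊛-suc a f n = begin
    (coeff aX ⊛ f) (suc n)                              ≡⟨ ⊛-suc (coeff aX) f n ⟩
    coeff aX 0 * f (suc n) + ((coeff aX ∘ suc) ⊛ f) n   ≈⟨ +-cong (*-congʳ (trans (coeff-constant-* a (X ℙ.^ 1) 0) (trans (*-congˡ (coeff-X*-zero ℙ.1#)) (zeroʳ a))))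
                                                             (⊛-cong {g = f} tail (λ _ → refl) n) ⟩
    0# * f (suc n) + (embed a ⊛ f) n                    ≈⟨ +-cong (zeroˡ _) (⊛-embedˡ a f n) ⟩
    0# + a * f n                                        ≈⟨ +-identityˡ _ ⟩
    a * f n                                             ∎
    where
    open SetoidReasoning setoid
    aX = constant a *ₚ X ℙ.^ 1
    tail : (coeff aX ∘ suc) ≈ₛ embed a
    tail k = trans (coeff-constant-* a (X ℙ.^ 1) (suc k)) (trans (*-congˡ (coeff-X*-suc ℙ.1# k)) (last k))
      where
      last : ∀ k → a * coeff ℙ.1# k ≈ embed a k
      last zero    = *-identityʳ a
      last (suc k) = zeroʳ a

  τS : ∀ n k → 𝕊.Carrier
  τS n k = coeff (τ n) ⊛ S k

  S-0 : S 0 ≈ₛ 1ₛ +ₛ τS 0 0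
  S-0 zero    = sym (trans (+-congˡ (monomial-⊛-zero (x ^ 0) (S 0))) (+-identityʳ 1#))
  S-0 (suc m) = sym (trans (+-congˡ (monomial-⊛-suc (x ^ 0) (S 0) m))
    (trans (+-identityˡ _) (sym (trans (+-identityʳ _) (+-identityʳ _)))))

  ∑∑-1 : ∀ g → ∑∑ g 1 ≈ ∑∑ g 0 + ∑∑ g 0 + g 1
  ∑∑-1 g = solve 2 (λ a b → (a :+ con 0) :+ ((a :+ (b :+ con 0)) :+ con 0) := (((a :+ con 0) :+ con 0) :+ ((a :+ con 0) :+ con 0)) :+ b)
    refl (g 0) (g 1)

  -- This plays the part of inclusion-exclusion over the two lower covers: everything cancels except
  -- the term g (2 + n) of the top root.
  ∑∑-rec : ∀ g n → ∑∑ g (2 ℕ.+ n) + ∑∑ g n ≈ ∑∑ g (1 ℕ.+ n) + ∑∑ g (1 ℕ.+ n) + g (2 ℕ.+ n)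
  ∑∑-rec g n = begin
    ∑∑ g (2 ℕ.+ n) + ∑∑ g n
      ≈⟨ +-congʳ (trans (∑-upTo-∷ʳ (2 ℕ.+ n) G) (+-cong (∑-upTo-∷ʳ (1 ℕ.+ n) G) (∑-upTo-∷ʳ (2 ℕ.+ n) g))) ⟩
    ∑∑ g n + G (1 ℕ.+ n) + (G (1 ℕ.+ n) + g (2 ℕ.+ n)) + ∑∑ g n
      ≈⟨ solve 3 (λ a b c → ((a :+ b) :+ (b :+ c)) :+ a := ((a :+ b) :+ (a :+ b)) :+ c) refl _ _ _ ⟩
    ∑∑ g n + G (1 ℕ.+ n) + (∑∑ g n + G (1 ℕ.+ n)) + g (2 ℕ.+ n)
      ≈⟨ +-congʳ (sym (+-cong (∑-upTo-∷ʳ (1 ℕ.+ n) G) (∑-upTo-∷ʳ (1 ℕ.+ n) G))) ⟩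
    ∑∑ g (1 ℕ.+ n) + ∑∑ g (1 ℕ.+ n) + g (2 ℕ.+ n) ∎
    where
    open SetoidReasoning setoid
    G : ℕ → Carrier
    G e = ∑ (upTo (suc e)) g

  -- The general relation continued one step down, with 1 as the chain series of the empty poset,
  -- which has only the empty chain.
  S-1 : S 1 +ₛ 1ₛ ≈ₛ (S 0 +ₛ S 0) +ₛ τS 1 1
  S-1 zero    = sym (trans (+-congˡ (monomial-⊛-zero (x ^ 1) (S 1))) (+-identityʳ _))
  S-1 (suc m) = trans (+-identityʳ _) (trans (∑∑-1 (λ e → x ^ e * κ m e)) (+-congˡ (sym (monomial-⊛-suc (x ^ 1) (S 1) m))))

  S-rec : ∀ n → S (2 ℕ.+ n) +ₛ S n ≈ₛ (S (1 ℕ.+ n) +ₛ S (1 ℕ.+ n)) +ₛ τS (2 ℕ.+ n) (2 ℕ.+ n)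
  S-rec n zero    = sym (trans (+-congˡ (monomial-⊛-zero (x ^ (2 ℕ.+ n)) (S (2 ℕ.+ n)))) (+-identityʳ _))
  S-rec n (suc m) = trans (∑∑-rec (λ e → x ^ e * κ m e) n) (+-congˡ (sym (monomial-⊛-suc (x ^ (2 ℕ.+ n)) (S (2 ℕ.+ n)) m)))

  factor : ℕ → Poly
  factor n = constant 1# +ₚ map -_ (τ n)

  factor+τ≈1 : ∀ n → coeff (factor n) +ₛ coeff (τ n) ≈ₛ 1ₛ
  factor+τ≈1 n k = begin
    coeff (factor n) k + coeff (τ n) k
      ≈⟨ sym (coeff-+ (factor n) (τ n) k) ⟩
    coeff (factor n +ₚ τ n) k
      ≈⟨ ℙ.trans {factor n +ₚ τ n} {constant 1# +ₚ (map -_ (τ n) +ₚ τ n)} {constant 1#}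
           (ℙ.+-assoc (constant 1#) (map -_ (τ n)) (τ n))
           (ℙ.trans {constant 1# +ₚ (map -_ (τ n) +ₚ τ n)} {constant 1# +ₚ []} {constant 1#}
             (ℙ.+-congˡ {constant 1#} {map -_ (τ n) +ₚ τ n} {[]} (ℙ.-‿inverseˡ (τ n)))
             (ℙ.+-identityʳ (constant 1#))) k ⟩
    coeff (constant 1#) k
      ≈⟨ coeff-constant 1# k ⟩
    1ₛ k ∎
    where open SetoidReasoning setoid

  open Recurrence.ClearDenominators seriesRing (coeff ∘ τ) (coeff ∘ factor) factor+τ≈1 S S-0 S-1 S-rec

  coeff-U-recurrence : ∀ n k → coeff (U R 0 (2 ℕ.+ n)) k + coeff (U R 0 n) k ≈
    coeff (U R 0 (1 ℕ.+ n)) k + coeff (U R 0 (1 ℕ.+ n)) k + (coeff (τ (suc n)) ⊛ coeff (U R 0 n)) k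
  coeff-U-recurrence n k = begin
    coeff (U R 0 (2 ℕ.+ n)) k + coeff (U R 0 n) k
      ≈⟨ sym (coeff-+ (U R 0 (2 ℕ.+ n)) (U R 0 n) k) ⟩
    coeff (U R 0 (2 ℕ.+ n) +ₚ U R 0 n) k
      ≈⟨ U-recurrence R 0 n k ⟩
    coeff (U R 0 (1 ℕ.+ n) +ₚ U R 0 (1 ℕ.+ n) +ₚ τ (suc n) *ₚ U R 0 n) k
      ≈⟨ coeff-+ (U R 0 (1 ℕ.+ n) +ₚ U R 0 (1 ℕ.+ n)) (τ (suc n) *ₚ U R 0 n) k ⟩
    coeff (U R 0 (1 ℕ.+ n) +ₚ U R 0 (1 ℕ.+ n)) k + coeff (τ (suc n) *ₚ U R 0 n) k
      ≈⟨ +-cong (coeff-+ (U R 0 (1 ℕ.+ n)) (U R 0 (1 ℕ.+ n)) k) (coeff-* (τ (suc n)) (U R 0 n) k) ⟩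
    coeff (U R 0 (1 ℕ.+ n)) k + coeff (U R 0 (1 ℕ.+ n)) k + (coeff (τ (suc n)) ⊛ coeff (U R 0 n)) k ∎
    where open SetoidReasoning setoid

  N≈U : ∀ n → N n ≈ₛ coeff (U R 0 n)
  N≈U = Recurrence.unique seriesRing {Φ = λ n f → coeff (τ (suc n)) ⊛ f} {N} {coeff ∘ U R 0}
    (λ n {f} {g} f≈g → ⊛-cong {coeff (τ (suc n))} {coeff (τ (suc n))} {f} {g} (λ _ → refl) f≈g)
    N-rec coeff-U-recurrence
    (λ k → trans (N-0 k) (sym (trans (U-0 R 0 k) (coeff-constant 1# k))))
    (λ k → trans (N-1 k) (sym (begin
      coeff (U R 0 1) k                                  ≈⟨ U-1 R 0 k ⟩
      coeff (τ 0 +ₚ constant 1#) k                       ≈⟨ coeff-+ (τ 0) (constant 1#) k ⟩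
      coeff (τ 0) k + coeff (constant 1#) k              ≈⟨ +-comm _ _ ⟩
      coeff (constant 1#) k + coeff (τ 0) k              ≈⟨ +-congʳ (coeff-constant 1# k) ⟩
      1ₛ k + coeff (τ 0) k                               ∎)))
    where open SetoidReasoning setoid

  coeff-∏ : ∀ {A : Set} (xs : List A) (f : A → Poly) → coeff (ℙ.∏ xs f) ≈ₛ Ring.∏ 𝕊.rawRing xs (coeff ∘ f)
  coeff-∏ []       f k = coeff-constant 1# k
  coeff-∏ (y ∷ xs) f k = trans (coeff-* (f y) (ℙ.∏ xs f) k)
    (⊛-cong {coeff (f y)} {coeff (f y)} (λ _ → refl) (coeff-∏ xs f) k)

  S-⊛-factors : ∀ n → S n ⊛ coeff (ℙ.∏ (upTo (suc n)) factor) ≈ₛ coeff (wordPoly n)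
  S-⊛-factors n k = trans (⊛-cong {S n} {S n} (λ _ → refl) (coeff-∏ (upTo (suc n)) factor) k)
    (trans (N≈U n k) (sym (wordPoly≈U n k)))

  chain-total : ∀ n m →
    ∑ (FiniteGradedPoset.weakChains (rootPoset (suc n)) m) (λ v → x ^ Vec.sum (Vec.map (λ α → height α ∸ 1) v)) ≈ S n m
  chain-total n m = begin
    ∑ (weakChains m) (λ v → x ^ Vec.sum (Vec.map (λ α → height α ∸ 1) v))
      ≈⟨ ∑-cong (weakChains m) power-weight ⟩
    total m
      ≈⟨ total≈below-maximum ⊤ ⊤-maximum m ⟩
    below m ⊤
      ≈⟨ below≈κ (suc n) _≤?_ (λ _ _ → ≡.refl) m ⊤ ⟩
    κ m (toℕ (fromℕ n))
      ≡⟨ ≡.cong (κ m) (Fin.toℕ-fromℕ n) ⟩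
    κ m n ∎
    where
    open SetoidReasoning setoid
    open FiniteGradedPoset (rootPoset (suc n)) using (weakChains; ⊤; ⊤-maximum; _≤?_)
    open ChainSums 𝓠 _≤?_ (posRoots (suc n)) (λ α → x ^ (height α ∸ 1))
    power-weight : ∀ {m} (v : Vec (PosRoot (suc n)) m) → x ^ Vec.sum (Vec.map (λ α → height α ∸ 1) v) ≈ weight v
    power-weight []      = refl
    power-weight (α ∷ v) = trans (^-homo-* x (height α ∸ 1) _) (*-congˡ (power-weight v))

rootPoset-H : ∀ n → FiniteGradedPoset.H (rootPoset (suc n)) ≡ n
rootPoset-H n = ≡.trans (≡.cong (_∸ 1) (height-formula (root {suc n} zero (fromℕ n) z≤n))) (Fin.toℕ-fromℕ n)

range-0 : ∀ n → range 0 n ≡ upTo (suc n)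
range-0 n = List.map-id (upTo (suc n))


ℤ-commutativeRing ℤ[x]-commutativeRing : CommutativeRing 0ℓ 0ℓ
ℤ-commutativeRing = ℤ.+-*-commutativeRing
ℤ[x]-commutativeRing = PolyRing.polyRing ℤ-commutativeRing

module TypeA = RootNumerator ℤ[x]-commutativeRing q

wordPolynomial-isNumerator : ∀ n → IsNumerator (rootPoset (suc n)) (wordPolynomial n)
wordPolynomial-isNumerator n m = begin
  (chainSeries P ⊛ coeff (denominator P)) m
    ≈⟨ ⊛-cong {chainSeries P} {TypeA.S n} {coeff (denominator P)} {coeff (TypeA.ℙ.∏ (upTo (suc n)) TypeA.factor)} (TypeA.chain-total n) (λ k → reflexive (≡.cong (λ d → coeff d k) denominator≡)) m ⟩
  (TypeA.S n ⊛ coeff (TypeA.ℙ.∏ (upTo (suc n)) TypeA.factor)) m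
    ≈⟨ TypeA.S-⊛-factors n m ⟩
  coeff (wordPolynomial n) m ∎
  where
  P = rootPoset (suc n)
  open CommutativeRing ℤ[x]-commutativeRing using (setoid; reflexive)
  open SetoidReasoning setoid
  open Ring ℤ[x]
  open SeriesRing ℤ[x]-commutativeRing using (⊛-cong)
  denominator≡ : denominator P ≡ TypeA.ℙ.∏ (upTo (suc n)) TypeA.factor
  denominator≡ = ≡.trans (≡.cong (λ h → TypeA.ℙ.∏ (range 0 h) TypeA.factor) (rootPoset-H n))
    (≡.cong (λ as → TypeA.ℙ.∏ as TypeA.factor) (range-0 n))

-- Coefficients of the numerator

module _ (𝓡 : CommutativeRing 0ℓ 0ℓ) where
  open CommutativeRing 𝓡 hiding (zero)
  open NaturalSolver commutativeSemiring using (solve; _:=_; _:*_; _:+_)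

  -- A discrete product rule: if f + δ and g + ε are the shifts of f and g, it reduces the second
  -- difference of the product to δ ε.
  *-expand : ∀ f δ g ε → (f + δ) * (g + ε) + f * g ≈ (f + δ) * g + f * (g + ε) + δ * ε
  *-expand = solve 4 (λ f δ g ε → ((f :+ δ) :* (g :+ ε)) :+ (f :* g) := (((f :+ δ) :* g) :+ (f :* (g :+ ε))) :+ (δ :* ε)) refl

-- This is k(k - 1)/2. The power q^{k(k-1)} is divided equally between the two convolved sequences,
-- so that each obeys a first-order recurrence.
triangular : ℕ → ℕ
triangular zero    = 0
triangular (suc k) = triangular k ℕ.+ k

triangular-double : ∀ k → triangular k ℕ.+ triangular k ≡ k ℕ.* (k ∸ 1)
triangular-double zero          = ≡.refl
triangular-double (suc zero)    = ≡.refl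
triangular-double (suc (suc k)) = ≡.trans
  (solve 2 (λ t k → (t :+ (con 1 :+ k)) :+ (t :+ (con 1 :+ k)) := (t :+ t) :+ (con 2 :* (con 1 :+ k))) ≡.refl (triangular (suc k)) k)
  (≡.trans (≡.cong (ℕ._+ 2 ℕ.* (1 ℕ.+ k)) (triangular-double (suc k)))
    (solve 1 (λ k → ((con 1 :+ k) :* k) :+ (con 2 :* (con 1 :+ k)) := (con 2 :+ k) :* (con 1 :+ k)) ≡.refl k))
  where open ℕSolver.+-*-Solver using (solve; con; _:=_; _:+_; _:*_)

-- Gaussian binomials and their convolution

record IsGaussian (𝓠 : CommutativeRing 0ℓ 0ℓ) (x : CommutativeRing.Carrier 𝓠) (γ : ℕ → ℕ → CommutativeRing.Carrier 𝓠) : Set where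
  open CommutativeRing 𝓠 using (_≈_; _+_; _*_; 0#; 1#; rawRing)
  open Ring rawRing using (_^_)
  field
    γ-0     : ∀ n → γ n 0 ≈ 1#
    γ-0-suc : ∀ k → γ 0 (suc k) ≈ 0#
    γ-suc   : ∀ n k → γ (suc n) (suc k) ≈ γ n k + x ^ suc k * γ n (suc k)

module GaussianConvolution (𝓠 : CommutativeRing 0ℓ 0ℓ) (x : CommutativeRing.Carrier 𝓠) (γ : ℕ → ℕ → CommutativeRing.Carrier 𝓠)
  (isGaussian : IsGaussian 𝓠 x γ) where
  open CommutativeRing 𝓠 hiding (zero)
  open IsGaussian isGaussian
  open Ring rawRing using (∑; Series; _⊛_; _^_)
  open Sums 𝓠
  open SeriesRing 𝓠
  open Algebra.Properties.Semiring.Exp semiring using (^-homo-*; ^-congʳ)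
  open NaturalSolver commutativeSemiring using (solve; con; _:=_; _:+_; _:*_)
  open SetoidReasoning setoid

  γ-vanish : ∀ n k → n ℕ.< k → γ n k ≈ 0#
  γ-vanish zero    (suc k) _         = γ-0-suc k
  γ-vanish (suc n) (suc k) (s≤s n<k) = begin
    γ (suc n) (suc k)                    ≈⟨ γ-suc n k ⟩
    γ n k + x ^ suc k * γ n (suc k)      ≈⟨ +-cong (γ-vanish n k n<k) (*-congˡ (γ-vanish n (suc k) (ℕ.m<n⇒m<1+n n<k))) ⟩
    0# + x ^ suc k * 0#                  ≈⟨ trans (+-identityˡ _) (zeroʳ _) ⟩
    0#                                   ∎

  -- [n+1 k+1] − [n k+1] = q^(n−k) [n k], multiplied by q^k to avoid the subtraction n − k.
  γ-suc′ : ∀ n k → x ^ k * γ (suc n) (suc k) ≈ x ^ k * γ n (suc k) + x ^ n * γ n k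
  γ-suc′ zero k = begin
    x ^ k * γ 1 (suc k)                        ≈⟨ *-congˡ (trans (γ-suc 0 k) (+-congˡ (trans (*-congˡ (γ-0-suc k)) (zeroʳ _)))) ⟩
    x ^ k * (γ 0 k + 0#)                       ≈⟨ *-congˡ (+-identityʳ _) ⟩
    x ^ k * γ 0 k                              ≈⟨ first k ⟩
    1# * γ 0 k                                 ≈⟨ sym (+-identityˡ _) ⟩
    0# + 1# * γ 0 k                            ≈⟨ +-congʳ (sym (trans (*-congˡ (γ-0-suc k)) (zeroʳ _))) ⟩
    x ^ k * γ 0 (suc k) + 1# * γ 0 k           ∎
    where
    first : ∀ k → x ^ k * γ 0 k ≈ 1# * γ 0 k
    first zero    = refl
    first (suc k) = trans (trans (*-congˡ (γ-0-suc k)) (zeroʳ _)) (sym (trans (*-congˡ (γ-0-suc k)) (zeroʳ _)))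
  γ-suc′ (suc n) zero = begin
    1# * γ (2 ℕ.+ n) 1
      ≈⟨ *-congˡ (trans (γ-suc (suc n) 0) (+-cong (trans (γ-0 (suc n)) (sym (γ-0 n))) (*-congˡ (trans (sym (*-identityˡ _)) (γ-suc′ n zero))))) ⟩
    1# * (γ n 0 + x ^ 1 * (1# * γ n 1 + x ^ n * γ n 0))
      ≈⟨ solve 4 (λ x y g h → con 1 :* (h :+ ((x :* con 1) :* ((con 1 :* g) :+ (y :* h))))
                          := (con 1 :* (h :+ ((x :* con 1) :* g))) :+ ((x :* y) :* h)) refl x (x ^ n) (γ n 1) (γ n 0) ⟩
    1# * (γ n 0 + x ^ 1 * γ n 1) + x ^ suc n * γ n 0
      ≈⟨ +-cong (*-congˡ (sym (γ-suc n 0))) (*-congˡ (trans (γ-0 n) (sym (γ-0 (suc n))))) ⟩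
    1# * γ (suc n) 1 + x ^ suc n * γ (suc n) 0 ∎
  γ-suc′ (suc n) (suc k) = begin
    x ^ suc k * γ (2 ℕ.+ n) (2 ℕ.+ k)
      ≈⟨ *-congˡ (γ-suc (suc n) (suc k)) ⟩
    x * x ^ k * (γ (suc n) (suc k) + x * (x ^ suc k) * γ (suc n) (2 ℕ.+ k))
      ≈⟨ solve 4 (λ x y g h → (x :* y) :* (g :+ ((x :* (x :* y)) :* h))
                          := (x :* (y :* g)) :+ ((x :* (x :* y)) :* ((x :* y) :* h))) refl x (x ^ k) _ _ ⟩
    x * (x ^ k * γ (suc n) (suc k)) + x * (x ^ suc k) * (x ^ suc k * γ (suc n) (2 ℕ.+ k))
      ≈⟨ +-cong (*-congˡ (γ-suc′ n k)) (*-congˡ (γ-suc′ n (suc k))) ⟩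
    x * (x ^ k * γ n (suc k) + x ^ n * γ n k) + x * (x ^ suc k) * (x ^ suc k * γ n (2 ℕ.+ k) + x ^ n * γ n (suc k))
      ≈⟨ solve 6 (λ x y z a b c → (x :* ((y :* a) :+ (z :* b))) :+ ((x :* (x :* y)) :* (((x :* y) :* c) :+ (z :* a)))
                          := ((x :* y) :* (a :+ ((x :* (x :* y)) :* c))) :+ ((x :* z) :* (b :+ ((x :* y) :* a)))) refl x (x ^ k) (x ^ n) _ _ _ ⟩
    x ^ suc k * (γ n (suc k) + x * (x ^ suc k) * γ n (2 ℕ.+ k)) + x ^ suc n * (γ n k + x ^ suc k * γ n (suc k))
      ≈⟨ sym (+-cong (*-congˡ (γ-suc n (suc k))) (*-congˡ (γ-suc n k))) ⟩
    x ^ suc k * γ (suc n) (2 ℕ.+ k) + x ^ suc n * γ (suc n) (suc k) ∎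

  α β : ℕ → Series
  α zero              = 1ₛ
  α (suc k) zero      = 0#
  α (suc k) (suc h)   = x ^ triangular (suc k) * γ h k
  β k s               = x ^ triangular k * γ s k

  -- Both sequences satisfy (1 − t) F_{k+1}(t) = t F_k(qt), read off coefficientwise.
  β-suc : ∀ k s → β (suc k) (suc s) ≈ β (suc k) s + x ^ s * β k s
  β-suc k s = begin
    x ^ (triangular k ℕ.+ k) * γ (suc s) (suc k)
      ≈⟨ trans (*-congʳ (^-homo-* x (triangular k) k)) (*-assoc _ _ _) ⟩
    x ^ triangular k * (x ^ k * γ (suc s) (suc k))
      ≈⟨ *-congˡ (γ-suc′ s k) ⟩
    x ^ triangular k * (x ^ k * γ s (suc k) + x ^ s * γ s k)
      ≈⟨ solve 5 (λ t u v g h → t :* ((u :* g) :+ (v :* h)) := ((t :* u) :* g) :+ (v :* (t :* h))) refl _ _ _ _ _ ⟩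
    x ^ triangular k * x ^ k * γ s (suc k) + x ^ s * β k s
      ≈⟨ +-congʳ (*-congʳ (sym (^-homo-* x (triangular k) k))) ⟩
    β (suc k) s + x ^ s * β k s ∎

  α-suc : ∀ k h → α (suc k) (suc h) ≈ α (suc k) h + x ^ h * α k h
  α-suc zero    zero    = trans (*-congˡ (γ-0 0)) (sym (+-identityˡ _))
  α-suc (suc k) zero    = trans (trans (*-congˡ (γ-0-suc k)) (zeroʳ _)) (sym (trans (+-identityˡ _) (zeroʳ _)))
  α-suc zero    (suc h) = trans (*-congˡ (trans (γ-0 (suc h)) (sym (γ-0 h)))) (sym (trans (+-congˡ (zeroʳ _)) (+-identityʳ _)))
  α-suc (suc k) (suc h) = begin
    x ^ (triangular (suc k) ℕ.+ suc k) * γ (suc h) (suc k)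
      ≈⟨ *-congʳ (^-homo-* x (triangular (suc k)) (suc k)) ⟩
    x ^ triangular (suc k) * (x * x ^ k) * γ (suc h) (suc k)
      ≈⟨ solve 4 (λ t x u g → (t :* (x :* u)) :* g := t :* (x :* (u :* g))) refl _ _ _ _ ⟩
    x ^ triangular (suc k) * (x * (x ^ k * γ (suc h) (suc k)))
      ≈⟨ *-congˡ (*-congˡ (γ-suc′ h k)) ⟩
    x ^ triangular (suc k) * (x * (x ^ k * γ h (suc k) + x ^ h * γ h k))
      ≈⟨ solve 6 (λ t x u v g f → t :* (x :* ((u :* g) :+ (v :* f))) := ((t :* (x :* u)) :* g) :+ ((x :* v) :* (t :* f))) refl _ _ _ _ _ _ ⟩
    x ^ triangular (suc k) * (x * x ^ k) * γ h (suc k) + x ^ suc h * α (suc k) (suc h)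
      ≈⟨ +-congʳ (*-congʳ (sym (^-homo-* x (triangular (suc k)) (suc k)))) ⟩
    α (2 ℕ.+ k) (suc h) + x ^ suc h * α (suc k) (suc h) ∎

  conv : ℕ → Series
  conv k = α k ⊛ β k

  β-suc-0 : ∀ k → β (suc k) 0 ≈ 0#
  β-suc-0 k = trans (*-congˡ (γ-0-suc k)) (zeroʳ _)

  ⊛-suc-0ˡ : ∀ f g n → f 0 ≈ 0# → (f ⊛ g) (suc n) ≈ ((f ∘ suc) ⊛ g) n
  ⊛-suc-0ˡ f g n f₀≈0 = trans (reflexive (⊛-suc f g n)) (trans (+-congʳ (trans (*-congʳ f₀≈0) (zeroˡ _))) (+-identityˡ _))

  ⊛-suc-0ʳ : ∀ f g n → g 0 ≈ 0# → (f ⊛ g) (suc n) ≈ (f ⊛ (g ∘ suc)) n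
  ⊛-suc-0ʳ f g n g₀≈0 = trans (⊛-comm f g (suc n)) (trans (⊛-suc-0ˡ g f n g₀≈0) (⊛-comm (g ∘ suc) f n))

  scaled : Series → Series
  scaled f n = x ^ n * f n

  -- Scaling the n-th coefficient by x^n is the substitution of x t for t, which respects products
  -- of series.
  ⊛-scaled : ∀ f g n → (scaled f ⊛ scaled g) n ≈ x ^ n * (f ⊛ g) n
  ⊛-scaled f g n = trans (∑-upTo-cong (suc n) (λ { i (s≤s i≤n) → begin
    x ^ i * f i * (x ^ (n ∸ i) * g (n ∸ i))     ≈⟨ solve 4 (λ a b c d → (a :* b) :* (c :* d) := (a :* c) :* (b :* d)) refl _ _ _ _ ⟩
    x ^ i * x ^ (n ∸ i) * (f i * g (n ∸ i))     ≈⟨ *-congʳ (sym (^-homo-* x i (n ∸ i))) ⟩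
    x ^ (i ℕ.+ (n ∸ i)) * (f i * g (n ∸ i))     ≈⟨ *-congʳ (^-congʳ x (ℕ.m+[n∸m]≡n i≤n)) ⟩
    x ^ n * (f i * g (n ∸ i))                   ∎ })) (∑-*ˡ (upTo (suc n)) (x ^ n) _)

  -- Both factors vanish at 0, so a single shift of their product can be moved into either factor,
  -- and a double shift into both. Then `*-expand` leaves the product of the increments, which are
  -- the scaled sequences for k.
  conv-rec : ∀ k → Recurrence.SecondDifference 𝓠 (λ n _ → x ^ n * conv k n) (conv (suc k))
  conv-rec k n = begin
    (f ⊛ g) (2 ℕ.+ n) + (f ⊛ g) n
      ≈⟨ +-congʳ (trans (⊛-suc-0ˡ f g (suc n) refl) (trans (⊛-suc-0ʳ (f ∘ suc) g n (β-suc-0 k))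
           (⊛-cong {f ∘ suc} {f +ₛ δ} {g ∘ suc} {g +ₛ ε} (α-suc k) (β-suc k) n))) ⟩
    ((f +ₛ δ) ⊛ (g +ₛ ε)) n + (f ⊛ g) n
      ≈⟨ *-expand seriesRing f δ g ε n ⟩
    ((f +ₛ δ) ⊛ g) n + (f ⊛ (g +ₛ ε)) n + (δ ⊛ ε) n
      ≈⟨ sym (+-congʳ (+-cong
           (trans (⊛-suc-0ˡ f g n refl) (⊛-cong {f ∘ suc} {f +ₛ δ} {g} {g} (α-suc k) (λ _ → refl) n))
           (trans (⊛-suc-0ʳ f g n (β-suc-0 k)) (⊛-cong {f} {f} {g ∘ suc} {g +ₛ ε} (λ _ → refl) (β-suc k) n)))) ⟩
    (f ⊛ g) (1 ℕ.+ n) + (f ⊛ g) (1 ℕ.+ n) + (δ ⊛ ε) n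
      ≈⟨ +-congˡ (⊛-scaled (α k) (β k) n) ⟩
    (f ⊛ g) (1 ℕ.+ n) + (f ⊛ g) (1 ℕ.+ n) + x ^ n * conv k n ∎
    where
    f = α (suc k)
    g = β (suc k)
    δ = scaled (α k)
    ε = scaled (β k)

  conv-0 : ∀ n → conv 0 n ≈ 1#
  conv-0 n = trans (⊛-identityˡ (β 0) n) (trans (*-identityˡ _) (γ-0 n))

  conv-suc-0 : ∀ k → conv (suc k) 0 ≈ 0#
  conv-suc-0 k = trans (⊛-zero (α (suc k)) (β (suc k))) (zeroˡ _)

  conv-suc-1 : ∀ k → conv (suc k) 1 ≈ 0#
  conv-suc-1 k = trans (⊛-suc-0ˡ (α (suc k)) (β (suc k)) 0 refl)
    (trans (⊛-zero (α (suc k) ∘ suc) (β (suc k))) (trans (*-congˡ (β-suc-0 k)) (zeroʳ _)))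

  -- Outside k ≤ h ≤ r - k one of the two Gaussian binomials vanishes, which cuts the full
  -- convolution over 0, ..., r down to the stated range.
  conv≈formula : ∀ r k → 1 ℕ.≤ k → k ℕ.+ k ℕ.≤ r →
    conv k r ≈ x ^ (k ℕ.* (k ∸ 1)) * ∑ (range k (r ∸ k)) (λ h → γ (h ∸ 1) (k ∸ 1) * γ (r ∸ h) k)
  conv≈formula r (suc k′) _ 2k≤r = begin
    ∑ (upTo (suc r)) F
      ≡⟨ ≡.cong (λ n → ∑ (upTo n) F) (≡.sym 1+r≡) ⟩
    ∑ (upTo (k ℕ.+ (l ℕ.+ k))) F
      ≈⟨ trans (∑-upTo-+ k (l ℕ.+ k) F) (+-congˡ (∑-upTo-+ l k (λ i → F (k ℕ.+ i)))) ⟩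
    ∑ (upTo k) F + (∑ (upTo l) (λ i → F (k ℕ.+ i)) + ∑ (upTo k) (λ i → F (k ℕ.+ (l ℕ.+ i))))
      ≈⟨ +-cong (∑-upTo-0 k low) (+-congˡ (∑-upTo-0 k (λ i _ → high i))) ⟩
    0# + (∑ (upTo l) (λ i → F (k ℕ.+ i)) + 0#)
      ≈⟨ trans (+-identityˡ _) (+-identityʳ _) ⟩
    ∑ (upTo l) (λ i → F (k ℕ.+ i))
      ≈⟨ trans (∑-cong (upTo l) (λ i → middle (k′ ℕ.+ i))) (∑-*ˡ (upTo l) _ _) ⟩
    x ^ (k ℕ.* k′) * ∑ (upTo l) (λ i → γ (k′ ℕ.+ i) k′ * γ (r ∸ (k ℕ.+ i)) k)
      ≈⟨ *-congˡ (reflexive (≡.sym (∑-map (k ℕ.+_) (upTo l) (λ h → γ (h ∸ 1) k′ * γ (r ∸ h) k)))) ⟩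
    x ^ (k ℕ.* k′) * ∑ (range k (r ∸ k)) (λ h → γ (h ∸ 1) k′ * γ (r ∸ h) k) ∎
    where
    k = suc k′
    l = suc (r ∸ k) ∸ k
    F : ℕ → Carrier
    F i = α k i * β k (r ∸ i)
    1+r≡ : k ℕ.+ (l ℕ.+ k) ≡ suc r
    1+r≡ = ≡.trans (≡.cong (k ℕ.+_) (ℕ.m∸n+n≡m {suc (r ∸ k)} {k} (ℕ.m≤n⇒m≤1+n (ℕ.m+n≤o⇒m≤o∸n k 2k≤r))))
      (≡.trans (ℕ.+-suc k (r ∸ k)) (≡.cong suc (ℕ.m+[n∸m]≡n (ℕ.m+n≤o⇒m≤o k 2k≤r))))
    low : ∀ i → i ℕ.< k → F i ≈ 0#
    low zero    _             = zeroˡ _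
    low (suc i) (s≤s i<k′)    = trans (*-congʳ (trans (*-congˡ (γ-vanish i k′ i<k′)) (zeroʳ _))) (zeroˡ _)
    high : ∀ i → F (k ℕ.+ (l ℕ.+ i)) ≈ 0#
    high i = trans (*-congˡ (trans (*-congˡ (γ-vanish _ k small)) (zeroʳ _))) (zeroʳ _)
      where
      small : r ∸ (k ℕ.+ (l ℕ.+ i)) ℕ.< k
      small = s≤s (ℕ.m≤n+o⇒m∸n≤o r (k ℕ.+ (l ℕ.+ i)) (ℕ.s≤s⁻¹ (ℕ.≤-trans (ℕ.≤-reflexive (≡.sym 1+r≡))
        (ℕ.≤-trans (ℕ.+-monoʳ-≤ k (ℕ.+-monoˡ-≤ k (ℕ.m≤m+n l i))) (ℕ.≤-reflexive
          (≡.trans (≡.sym (ℕ.+-assoc k (l ℕ.+ i) k)) (ℕ.+-suc (k ℕ.+ (l ℕ.+ i)) k′)))))))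
    middle : ∀ h → F (suc h) ≈ x ^ (k ℕ.* k′) * (γ h k′ * γ (r ∸ suc h) k)
    middle h = begin
      x ^ triangular k * γ h k′ * (x ^ triangular k * γ (r ∸ suc h) k)
        ≈⟨ solve 4 (λ a b c d → (a :* b) :* (c :* d) := (a :* c) :* (b :* d)) refl _ _ _ _ ⟩
      x ^ triangular k * x ^ triangular k * (γ h k′ * γ (r ∸ suc h) k)
        ≈⟨ *-congʳ (trans (sym (^-homo-* x (triangular k) (triangular k))) (^-congʳ x (triangular-double k))) ⟩
      x ^ (k ℕ.* k′) * (γ h k′ * γ (r ∸ suc h) k) ∎

module RootCoefficients (𝓠 : CommutativeRing 0ℓ 0ℓ) (x : CommutativeRing.Carrier 𝓠) where
  open CommutativeRing 𝓠 hiding (zero)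
  open Ring rawRing
  open SeriesRing 𝓠
  open PolyRing 𝓠
  open RootNumerator 𝓠 x
  open Recurrence 𝓠
  open WordSums polyRing τ using (U; U-0; U-1)
  open Algebra.Properties.Ring ring using (+-cancelʳ)
  open SetoidReasoning setoid

  -- a r is the coefficient sequence of the numerator of type A_r, with the value 1 at r = 0.
  a : ℕ → Series
  a zero    = 1ₛ
  a (suc n) = coeff (wordPoly n)

  shifted : ℕ → Series → Series
  shifted r f zero    = 0#
  shifted r f (suc k) = x ^ r * f k

  shifted≈ : ∀ r f k → (coeff (τ r) ⊛ f) k ≈ shifted r f k
  shifted≈ r f zero    = monomial-⊛-zero (x ^ r) f
  shifted≈ r f (suc k) = monomial-⊛-suc (x ^ r) f k

  a-1 : ∀ k → a 1 k ≈ 1ₛ k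
  a-1 k = trans (wordPoly≈U 0 k) (trans (U-0 R 0 k) (coeff-constant 1# k))

  a-rec : ∀ r k → a (2 ℕ.+ r) k + a r k ≈ a (1 ℕ.+ r) k + a (1 ℕ.+ r) k + shifted r (a r) k
  -- The recurrence reaches down to r = 0 because the numerator for r = 2 is 1 + t; this fixes the
  -- choice of `a 0`.
  a-rec zero k = begin
    coeff (wordPoly 1) k + 1ₛ k                        ≈⟨ +-congʳ (trans (wordPoly≈U 1 k) (trans (U-1 R 0 k) (coeff-+ (τ 0) (constant 1#) k))) ⟩
    coeff (τ 0) k + coeff (constant 1#) k + 1ₛ k       ≈⟨ +-congʳ (+-cong (trans (sym (⊛-identityʳ k)) (shifted≈ 0 1ₛ k)) (coeff-constant 1# k)) ⟩
    shifted 0 1ₛ k + 1ₛ k + 1ₛ k                       ≈⟨ trans (+-assoc _ _ _) (+-comm _ _) ⟩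
    1ₛ k + 1ₛ k + shifted 0 1ₛ k                       ≈⟨ +-congʳ (sym (+-cong (a-1 k) (a-1 k))) ⟩
    a 1 k + a 1 k + shifted 0 (a 0) k                  ∎
    where
    ⊛-identityʳ : ∀ k → (coeff (τ 0) ⊛ 1ₛ) k ≈ coeff (τ 0) k
    ⊛-identityʳ = 𝕊.*-identityʳ (coeff (τ 0))
  a-rec (suc n) k = begin
    coeff (wordPoly (2 ℕ.+ n)) k + coeff (wordPoly n) k
      ≈⟨ +-cong (wordPoly≈U (2 ℕ.+ n) k) (wordPoly≈U n k) ⟩
    coeff (U R 0 (2 ℕ.+ n)) k + coeff (U R 0 n) k
      ≈⟨ coeff-U-recurrence n k ⟩
    coeff (U R 0 (1 ℕ.+ n)) k + coeff (U R 0 (1 ℕ.+ n)) k + (coeff (τ (suc n)) ⊛ coeff (U R 0 n)) k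
      ≈⟨ sym (+-cong (+-cong (wordPoly≈U (1 ℕ.+ n) k) (wordPoly≈U (1 ℕ.+ n) k))
           (trans (sym (shifted≈ (suc n) (coeff (wordPoly n)) k))
             (⊛-cong {coeff (τ (suc n))} {coeff (τ (suc n))} {coeff (wordPoly n)} {coeff (U R 0 n)} (λ _ → refl) (wordPoly≈U n) k))) ⟩
    coeff (wordPoly (1 ℕ.+ n)) k + coeff (wordPoly (1 ℕ.+ n)) k + shifted (suc n) (coeff (wordPoly n)) k ∎

  a-constant : ∀ r → a r 0 ≈ 1#
  a-constant = unique {Φ = λ _ _ → 0#} {λ r → a r 0} {λ _ → 1#} (λ _ _ → refl) (λ r → a-rec r 0) (λ _ → sym (+-identityʳ _)) refl (a-1 0)

  -- Two steps in r raise the degree in t by at most one, through the shifted term.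
  a-vanish : ∀ r k → r ℕ.< k ℕ.+ k → a r k ≈ 0#
  a-vanish zero          (suc k) _ = refl
  a-vanish (suc zero)    (suc k) _ = a-1 (suc k)
  a-vanish (suc (suc r)) (suc k) r+2<2k+2 =
    let z₁ = a-vanish (suc r) (suc k) (ℕ.<-trans (ℕ.n<1+n _) r+2<2k+2)
        z₀ = a-vanish r (suc k) (ℕ.<-trans (ℕ.m<n⇒m<1+n (ℕ.n<1+n _)) r+2<2k+2)
    in +-cancelʳ (a r (suc k)) _ _ (begin
    a (2 ℕ.+ r) (suc k) + a r (suc k)
      ≈⟨ a-rec r (suc k) ⟩
    a (1 ℕ.+ r) (suc k) + a (1 ℕ.+ r) (suc k) + x ^ r * a r k
      ≈⟨ +-cong (+-cong z₁ z₁) (trans (*-congˡ (a-vanish r k r<2k)) (zeroʳ _)) ⟩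
    0# + 0# + 0#
      ≈⟨ trans (+-congʳ (+-identityˡ 0#)) (+-congˡ (sym z₀)) ⟩
    0# + a r (suc k) ∎)
    where
    r<2k : r ℕ.< k ℕ.+ k
    r<2k = ℕ.s≤s⁻¹ (ℕ.s≤s⁻¹ (≡.subst (3 ℕ.+ r ℕ.≤_) (≡.cong suc (ℕ.+-suc k k)) r+2<2k+2))

  module _ (γ : ℕ → ℕ → Carrier) (isGaussian : IsGaussian 𝓠 x γ) where
    open GaussianConvolution 𝓠 x γ isGaussian

    -- Induction on k outside, recurrence in r inside: for fixed k both sides have the same second
    -- difference, known from k - 1.
    a≈conv : ∀ k r → a r k ≈ conv k r
    a≈conv zero    r = trans (a-constant r) (sym (conv-0 r))
    a≈conv (suc k)   = unique {Φ = λ r _ → x ^ r * conv k r} {λ r → a r (suc k)} {conv (suc k)} (λ _ _ → refl)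
      (λ r → trans (a-rec r (suc k)) (+-congˡ (*-congˡ (a≈conv k r)))) (conv-rec k)
      (sym (conv-suc-0 k)) (trans (a-1 (suc k)) (sym (conv-suc-1 k)))

    a≈formula : ∀ r k → 1 ℕ.≤ k → k ℕ.+ k ℕ.≤ r →
      a r k ≈ x ^ (k ℕ.* (k ∸ 1)) * ∑ (range k (r ∸ k)) (λ h → γ (h ∸ 1) (k ∸ 1) * γ (r ∸ h) k)
    a≈formula r k 1≤k 2k≤r = trans (a≈conv k r) (conv≈formula r k 1≤k 2k≤r)

-- Positivity and the specialisation q = 1

record IsSubsemiring (𝓡 : CommutativeRing 0ℓ 0ℓ) (Q : CommutativeRing.Carrier 𝓡 → Set) : Set where
  open CommutativeRing 𝓡 hiding (zero)
  open Ring rawRing using (∑; _^_)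
  field
    resp : ∀ {a b} → a ≈ b → Q a → Q b
    0∈   : Q 0#
    1∈   : Q 1#
    +∈   : ∀ {a b} → Q a → Q b → Q (a + b)
    *∈   : ∀ {a b} → Q a → Q b → Q (a * b)

  ∑∈ : ∀ {A : Set} (xs : List A) {f} → (∀ y → Q (f y)) → Q (∑ xs f)
  ∑∈ []       f∈ = 0∈
  ∑∈ (y ∷ xs) f∈ = +∈ (f∈ y) (∑∈ xs f∈)

  ^∈ : ∀ {a} n → Q a → Q (a ^ n)
  ^∈ zero    a∈ = 1∈
  ^∈ (suc n) a∈ = *∈ a∈ (^∈ n a∈)

-- Closure under sums and products passes from coefficients to polynomials. Applied twice, it lifts
-- nonnegativity from ℤ to ℤ[q][t], where the word sum is visibly built from admissible terms.
module PolySubsemiring {𝓡 : CommutativeRing 0ℓ 0ℓ} {Q : CommutativeRing.Carrier 𝓡 → Set} (isSubsemiring : IsSubsemiring 𝓡 Q) where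
  open CommutativeRing 𝓡 using (rawRing; sym)
  open IsSubsemiring isSubsemiring
  open Ring rawRing
  open PolyRing 𝓡

  coefficients∈ : Poly → Set
  coefficients∈ p = ∀ n → Q (coeff p n)

  constant∈ : ∀ {a} → Q a → coefficients∈ (constant a)
  constant∈ a∈ zero    = a∈
  constant∈ a∈ (suc n) = 0∈

  X∈ : coefficients∈ X
  X∈ zero          = 0∈
  X∈ (suc zero)    = 1∈
  X∈ (suc (suc n)) = 0∈

  polyIsSubsemiring : IsSubsemiring polyRing coefficients∈
  polyIsSubsemiring = record
    { resp = λ p≈p′ p∈ n → resp (p≈p′ n) (p∈ n)
    ; 0∈   = λ _ → 0∈
    ; 1∈   = constant∈ 1∈
    ; +∈   = λ {p} {p′} p∈ p′∈ n → resp (sym (coeff-+ p p′ n)) (+∈ (p∈ n) (p′∈ n))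
    ; *∈   = λ {p} {p′} p∈ p′∈ n → resp (sym (coeff-* p p′ n))
               (∑∈ (upTo (suc n)) (λ i → *∈ (p∈ i) (p′∈ (n ∸ i))))
    }

ℤ-nonNegative : IsSubsemiring ℤ-commutativeRing (0ℤ ℤ.≤_)
ℤ-nonNegative = record
  { resp = λ { ≡.refl 0≤a → 0≤a }
  ; 0∈   = ℤ.≤-refl
  ; 1∈   = ℤ.+≤+ z≤n
  ; +∈   = ℤ.+-mono-≤
  ; *∈   = λ { {+ a} {+ b} _ _ → ≡.subst (0ℤ ℤ.≤_) (ℤ.pos-* a b) (ℤ.+≤+ z≤n) }
  }

wordPolynomial-nonnegative : ∀ n → CoefficientwiseNonnegative (wordPolynomial n)
wordPolynomial-nonnegative n =
  ∑∈ (words n) {λ w → RawRing._*_ ℤ[q][t] (Ring.constant ℤ[x] (q^ (qExponent w))) (t^ (length (D w)))}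
    (λ w → *∈ {Ring.constant ℤ[x] (q^ (qExponent w))} {t^ (length (D w))}
      (N₂.constant∈ {q^ (qExponent w)} (N.^∈ {q} (qExponent w) N₁.X∈)) (^∈ {Ring.X ℤ[x]} (length (D w)) N₂.X∈))
  where
  module N₁ = PolySubsemiring ℤ-nonNegative
  module N = IsSubsemiring N₁.polyIsSubsemiring
  module N₂ = PolySubsemiring N₁.polyIsSubsemiring
  open IsSubsemiring N₂.polyIsSubsemiring

module TypeACoefficients = RootCoefficients ℤ[x]-commutativeRing q

⌊n/2⌋+⌊n/2⌋≤n : ∀ n → ⌊ n /2⌋ ℕ.+ ⌊ n /2⌋ ℕ.≤ n
⌊n/2⌋+⌊n/2⌋≤n n = ℕ.≤-trans (ℕ.+-monoʳ-≤ ⌊ n /2⌋ (ℕ.⌊n/2⌋≤⌈n/2⌉ n)) (ℕ.≤-reflexive (ℕ.⌊n/2⌋+⌈n/2⌉≡n n))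

⌊n/2⌋<k⇒n<k+k : ∀ n {k} → ⌊ n /2⌋ ℕ.< k → n ℕ.< k ℕ.+ k
⌊n/2⌋<k⇒n<k+k zero          {suc k} _           = s≤s z≤n
⌊n/2⌋<k⇒n<k+k (suc zero)    {suc k} _           = s≤s (ℕ.≤-trans (s≤s z≤n) (ℕ.≤-reflexive (≡.sym (ℕ.+-suc k k))))
⌊n/2⌋<k⇒n<k+k (suc (suc n)) {suc k} (s≤s n/2<k) = s≤s (≡.subst (2 ℕ.+ n ℕ.≤_) (≡.sym (ℕ.+-suc k k)) (s≤s (⌊n/2⌋<k⇒n<k+k n n/2<k)))

gaussian-isGaussian : IsGaussian ℤ[x]-commutativeRing q gaussian
gaussian-isGaussian = record
  { γ-0     = λ { zero _ → ≡.refl ; (suc _) _ → ≡.refl }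
  ; γ-0-suc = λ _ _ → ≡.refl
  ; γ-suc   = λ _ _ _ → ≡.refl
  }

coefficient-formula : ∀ n k → 1 ℕ.≤ k → k ℕ.≤ ⌊ suc n /2⌋ → [t^ k ] (wordPolynomial n) ≈₁ gaussianFormula (suc n) k
coefficient-formula n k 1≤k k≤ = TypeACoefficients.a≈formula gaussian gaussian-isGaussian (suc n) k 1≤k
  (ℕ.≤-trans (ℕ.+-mono-≤ k≤ k≤) (⌊n/2⌋+⌊n/2⌋≤n (suc n)))

coefficient-vanish : ∀ n k → ⌊ suc n /2⌋ ℕ.< k → [t^ k ] (wordPolynomial n) ≈₁ RawRing.0# ℤ[x]
coefficient-vanish n k n/2<k = TypeACoefficients.a-vanish (suc n) k (⌊n/2⌋<k⇒n<k+k (suc n) n/2<k)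

coefficient-constant : ∀ n → [t^ 0 ] (wordPolynomial n) ≈₁ RawRing.1# ℤ[x]
coefficient-constant n = TypeACoefficients.a-constant (suc n)

-- Even binomial coefficients as the values at q = 1

nCk-second-difference : ∀ n k →
  (2 ℕ.+ n) C (2 ℕ.+ k) ℕ.+ n C (2 ℕ.+ k) ≡ (1 ℕ.+ n) C (2 ℕ.+ k) ℕ.+ (1 ℕ.+ n) C (2 ℕ.+ k) ℕ.+ n C k
nCk-second-difference n k
  rewrite ≡.sym (nCk+nC[k+1]≡[n+1]C[k+1] (1 ℕ.+ n) (1 ℕ.+ k))
        | ≡.sym (nCk+nC[k+1]≡[n+1]C[k+1] n k)
        | ≡.sym (nCk+nC[k+1]≡[n+1]C[k+1] n (1 ℕ.+ k)) =
  solve 3 (λ a b c → ((a :+ b) :+ (b :+ c)) :+ c := ((b :+ c) :+ (b :+ c)) :+ a) ≡.refl (n C k) (n C suc k) (n C (2 ℕ.+ k))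
  where open ℕSolver.+-*-Solver using (solve; _:=_; _:+_)

evenBinomial : ℕ → ℕ → ℤ
evenBinomial r k = + (r C (2 ℕ.* k))

shiftedEvenBinomial : ℕ → ℕ → ℤ
shiftedEvenBinomial r zero    = 0ℤ
shiftedEvenBinomial r (suc k) = evenBinomial r k

evenBinomial-rec : ∀ k → Recurrence.SecondDifference ℤ-commutativeRing (λ r _ → shiftedEvenBinomial r k) (λ r → evenBinomial r k)
evenBinomial-rec zero    r = ≡.refl
evenBinomial-rec (suc k) r = ≡.cong +_
  (≡.subst (λ j → (2 ℕ.+ r) C j ℕ.+ r C j ≡ (1 ℕ.+ r) C j ℕ.+ (1 ℕ.+ r) C j ℕ.+ r C (2 ℕ.* k))
    (≡.sym (ℕ.*-suc 2 k)) (nCk-second-difference r (2 ℕ.* k)))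

evenBinomial-vanish : ∀ r k → ⌊ r /2⌋ ℕ.< k → evenBinomial r k ≡ 0ℤ
evenBinomial-vanish r k r/2<k = ≡.cong +_ (k>n⇒nCk≡0
  (≡.subst (r ℕ.<_) (≡.cong (k ℕ.+_) (≡.sym (ℕ.+-identityʳ k))) (⌊n/2⌋<k⇒n<k+k r r/2<k)))

module At1 where
  open Ring ℤ-ring using (eval)
  open PolyRing ℤ-commutativeRing using (polyRing)
  open Evaluation ℤ-commutativeRing ℤ-commutativeRing id id ≡.refl (λ _ _ → ≡.refl) 1ℤ public

  at1 : Poly₁ → ℤ
  at1 p = eval p 1ℤ

  evaluate≡at1 : ∀ p → evaluate p ≡ at1 p
  evaluate≡at1 p = ≡.cong (λ p → eval p 1ℤ) (List.map-id p)

  at1-cong : ∀ p p′ → p ≈₁ p′ → at1 p ≡ at1 p′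
  at1-cong p p′ p≈p′ = ≡.trans (≡.sym (evaluate≡at1 p)) (≡.trans (evaluate-cong p p′ p≈p′) (evaluate≡at1 p′))

  at1-+ : ∀ p p′ → at1 (RawRing._+_ ℤ[x] p p′) ≡ at1 p ℤ.+ at1 p′
  at1-+ p p′ = ≡.trans (≡.sym (evaluate≡at1 (RawRing._+_ ℤ[x] p p′))) (≡.trans (evaluate-+ p p′) (≡.cong₂ ℤ._+_ (evaluate≡at1 p) (evaluate≡at1 p′)))

  at1-q^ : ∀ r p → at1 (RawRing._*_ ℤ[x] (q^ r) p) ≡ at1 p
  at1-q^ zero    p = at1-cong (RawRing._*_ ℤ[x] (q^ 0) p) p (CommutativeRing.*-identityˡ polyRing p)
  at1-q^ (suc r) p = begin
    at1 ((q * (q^ r)) * p)      ≡⟨ at1-cong ((q * (q^ r)) * p) (q * ((q^ r) * p)) (CommutativeRing.*-assoc polyRing q (q^ r) p) ⟩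
    at1 (q * ((q^ r) * p))      ≡⟨ ≡.trans (≡.sym (evaluate≡at1 (q * ((q^ r) * p)))) (evaluate-X* ((q^ r) * p)) ⟩
    1ℤ ℤ.* evaluate ((q^ r) * p) ≡⟨ ℤ.*-identityˡ _ ⟩
    evaluate ((q^ r) * p)        ≡⟨ evaluate≡at1 ((q^ r) * p) ⟩
    at1 ((q^ r) * p)             ≡⟨ at1-q^ r p ⟩
    at1 p                        ∎
    where
    open ≡.≡-Reasoning
    open RawRing ℤ[x] using (_*_)

open At1 using (at1; at1-cong; at1-+; at1-q^)

at1-a : ∀ k r → at1 (TypeACoefficients.a r k) ≡ evenBinomial r k
at1-a k = unique {λ r _ → shiftedEvenBinomial r k} {λ r → at1 (TypeACoefficients.a r k)} {λ r → evenBinomial r k} (λ _ _ → ≡.refl)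
  (λ r → begin
    at1 (a (2 ℕ.+ r) k) ℤ.+ at1 (a r k)
      ≡⟨ ≡.sym (at1-+ (a (2 ℕ.+ r) k) (a r k)) ⟩
    at1 (a (2 ℕ.+ r) k + a r k)
      ≡⟨ at1-cong (a (2 ℕ.+ r) k + a r k) (a (1 ℕ.+ r) k + a (1 ℕ.+ r) k + shifted r (a r) k) (a-rec r k) ⟩
    at1 (a (1 ℕ.+ r) k + a (1 ℕ.+ r) k + shifted r (a r) k)
      ≡⟨ ≡.trans (at1-+ (a (1 ℕ.+ r) k + a (1 ℕ.+ r) k) (shifted r (a r) k))
           (≡.cong₂ ℤ._+_ (at1-+ (a (1 ℕ.+ r) k) (a (1 ℕ.+ r) k)) (at1-shifted k r)) ⟩
    at1 (a (1 ℕ.+ r) k) ℤ.+ at1 (a (1 ℕ.+ r) k) ℤ.+ shiftedEvenBinomial r k ∎)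
  (evenBinomial-rec k) (start₀ k) (≡.trans (at1-cong (a 1 k) (a 0 k) (a-1 k)) (≡.trans (start₀ k) (start₁ k)))
  where
  open TypeACoefficients using (a; a-rec; a-1; shifted)
  open RawRing ℤ[x] using (_+_)
  open Recurrence ℤ-commutativeRing using (unique)
  open ≡.≡-Reasoning
  -- The induction on k sits here: the inhomogeneous term at k + 1 is the claim at k, the power of q
  -- having become 1.
  at1-shifted : ∀ k r → at1 (shifted r (a r) k) ≡ shiftedEvenBinomial r k
  at1-shifted zero    r = ≡.refl
  at1-shifted (suc k) r = ≡.trans (at1-q^ r (a r k)) (at1-a k r)
  start₀ : ∀ k → at1 (a 0 k) ≡ evenBinomial 0 k
  start₀ zero    = ≡.refl
  start₀ (suc k) = ≡.sym (evenBinomial-vanish 0 (suc k) (s≤s z≤n))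
  start₁ : ∀ k → evenBinomial 0 k ≡ evenBinomial 1 k
  start₁ zero    = ≡.refl
  start₁ (suc k) = ≡.trans (evenBinomial-vanish 0 (suc k) (s≤s z≤n)) (≡.sym (evenBinomial-vanish 1 (suc k) (s≤s z≤n)))

coeff-at-q≡1 : ∀ p k → Ring.coeff ℤ-ring (at-q≡1 p) k ≡ at1 ([t^ k ] p)
coeff-at-q≡1 []      k       = ≡.refl
coeff-at-q≡1 (c ∷ p) zero    = ≡.refl
coeff-at-q≡1 (c ∷ p) (suc k) = coeff-at-q≡1 p k

at-q≡1-coefficients : ∀ n k → Ring.coeff ℤ-ring (at-q≡1 (wordPolynomial n)) k ≡ evenBinomial (suc n) k
at-q≡1-coefficients n k = ≡.trans (coeff-at-q≡1 (wordPolynomial n) k) (at1-a k (suc n))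

-- Exactly the coefficients up to the degree, so that the last entry is the leading coefficient.
evenBinomials : ℕ → Poly₁
evenBinomials r = map (evenBinomial r) (upTo (suc ⌊ r /2⌋))

module PolyLists (𝓡 : CommutativeRing 0ℓ 0ℓ) where
  open CommutativeRing 𝓡 hiding (zero)
  open Ring rawRing using (Poly; X; constant; coeff; polynomials; ∑; _*ₚ_)
  open Ring polynomials using (_^_) renaming (∑ to ∑ₚ)
  open PolyRing 𝓡
  open Sums 𝓡
  open SetoidReasoning setoid

  coeff-map-upTo : ∀ n (c : ℕ → Carrier) k → k ℕ.< n → coeff (map c (upTo n)) k ≈ c k
  coeff-map-upTo n c k k<n = trans (reflexive (≡.cong (λ p → coeff p k) (List.map-upTo c n))) (go n c k k<n)
    where
    go : ∀ n (c : ℕ → Carrier) k → k ℕ.< n → coeff (Data.List.Base.applyUpTo c n) k ≈ c k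
    go (suc n) c zero    _         = refl
    go (suc n) c (suc k) (s≤s k<n) = go n (c ∘ suc) k k<n

  coeff-map-upTo-beyond : ∀ n (c : ℕ → Carrier) k → n ℕ.≤ k → coeff (map c (upTo n)) k ≈ 0#
  coeff-map-upTo-beyond n c k n≤k = trans (reflexive (≡.cong (λ p → coeff p k) (List.map-upTo c n))) (go n c k n≤k)
    where
    go : ∀ n (c : ℕ → Carrier) k → n ℕ.≤ k → coeff (Data.List.Base.applyUpTo c n) k ≈ 0#
    go zero    c k       _         = refl
    go (suc n) c (suc k) (s≤s n≤k) = go n (c ∘ suc) k n≤k

  coeff-∑ : ∀ {A : Set} (xs : List A) f k → coeff (∑ₚ xs f) k ≈ ∑ xs (λ x → coeff (f x) k)
  coeff-∑ []       f k = refl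
  coeff-∑ (x ∷ xs) f k = trans (coeff-+ (f x) (∑ₚ xs f) k) (+-congˡ (coeff-∑ xs f k))

  coeff-monomials : ∀ n (c : ℕ → Carrier) k → coeff (∑ₚ (upTo n) (λ i → constant (c i) *ₚ X ^ i)) k ≈ coeff (map c (upTo n)) k
  coeff-monomials n c k = trans (coeff-∑ (upTo n) _ k)
    (trans (∑-cong (upTo n) (λ i → coeff-constant-* (c i) (X ^ i) k)) (trans (go n c k) (reflexive (≡.cong (λ p → coeff p k) (≡.sym (List.map-upTo c n))))))
    where
    go : ∀ n (c : ℕ → Carrier) k → ∑ (upTo n) (λ i → c i * coeff (X ^ i) k) ≈ coeff (Data.List.Base.applyUpTo c n) k
    go zero    c k       = refl
    go (suc n) c zero    = begin
      ∑ (upTo (suc n)) (λ i → c i * coeff (X ^ i) 0)                     ≡⟨ ∑-upTo-suc n _ ⟩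
      c 0 * 1# + ∑ (upTo n) (λ i → c (suc i) * coeff (X *ₚ X ^ i) 0)     ≈⟨ +-cong (*-identityʳ _) (∑-0 (upTo n) (λ i → trans (*-congˡ (coeff-X*-zero (X ^ i))) (zeroʳ _))) ⟩
      c 0 + 0#                                                           ≈⟨ +-identityʳ _ ⟩
      c 0                                                                ∎
    go (suc n) c (suc k) = begin
      ∑ (upTo (suc n)) (λ i → c i * coeff (X ^ i) (suc k))                     ≡⟨ ∑-upTo-suc n _ ⟩
      c 0 * 0# + ∑ (upTo n) (λ i → c (suc i) * coeff (X *ₚ X ^ i) (suc k))     ≈⟨ +-cong (zeroʳ _) (∑-cong (upTo n) (λ i → *-congˡ (coeff-X*-suc (X ^ i) k))) ⟩
      0# + ∑ (upTo n) (λ i → c (suc i) * coeff (X ^ i) k)                      ≈⟨ trans (+-identityˡ _) (go n (c ∘ suc) k) ⟩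
      coeff (Data.List.Base.applyUpTo (c ∘ suc) n) k                           ∎

open PolyLists ℤ-commutativeRing using (coeff-map-upTo; coeff-map-upTo-beyond; coeff-monomials)

coeff-evenBinomials : ∀ r k → Ring.coeff ℤ-ring (evenBinomials r) k ≡ evenBinomial r k
coeff-evenBinomials r k with k ℕ.<? suc ⌊ r /2⌋
... | yes k<d = coeff-map-upTo (suc ⌊ r /2⌋) (evenBinomial r) k k<d
... | no  k≮d = ≡.trans (coeff-map-upTo-beyond (suc ⌊ r /2⌋) (evenBinomial r) k (ℕ.≮⇒≥ k≮d))
  (≡.sym (evenBinomial-vanish r k (ℕ.≮⇒≥ k≮d)))

at-q≡1≈evenBinomials : ∀ n → at-q≡1 (wordPolynomial n) ≈₁ evenBinomials (suc n)
at-q≡1≈evenBinomials n k = ≡.trans (at-q≡1-coefficients n k) (≡.sym (coeff-evenBinomials (suc n) k))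

evenBinomialPolynomial≈evenBinomials : ∀ r → evenBinomialPolynomial r ≈₁ evenBinomials r
evenBinomialPolynomial≈evenBinomials r k = ≡.trans
  (≡.cong (λ ks → Ring.coeff ℤ-ring (Ring.∑ ℤ[x] ks (λ k → Ring.constant ℤ-ring (evenBinomial r k) ·₁ Ring._^_ ℤ[x] q k)) k) (range-0 ⌊ r /2⌋))
  (coeff-monomials (suc ⌊ r /2⌋) (evenBinomial r) k)

evenBinomials-rec : Recurrence.SecondDifference ℤ[x]-commutativeRing (λ _ p → RawRing._*_ ℤ[x] q p) evenBinomials
evenBinomials-rec r k = begin
  coeff (B (2 ℕ.+ r) +ₚ B r) k
    ≡⟨ ≡.trans (coeff-+ (B (2 ℕ.+ r)) (B r) k) (≡.cong₂ ℤ._+_ (coeff-evenBinomials (2 ℕ.+ r) k) (coeff-evenBinomials r k)) ⟩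
  evenBinomial (2 ℕ.+ r) k ℤ.+ evenBinomial r k
    ≡⟨ evenBinomial-rec k r ⟩
  evenBinomial (1 ℕ.+ r) k ℤ.+ evenBinomial (1 ℕ.+ r) k ℤ.+ shiftedEvenBinomial r k
    ≡⟨ ≡.sym (≡.cong₂ ℤ._+_ (≡.trans (coeff-+ (B (1 ℕ.+ r)) (B (1 ℕ.+ r)) k)
         (≡.cong₂ ℤ._+_ (coeff-evenBinomials (1 ℕ.+ r) k) (coeff-evenBinomials (1 ℕ.+ r) k))) (coeff-X k)) ⟩
  coeff (B (1 ℕ.+ r) +ₚ B (1 ℕ.+ r)) k ℤ.+ coeff (q *ₚ B r) k
    ≡⟨ ≡.sym (coeff-+ (B (1 ℕ.+ r) +ₚ B (1 ℕ.+ r)) (q *ₚ B r) k) ⟩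
  coeff (B (1 ℕ.+ r) +ₚ B (1 ℕ.+ r) +ₚ q *ₚ B r) k ∎
  where
  B = evenBinomials
  open ≡.≡-Reasoning
  open Ring ℤ-ring using (coeff; _+ₚ_; _*ₚ_)
  open PolyRing ℤ-commutativeRing using (coeff-+; coeff-X*-zero; coeff-X*-suc)
  coeff-X : ∀ k → coeff (q *ₚ B r) k ≡ shiftedEvenBinomial r k
  coeff-X zero    = coeff-X*-zero (B r)
  coeff-X (suc k) = ≡.trans (coeff-X*-suc (B r) k) (coeff-evenBinomials r k)

-- Powers of 1 + √t and 1 - √t

module ConjugatePowers (𝓡 : CommutativeRing 0ℓ 0ℓ) where
  open CommutativeRing 𝓡 hiding (zero)
  open Ring rawRing using (_^_)
  open Recurrence 𝓡 using (SecondDifference)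
  open NaturalSolver commutativeSemiring using (solve; con; _:=_; _:*_; _:+_)
  open SetoidReasoning setoid

  -- The hypothesis says (p - 1)² = y; it is meant for p = 1 ± x and y = x².
  power-rec : ∀ p y → p * p + 1# ≈ p + p + y → SecondDifference (λ _ u → y * u) (p ^_)
  power-rec p y eq n = begin
    p * (p * p ^ n) + p ^ n             ≈⟨ solve 2 (λ p u → (p :* (p :* u)) :+ u := ((p :* p) :+ con 1) :* u) refl p (p ^ n) ⟩
    (p * p + 1#) * p ^ n                ≈⟨ *-congʳ eq ⟩
    (p + p + y) * p ^ n                 ≈⟨ solve 3 (λ p y u → ((p :+ p) :+ y) :* u := ((p :* u) :+ (p :* u)) :+ (y :* u)) refl p y (p ^ n) ⟩
    p * p ^ n + p * p ^ n + y * p ^ n   ∎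

  rec-+ : ∀ {y u v} → SecondDifference (λ _ w → y * w) u → SecondDifference (λ _ w → y * w) v →
    SecondDifference (λ _ w → y * w) (λ n → u n + v n)
  rec-+ {y} {u} {v} u-rec v-rec n = begin
    u (2 ℕ.+ n) + v (2 ℕ.+ n) + (u n + v n)     ≈⟨ solve 4 (λ a b c d → (a :+ b) :+ (c :+ d) := (a :+ c) :+ (b :+ d)) refl _ _ _ _ ⟩
    u (2 ℕ.+ n) + u n + (v (2 ℕ.+ n) + v n)     ≈⟨ +-cong (u-rec n) (v-rec n) ⟩
    u (1 ℕ.+ n) + u (1 ℕ.+ n) + y * u n + (v (1 ℕ.+ n) + v (1 ℕ.+ n) + y * v n)
      ≈⟨ solve 5 (λ a b y c d → ((a :+ a) :+ (y :* c)) :+ ((b :+ b) :+ (y :* d)) := ((a :+ b) :+ (a :+ b)) :+ (y :* (c :+ d))) refl _ _ y _ _ ⟩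
    u (1 ℕ.+ n) + v (1 ℕ.+ n) + (u (1 ℕ.+ n) + v (1 ℕ.+ n)) + y * (u n + v n) ∎

  rec-double : ∀ {y u} → SecondDifference (λ _ w → y * w) u → SecondDifference (λ _ w → y * w) (λ n → (1# + 1#) * u n)
  rec-double {y} {u} u-rec n = begin
    (1# + 1#) * u (2 ℕ.+ n) + (1# + 1#) * u n
      ≈⟨ sym (distribˡ _ _ _) ⟩
    (1# + 1#) * (u (2 ℕ.+ n) + u n)
      ≈⟨ *-congˡ (u-rec n) ⟩
    (1# + 1#) * (u (1 ℕ.+ n) + u (1 ℕ.+ n) + y * u n)
      ≈⟨ solve 4 (λ t a y b → t :* ((a :+ a) :+ (y :* b)) := ((t :* a) :+ (t :* a)) :+ (y :* (t :* b))) refl (1# + 1#) _ y _ ⟩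
    (1# + 1#) * u (1 ℕ.+ n) + (1# + 1#) * u (1 ℕ.+ n) + y * ((1# + 1#) * u n) ∎

  conjugate : Carrier → ℕ → Carrier
  conjugate x n = (1# + x) ^ n + (1# + - x) ^ n

  conjugate-rec : ∀ x → SecondDifference (λ _ u → x ^ 2 * u) (conjugate x)
  conjugate-rec x = rec-+ {u = (1# + x) ^_} {(1# + - x) ^_}
    (power-rec (1# + x) (x ^ 2)
      (solve 1 (λ x → ((con 1 :+ x) :* (con 1 :+ x)) :+ con 1 := ((con 1 :+ x) :+ (con 1 :+ x)) :+ (x :* (x :* con 1))) refl x))
    (power-rec m (x ^ 2) (begin
      -- Replacing 1 by (m + x)², where m = 1 - x, leaves an identity without negation.
      m * m + 1#                          ≈⟨ +-congˡ (sym (trans (*-cong m+x≈1 m+x≈1) (*-identityˡ 1#))) ⟩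
      m * m + (m + x) * (m + x)           ≈⟨ solve 2 (λ m x → (m :* m) :+ ((m :+ x) :* (m :+ x)) := ((m :* (m :+ x)) :+ (m :* (m :+ x))) :+ (x :* (x :* con 1))) refl m x ⟩
      m * (m + x) + m * (m + x) + x ^ 2   ≈⟨ +-congʳ (+-cong m≈ m≈) ⟩
      m + m + x ^ 2                       ∎))
    where
    m = 1# + - x
    m+x≈1 : m + x ≈ 1#
    m+x≈1 = trans (+-assoc _ _ _) (trans (+-congˡ (-‿inverseˡ x)) (+-identityʳ _))
    m≈ : m * (m + x) ≈ m
    m≈ = trans (*-congˡ m+x≈1) (*-identityʳ m)

module SubstituteSquare where
  open PolyRing ℤ-commutativeRing using (constant-cong)
  open Ring ℤ-ring using (constant)

  constant-0 : constant 0ℤ ≈₁ []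
  constant-0 zero    = ≡.refl
  constant-0 (suc _) = ≡.refl

  constant-+ : ∀ a b → constant (a ℤ.+ b) ≈₁ RawRing._+_ ℤ[x] (constant a) (constant b)
  constant-+ a b zero    = ≡.refl
  constant-+ a b (suc _) = ≡.refl

  open Evaluation ℤ-commutativeRing ℤ[x]-commutativeRing constant constant-cong constant-0 constant-+ (Ring._^_ ℤ[x] q 2) public

-- Both sequences start with 2, 2. The factor `two` stands on the left so that no polynomial over ℤ
-- has to be halved.
substitute-square≈conjugatePowers : ∀ r → two ·₁ substitute-square (evenBinomials r) ≈₁ conjugatePowers r
substitute-square≈conjugatePowers = unique
  {λ _ p → q² * p} {λ r → two * substitute-square (evenBinomials r)} {conjugatePowers}
  (λ _ {u} {v} u≈v → *-congˡ {q²} {u} {v} u≈v)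
  (rec-double {q²} {λ r → substitute-square (evenBinomials r)} λ r → begin
    sub (B (2 ℕ.+ r)) + sub (B r)                        ≈⟨ sym {sub (B (2 ℕ.+ r) + B r)} {sub (B (2 ℕ.+ r)) + sub (B r)} (evaluate-+ (B (2 ℕ.+ r)) (B r)) ⟩
    sub (B (2 ℕ.+ r) + B r)                              ≈⟨ evaluate-cong (B (2 ℕ.+ r) + B r) (B (1 ℕ.+ r) + B (1 ℕ.+ r) + q * B r) (evenBinomials-rec r) ⟩
    sub (B (1 ℕ.+ r) + B (1 ℕ.+ r) + q * B r)            ≈⟨ evaluate-+ (B (1 ℕ.+ r) + B (1 ℕ.+ r)) (q * B r) ⟩
    sub (B (1 ℕ.+ r) + B (1 ℕ.+ r)) + sub (q * B r)      ≈⟨ +-cong {sub (B (1 ℕ.+ r) + B (1 ℕ.+ r))} {sub (B (1 ℕ.+ r)) + sub (B (1 ℕ.+ r))} {sub (q * B r)} {q² * sub (B r)}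
                                                              (evaluate-+ (B (1 ℕ.+ r)) (B (1 ℕ.+ r))) (evaluate-X* (B r)) ⟩
    sub (B (1 ℕ.+ r)) + sub (B (1 ℕ.+ r)) + q² * sub (B r)  ∎)
  (conjugate-rec q)
  start₀ start₁
  where
  open CommutativeRing ℤ[x]-commutativeRing hiding (zero)
  open Recurrence ℤ[x]-commutativeRing using (unique)
  open ConjugatePowers ℤ[x]-commutativeRing
  open SubstituteSquare
  open SetoidReasoning setoid
  B = evenBinomials
  sub = substitute-square
  q² : Poly₁
  q² = Ring._^_ ℤ[x] q 2
  start₀ : two * sub (B 0) ≈ conjugate q 0
  start₀ zero = ≡.refl
  start₀ (suc zero) = ≡.refl
  start₀ (suc (suc zero)) = ≡.refl
  start₀ (suc (suc (suc zero))) = ≡.refl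
  start₀ (suc (suc (suc (suc _)))) = ≡.refl
  start₁ : two * sub (B 1) ≈ conjugate q 1
  start₁ zero = ≡.refl
  start₁ (suc zero) = ≡.refl
  start₁ (suc (suc zero)) = ≡.refl
  start₁ (suc (suc (suc zero))) = ≡.refl
  start₁ (suc (suc (suc (suc _)))) = ≡.refl

-- Sturm sequences over an ordered ring

-- A constructive form of an ordered ring: `cotransitive` takes the place of trichotomy, and
-- `cancel` that of dividing by a positive element.
record IsPositiveCone (𝓡 : CommutativeRing 0ℓ 0ℓ) (Pos : CommutativeRing.Carrier 𝓡 → Set) : Set where
  open CommutativeRing 𝓡
  field
    resp         : ∀ {x y} → x ≈ y → Pos x → Pos y
    +-pos        : ∀ {x y} → Pos x → Pos y → Pos (x + y)
    *-pos        : ∀ {x y} → Pos x → Pos y → Pos (x * y)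
    1-pos        : Pos 1#
    cotransitive : ∀ x y → Pos (x + y) → Pos x ⊎ Pos y
    cancel       : ∀ {x y} → Pos x → x * y ≈ 0# → y ≈ 0#
    archimedean  : ∀ x → Σ[ m ∈ Carrier ] (Pos m × Pos (m + - x))

module Sturm (𝓡 : CommutativeRing 0ℓ 0ℓ) (Pos : CommutativeRing.Carrier 𝓡 → Set) (cone : IsPositiveCone 𝓡 Pos) where
  open CommutativeRing 𝓡 hiding (zero)
  open IsPositiveCone cone
  open Ring rawRing using (Poly; eval)
  open Algebra.Properties.Ring ring using (-‿distribˡ-*; -‿distribʳ-*; -‿involutive; -‿+-comm; -0#≈0#; +-cancelʳ)
  open NaturalSolver commutativeSemiring using (solve; con; _:=_; _:*_; _:+_)
  open SetoidReasoning setoid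

  infix 4 _≺_
  _≺_ : Carrier → Carrier → Set
  x ≺ y = Pos (y + - x)

  telescope : ∀ x y z → (z + - y) + (y + - x) ≈ z + - x
  telescope x y z = begin
    (z + - y) + (y + - x)   ≈⟨ solve 4 (λ z n y m → (z :+ n) :+ (y :+ m) := (z :+ m) :+ (n :+ y)) refl z (- y) y (- x) ⟩
    (z + - x) + (- y + y)   ≈⟨ +-congˡ (-‿inverseˡ y) ⟩
    (z + - x) + 0#          ≈⟨ +-identityʳ _ ⟩
    z + - x                 ∎

  ≺-trans : ∀ {x y z} → x ≺ y → y ≺ z → x ≺ z
  ≺-trans {x} {y} {z} x≺y y≺z = resp (telescope x y z) (+-pos y≺z x≺y)

  neg-difference : ∀ x y → - (x + - y) ≈ y + - x
  neg-difference x y = trans (sym (-‿+-comm x (- y))) (trans (+-congˡ (-‿involutive y)) (+-comm _ _))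

  sgn : ℕ → Carrier → Carrier
  sgn zero    x = x
  sgn (suc j) x = - sgn j x

  sgn-cong : ∀ j {x y} → x ≈ y → sgn j x ≈ sgn j y
  sgn-cong zero    x≈y = x≈y
  sgn-cong (suc j) x≈y = -‿cong (sgn-cong j x≈y)

  sgn-neg : ∀ j x → sgn j (- x) ≈ - sgn j x
  sgn-neg zero    x = refl
  sgn-neg (suc j) x = -‿cong (sgn-neg j x)

  sgn-* : ∀ j x y → sgn j (x * y) ≈ sgn j x * y
  sgn-* zero    x y = refl
  sgn-* (suc j) x y = trans (-‿cong (sgn-* j x y)) (-‿distribˡ-* (sgn j x) y)

  sgn-+ : ∀ j x y → sgn j (x + y) ≈ sgn j x + sgn j y
  sgn-+ zero    x y = refl
  sgn-+ (suc j) x y = trans (-‿cong (sgn-+ j x y)) (sym (-‿+-comm _ _))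

  -- The expected sign is prescribed through the parity of j, so an alternating pattern is one
  -- statement in j and no sign needs to be decided.
  Sign : ℕ → Carrier → Set
  Sign j x = Pos (sgn j x)

  sign-resp : ∀ j {x y} → x ≈ y → Sign j x → Sign j y
  sign-resp j x≈y = resp (sgn-cong j x≈y)

  sign-*-pos : ∀ j {x y} → Sign j x → Pos y → Sign j (x * y)
  sign-*-pos j x-sign y-pos = resp (sym (sgn-* j _ _)) (*-pos x-sign y-pos)

  sign-*-neg : ∀ j {x y} → Sign j x → Pos (- y) → Sign (suc j) (x * y)
  sign-*-neg j {x} {y} x-sign -y-pos = resp (begin
    sgn j x * - y         ≈⟨ sym (-‿distribʳ-* (sgn j x) y) ⟩
    - (sgn j x * y)       ≈⟨ -‿cong (sym (sgn-* j x y)) ⟩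
    - sgn j (x * y)       ∎) (*-pos x-sign -y-pos)

  cancel-sign : ∀ j {x y} → Sign j x → x * y ≈ 0# → y ≈ 0#
  cancel-sign j {x} {y} x-sign xy≈0 = cancel x-sign (trans (sym (sgn-* j x y)) (trans (sgn-cong j xy≈0) (sgn-0 j)))
    where
    sgn-0 : ∀ j → sgn j 0# ≈ 0#
    sgn-0 zero    = refl
    sgn-0 (suc j) = trans (-‿cong (sgn-0 j)) -0#≈0#

  Π : ℕ → (ℕ → Carrier) → Carrier → Carrier
  Π zero    z x = 1#
  Π (suc d) z x = Π d z x * (x + - z d)

  -- With the zeros listed in decreasing order, exactly the first j factors are negative at x.
  sign-Π : ∀ d z x j → j ℕ.≤ d → (∀ i → i ℕ.< j → x ≺ z i) → (∀ i → j ℕ.≤ i → i ℕ.< d → z i ≺ x) → Sign j (Π d z x)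
  sign-Π zero    z x zero _   below above = 1-pos
  sign-Π (suc d) z x j    j≤  below above with ℕ.m≤n⇒m<n∨m≡n j≤
  ... | inj₁ (s≤s j≤d) = sign-*-pos j (sign-Π d z x j j≤d below (λ i j≤i i<d → above i j≤i (ℕ.m<n⇒m<1+n i<d))) (above d j≤d ℕ.≤-refl)
  ... | inj₂ ≡.refl    = sign-*-neg d
    (sign-Π d z x d ℕ.≤-refl (λ i i<d → below i (ℕ.m<n⇒m<1+n i<d)) (λ i d≤i i<d → contradiction d≤i (ℕ.<⇒≱ i<d)))
    (resp (sym (neg-difference x (z d))) (below d ℕ.≤-refl))

  -- A list of exactly d + 1 entries ending in ℓ. Degree is read from the length, since a real
  -- coefficient cannot be tested for zero.
  data Degree (ℓ : Carrier) : ℕ → Poly → Set where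
    leading : ∀ {a} → a ≈ ℓ → Degree ℓ 0 (a ∷ [])
    _∷_     : ∀ a {d p} → Degree ℓ d p → Degree ℓ (suc d) (a ∷ p)

  -- The quotient of X p(X) − z p(z), not of p itself, by X − z.
  quotient : Poly → Carrier → Poly
  quotient []      z = []
  quotient (a ∷ p) z = eval (a ∷ p) z ∷ quotient p z

  quotient-degree : ∀ {ℓ d p} z → Degree ℓ d p → Degree ℓ d (quotient p z)
  quotient-degree z (leading a≈ℓ) = leading (trans (+-congˡ (zeroʳ z)) (trans (+-identityʳ _) a≈ℓ))
  quotient-degree z (a ∷ deg)     = _ ∷ quotient-degree z deg

  -- The difference x - z enters as δ with x = z + δ, which keeps the identity free of subtraction.
  eval-quotient : ∀ p {x z δ} → x ≈ z + δ → x * eval p x ≈ z * eval p z + δ * eval (quotient p z) x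
  eval-quotient []      {x} {z} {δ} x≈z+δ = trans (zeroʳ x) (sym (trans (+-cong (zeroʳ z) (zeroʳ δ)) (+-identityˡ 0#)))
  eval-quotient (a ∷ p) {x} {z} {δ} x≈z+δ = begin
    x * (a + x * eval p x)
      ≈⟨ *-congˡ (trans (+-congˡ (eval-quotient p x≈z+δ)) (sym (+-assoc _ _ _))) ⟩
    x * (a + z * eval p z + δ * Q)
      ≈⟨ distribˡ _ _ _ ⟩
    x * (a + z * eval p z) + x * (δ * Q)
      ≈⟨ +-congʳ (*-congʳ x≈z+δ) ⟩
    (z + δ) * (a + z * eval p z) + x * (δ * Q)
      ≈⟨ solve 5 (λ z d e x q → ((z :+ d) :* e) :+ (x :* (d :* q)) := (z :* e) :+ (d :* (e :+ (x :* q)))) refl z δ (a + z * eval p z) x Q ⟩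
    z * (a + z * eval p z) + δ * ((a + z * eval p z) + x * Q) ∎
    where Q = eval (quotient p z) x

  Decreasing : ℕ → (ℕ → Carrier) → Set
  Decreasing d z = ∀ i j → i ℕ.< j → j ℕ.< d → z j ≺ z i

  difference-split : ∀ x z → x ≈ z + (x + - z)
  difference-split x z = sym (begin
    z + (x + - z)   ≈⟨ solve 3 (λ z x n → z :+ (x :+ n) := x :+ (z :+ n)) refl z x (- z) ⟩
    x + (z + - z)   ≈⟨ +-congˡ (-‿inverseʳ z) ⟩
    x + 0#          ≈⟨ +-identityʳ x ⟩
    x               ∎)

  -- Divide by the factor of the lowest zero `z d`. The other zeros pass to the quotient because z i
  -- - z d is positive and hence cancellable.
  factorisation : ∀ {ℓ} d {p} → Degree ℓ d p → ∀ z → Decreasing d z → (∀ i → i ℕ.< d → eval p (z i) ≈ 0#) →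
    ∀ x → eval p x ≈ ℓ * Π d z x
  factorisation {ℓ} zero    (leading {a} a≈ℓ) z dec zeros x = begin
    a + x * 0#   ≈⟨ trans (+-congˡ (zeroʳ x)) (+-identityʳ a) ⟩
    a            ≈⟨ a≈ℓ ⟩
    ℓ            ≈⟨ sym (*-identityʳ ℓ) ⟩
    ℓ * 1#       ∎
  factorisation {ℓ} (suc d) (_∷_ a {p = p} deg) z dec zeros x = begin
    eval (a ∷ p) x                                ≈⟨ divide x ⟩
    (x + - z d) * eval (quotient p (z d)) x       ≈⟨ *-congˡ (factorisation d (quotient-degree (z d) deg) z
                                                       (λ i j i<j j<d → dec i j i<j (ℕ.m<n⇒m<1+n j<d)) quotient-zeros x) ⟩
    (x + - z d) * (ℓ * Π d z x)                   ≈⟨ solve 3 (λ u l v → u :* (l :* v) := l :* (v :* u)) refl _ _ _ ⟩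
    ℓ * Π (suc d) z x                             ∎
    where
    divide : ∀ x → eval (a ∷ p) x ≈ (x + - z d) * eval (quotient p (z d)) x
    divide x = begin
      a + x * eval p x                                                     ≈⟨ +-congˡ (eval-quotient p (difference-split x (z d))) ⟩
      a + (z d * eval p (z d) + (x + - z d) * eval (quotient p (z d)) x)   ≈⟨ sym (+-assoc _ _ _) ⟩
      eval (a ∷ p) (z d) + (x + - z d) * eval (quotient p (z d)) x         ≈⟨ +-congʳ (zeros d ℕ.≤-refl) ⟩
      0# + (x + - z d) * eval (quotient p (z d)) x                         ≈⟨ +-identityˡ _ ⟩
      (x + - z d) * eval (quotient p (z d)) x                              ∎
    quotient-zeros : ∀ i → i ℕ.< d → eval (quotient p (z d)) (z i) ≈ 0#
    quotient-zeros i i<d = cancel (dec i d i<d ℕ.≤-refl) (trans (sym (divide (z i))) (zeros i (ℕ.m<n⇒m<1+n i<d)))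

  -- A vanishing product must be turned into an explicit vanishing factor. Each gap z d ≺ z i yields
  -- z d ≺ x or x ≺ z i. In the first case the last factor cancels and the induction applies; if x
  -- lies below all other zeros, their product has a known sign and cancels, leaving x = z d.
  zero-of-Π : ∀ d z → Decreasing (suc d) z → ∀ x → Π (suc d) z x ≈ 0# → ∃[ i ] (i ℕ.< suc d × x ≈ z i)
  zero-of-Π d z dec x Πx≈0 with scan d ℕ.≤-refl
    where
    scan : ∀ n → n ℕ.≤ d → z d ≺ x ⊎ (∀ i → i ℕ.< n → x ≺ z i)
    scan zero    _   = inj₂ λ _ ()
    scan (suc n) n<d with scan n (ℕ.<⇒≤ n<d) | cotransitive (z n + - x) (x + - z d) (resp (sym (telescope (z d) x (z n))) (dec n d n<d ℕ.≤-refl))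
    ... | inj₁ above | _           = inj₁ above
    ... | inj₂ below | inj₂ above  = inj₁ above
    ... | inj₂ below | inj₁ x≺zn   = inj₂ λ i i<1+n → case (ℕ.m<1+n⇒m<n∨m≡n i<1+n)
      where
      case : ∀ {i} → i ℕ.< n ⊎ i ≡ n → x ≺ z i
      case (inj₁ i<n)    = below _ i<n
      case (inj₂ ≡.refl) = x≺zn
  ... | inj₂ below = d , ℕ.≤-refl , difference-0 (cancel-sign d (sign-Π d z x d ℕ.≤-refl below (λ i d≤i i<d → contradiction d≤i (ℕ.<⇒≱ i<d))) Πx≈0)
    where
    difference-0 : x + - z d ≈ 0# → x ≈ z d
    difference-0 eq = trans (difference-split x (z d)) (trans (+-congˡ eq) (+-identityʳ (z d)))
  zero-of-Π zero    z dec x Πx≈0 | inj₁ above = 0 , s≤s z≤n , (begin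
    x                       ≈⟨ difference-split x (z 0) ⟩
    z 0 + (x + - z 0)       ≈⟨ +-congˡ (trans (sym (*-identityˡ _)) Πx≈0) ⟩
    z 0 + 0#                ≈⟨ +-identityʳ (z 0) ⟩
    z 0                     ∎)
  zero-of-Π (suc d) z dec x Πx≈0 | inj₁ above
    with i , i<d , x≈zi ← zero-of-Π d z (λ i j i<j j<d → dec i j i<j (ℕ.m<n⇒m<1+n j<d)) x (cancel above (trans (*-comm _ _) Πx≈0)) =
    i , ℕ.m<n⇒m<1+n i<d , x≈zi

  -- The bound 2 (−1)^d p(x) > 1 rather than mere positivity makes the induction on the degree work.
  sign-at-−∞ : ∀ {ℓ} d {p} → Degree ℓ d p → Pos (ℓ + ℓ + - 1#) →
    Σ[ m ∈ Carrier ] (Pos m × (∀ x → Pos (- x + - m) → Pos (sgn d (eval p x) + sgn d (eval p x) + - 1#)))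
  sign-at-−∞ {ℓ} zero (leading {a} a≈ℓ) 2ℓ>1 = 1# , 1-pos , λ x _ → resp (+-congʳ (+-cong (value x) (value x))) 2ℓ>1
    where
    value : ∀ x → ℓ ≈ a + x * 0#
    value x = sym (trans (+-congˡ (zeroʳ x)) (trans (+-identityʳ a) a≈ℓ))
  sign-at-−∞ (suc d) (_∷_ a {p = p} deg) 2ℓ>1
    with m , m>0 , large ← sign-at-−∞ d deg 2ℓ>1
    with k , k>0 , k>c ← archimedean (1# + - (- sgn d a + - sgn d a)) = m + k , +-pos m>0 k>0 , bound
    where
    bound : ∀ x → Pos (- x + - (m + k)) → Pos (sgn (suc d) (a + x * eval p x) + sgn (suc d) (a + x * eval p x) + - 1#)
    bound x x-low = resp identity (+-pos (*-pos -x>0 (large x -x>m)) (+-pos -x>k k>c))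
      where
      A = sgn d a
      u = sgn d (eval p x)
      peel : ∀ m k → - x + - (m + k) + m ≈ - x + - k
      peel m k = begin
        - x + - (m + k) + m         ≈⟨ +-congʳ (+-congˡ (sym (-‿+-comm m k))) ⟩
        - x + (- m + - k) + m       ≈⟨ solve 4 (λ x n l m → (x :+ (n :+ l)) :+ m := (x :+ l) :+ (n :+ m)) refl (- x) (- m) (- k) m ⟩
        - x + - k + (- m + m)       ≈⟨ trans (+-congˡ (-‿inverseˡ m)) (+-identityʳ _) ⟩
        - x + - k                   ∎
      -x>k : Pos (- x + - k)
      -x>k = resp (peel m k) (+-pos x-low m>0)
      -x>m : Pos (- x + - m)
      -x>m = resp (trans (+-congʳ (+-congˡ (-‿cong (+-comm m k)))) (peel k m)) (+-pos x-low k>0)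
      -x>0 : Pos (- x)
      -x>0 = resp (trans (+-assoc _ _ _) (trans (+-congˡ (-‿inverseˡ k)) (+-identityʳ _))) (+-pos -x>k k>0)
      value : sgn (suc d) (a + x * eval p x) ≈ - A + - x * u
      value = begin
        - sgn d (a + x * eval p x)          ≈⟨ -‿cong (trans (sgn-+ d a _) (+-congˡ (trans (sgn-cong d (*-comm x _)) (sgn-* d (eval p x) x)))) ⟩
        - (A + u * x)                       ≈⟨ sym (-‿+-comm A (u * x)) ⟩
        - A + - (u * x)                     ≈⟨ +-congˡ (trans (-‿cong (*-comm u x)) (-‿distribˡ-* x u)) ⟩
        - A + - x * u                       ∎
      -- With A = (-1)^d a and u = (-1)^d p(x), the quantity 2(-A - x u) - 1 splits into -x(2u - 1),
      -- -x - k and k - 1 - 2A. Each part is positive, the last by the choice of k.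
      identity : - x * (u + u + - 1#) + ((- x + - k) + (k + - (1# + - (- A + - A)))) ≈
                 sgn (suc d) (a + x * eval p x) + sgn (suc d) (a + x * eval p x) + - 1#
      identity = begin
        - x * (u + u + - 1#) + ((- x + - k) + (k + - (1# + - (- A + - A))))
          ≈⟨ +-cong (trans (distribˡ _ _ _) (+-congˡ (trans (sym (-‿distribʳ-* (- x) 1#)) (-‿cong (*-identityʳ (- x))))))
               (+-congˡ (+-congˡ (neg-difference 1# (- A + - A)))) ⟩
        (- x * (u + u) + - - x) + ((- x + - k) + (k + (- A + - A + - 1#)))
          ≈⟨ solve 7 (λ y u z n k a i → ((y :* (u :+ u)) :+ z) :+ ((y :+ n) :+ (k :+ ((a :+ a) :+ i)))
                        := ((((a :+ (y :* u)) :+ (a :+ (y :* u))) :+ i) :+ ((y :+ z) :+ (n :+ k)))) refl (- x) u (- - x) (- k) k (- A) (- 1#) ⟩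
        (- A + - x * u) + (- A + - x * u) + - 1# + ((- x + - - x) + (- k + k))
          ≈⟨ +-cong (+-congʳ (sym (+-cong value value))) (trans (+-cong (-‿inverseʳ (- x)) (-‿inverseˡ k)) (+-identityˡ 0#)) ⟩
        sgn (suc d) (a + x * eval p x) + sgn (suc d) (a + x * eval p x) + - 1# + 0#
          ≈⟨ +-identityʳ _ ⟩
        sgn (suc d) (a + x * eval p x) + sgn (suc d) (a + x * eval p x) + - 1# ∎

  sign-low : ∀ {ℓ} d {p} → Degree ℓ d p → Pos (ℓ + ℓ + - 1#) → Σ[ m ∈ Carrier ] (Pos m × (∀ x → Pos (- x + - m) → Sign d (eval p x)))
  sign-low d deg 2ℓ>1 with m , m>0 , large ← sign-at-−∞ d deg 2ℓ>1 = m , m>0 , λ x x-low → halve (large x x-low)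
    where
    halve : ∀ {s} → Pos (s + s + - 1#) → Pos s
    -- From s + s > 0 cotransitivity gives s > 0 without a division by 2.
    halve {s} h with cotransitive s s (resp (trans (+-assoc _ _ _) (trans (+-congˡ (-‿inverseˡ 1#)) (+-identityʳ _))) (+-pos h 1-pos))
    ... | inj₁ s>0 = s>0
    ... | inj₂ s>0 = s>0

  extend : ℕ → (ℕ → Carrier) → Carrier → ℕ → Carrier
  extend zero    z b i       = b
  extend (suc d) z b zero    = z 0
  extend (suc d) z b (suc i) = extend d (z ∘ suc) b i

  extend-< : ∀ d z b i → i ℕ.< d → extend d z b i ≡ z i
  extend-< (suc d) z b zero    _         = ≡.refl
  extend-< (suc d) z b (suc i) (s≤s i<d) = extend-< d (z ∘ suc) b i i<d

  extend-≡ : ∀ d z b → extend d z b d ≡ b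
  extend-≡ zero    z b = ≡.refl
  extend-≡ (suc d) z b = extend-≡ d (z ∘ suc) b

  -- Interlacing zeros of a family with a Sturm recurrence

  module Family (p : ℕ → Poly) (ℓ : ℕ → Carrier) (degree : ∀ r → Degree (ℓ r) ⌊ r /2⌋ (p r))
    (ℓ-pos : ∀ r → Pos (ℓ r)) (2ℓ>1 : ∀ r → Pos (ℓ r + ℓ r + - 1#))
    (p-0 : ∀ x → eval (p 0) x ≈ 1#) (p-1 : ∀ x → eval (p 1) x ≈ 1#)
    (p-rec : ∀ r x → eval (p (2 ℕ.+ r)) x + eval (p r) x ≈ eval (p (1 ℕ.+ r)) x + eval (p (1 ℕ.+ r)) x + x * eval (p r) x)
    (ivt : ∀ r j {x y} → x ≺ y → Sign (suc j) (eval (p r) x) → Sign j (eval (p r) y) →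
      Σ[ w ∈ Carrier ] (x ≺ w × w ≺ y × eval (p r) w ≈ 0#)) where

    -- At 0 the term with the factor x drops out and the constant sequence 1 solves what remains.
    -- This is the sign at the uppermost node.
    p-at-0 : ∀ r → eval (p r) 0# ≈ 1#
    p-at-0 = Recurrence.unique 𝓡 {λ _ _ → 0#} (λ _ _ → refl) (λ r → trans (p-rec r 0#) (+-congˡ (zeroˡ _)))
      (λ _ → sym (+-identityʳ _)) (p-0 0#) (p-1 0#)

    -- The sign condition says that the zeros of p (n + 1) interlace with those of p n.
    record Zeros (n : ℕ) : Set where
      d = ⌊ suc n /2⌋
      field
        z          : ℕ → Carrier
        negative   : ∀ i → i ℕ.< d → z i ≺ 0#
        decreasing : Decreasing d z
        zeros      : ∀ i → i ℕ.< d → eval (p (suc n)) (z i) ≈ 0#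
        signs      : ∀ i → i ℕ.< d → Sign i (eval (p n) (z i))

    module Step (n : ℕ) (Z : Zeros n) where
      open Zeros Z
      d′ = ⌊ 2 ℕ.+ n /2⌋

      d≤d′ : d ℕ.≤ d′
      d≤d′ = ℕ.⌊n/2⌋-mono (ℕ.n≤1+n (suc n))

      d′≤1+d : d′ ℕ.≤ suc d
      d′≤1+d = s≤s (ℕ.⌊n/2⌋-mono (ℕ.n≤1+n n))

      -- A node below the known zeros, so far left that the leading term determines the sign of the
      -- next polynomial there; it stands in for -∞.
      lowest : Σ[ b ∈ Carrier ] (Sign d′ (eval (p (2 ℕ.+ n)) b) × b ≺ 0# × (∀ i → i ℕ.< d → suc i ≡ d → b ≺ z i))
      lowest
        with m , m>0 , low ← sign-low d′ (degree (2 ℕ.+ n)) (2ℓ>1 (2 ℕ.+ n))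
        -- For d > 0 this is the lowest zero. For d = 0 it is an arbitrary value, and the last
        -- condition on the node is then empty.
        with k , k>0 , k> ← archimedean (- z (ℕ.pred d)) =
        - (m + k)
        , low _ (resp (begin
            k                         ≈⟨ sym (+-identityˡ k) ⟩
            0# + k                    ≈⟨ +-congʳ (sym (-‿inverseʳ m)) ⟩
            m + - m + k               ≈⟨ solve 3 (λ m n k → (m :+ n) :+ k := (m :+ k) :+ n) refl m (- m) k ⟩
            m + k + - m               ≈⟨ +-congʳ (sym (-‿involutive (m + k))) ⟩
            - (- (m + k)) + - m       ∎) k>0)
        , resp (trans (sym (-‿involutive (m + k))) (sym (+-identityˡ _))) (+-pos m>0 k>0)
        , λ i i<d 1+i≡d → resp (begin
            m + (k + - - z (ℕ.pred d))     ≈⟨ +-congˡ (+-congˡ (trans (-‿involutive _) (reflexive (≡.cong z (≡.sym (≡.cong ℕ.pred 1+i≡d)))))) ⟩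
            m + (k + z i)                  ≈⟨ trans (sym (+-assoc _ _ _)) (+-comm _ _) ⟩
            z i + (m + k)                  ≈⟨ +-congˡ (sym (-‿involutive (m + k))) ⟩
            z i + - (- (m + k))            ∎) (+-pos m>0 k>)

      b = proj₁ lowest

      -- The nodes 0, z 0, ..., z (d - 1), b in decreasing order. The last one falls within the
      -- indices up to d′ exactly when the degree grows, that is, when d′ = d + 1.
      v : ℕ → Carrier
      v zero    = 0#
      v (suc i) = extend d z b i

      v-z : ∀ i → i ℕ.< d → v (suc i) ≡ z i
      v-z = extend-< d z b

      split : ∀ {j} → j ℕ.< d′ → j ℕ.< d ⊎ (j ≡ d × d′ ≡ suc d)
      split j<d′ with ℕ.m<1+n⇒m<n∨m≡n (ℕ.<-≤-trans j<d′ d′≤1+d)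
      ... | inj₁ j<d    = inj₁ j<d
      ... | inj₂ ≡.refl = inj₂ (≡.refl , ℕ.≤-antisym d′≤1+d j<d′)

      v-step : ∀ j → j ℕ.< d′ → v (suc j) ≺ v j
      v-step j j<d′ with split j<d′
      v-step zero    j<d′ | inj₁ j<d = ≡.subst (_≺ 0#) (≡.sym (v-z 0 j<d)) (negative 0 j<d)
      v-step (suc i) j<d′ | inj₁ j<d = ≡.subst₂ _≺_ (≡.sym (v-z (suc i) j<d)) (≡.sym (v-z i (ℕ.<⇒≤ j<d))) (decreasing i (suc i) ℕ.≤-refl j<d)
      v-step j       j<d′ | inj₂ (j≡d , _) = ≡.subst (_≺ v j) (≡.sym (≡.trans (≡.cong (λ i → extend d z b i) j≡d) (extend-≡ d z b))) (b≺ j j≡d)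
        where
        b≺ : ∀ j → j ≡ d → b ≺ v j
        b≺ zero    _     = proj₁ (proj₂ (proj₂ lowest))
        b≺ (suc i) 1+i≡d = ≡.subst (b ≺_) (≡.sym (v-z i (ℕ.≤-reflexive 1+i≡d))) (proj₂ (proj₂ (proj₂ lowest)) i (ℕ.≤-reflexive 1+i≡d) 1+i≡d)

      v-decreasing : ∀ i j → i ℕ.< j → j ℕ.≤ d′ → v j ≺ v i
      v-decreasing i (suc j) (s≤s i≤j) j<d′ with ℕ.m≤n⇒m<n∨m≡n i≤j
      ... | inj₁ i<j    = ≺-trans (v-step j j<d′) (v-decreasing i j i<j (ℕ.<⇒≤ j<d′))
      ... | inj₂ ≡.refl = v-step j j<d′

      -- At a zero of p (n + 1) the recurrence reads p (n + 2) = −(1 − t) p n.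
      z-sign : ∀ i → i ℕ.< d → Sign (suc i) (eval (p (2 ℕ.+ n)) (z i))
      z-sign i i<d = resp (sgn-neg i _) (sign-resp i (begin
        y * (1# + - t)         ≈⟨ trans (distribˡ y 1# (- t)) (+-cong (*-identityʳ y) (trans (sym (-‿distribʳ-* y t)) (-‿cong (*-comm y t)))) ⟩
        y + - (t * y)          ≈⟨ neg-eq ⟩
        - eval (p (2 ℕ.+ n)) t ∎) (sign-*-pos i (signs i i<d) (+-pos 1-pos (resp (+-identityˡ _) (negative i i<d)))))
        where
        t = z i
        y = eval (p n) t
        E = eval (p (2 ℕ.+ n)) t
        rec : E + y ≈ t * y
        rec = trans (p-rec n t) (trans (+-congʳ (trans (+-cong (zeros i i<d) (zeros i i<d)) (+-identityˡ 0#))) (+-identityˡ _))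
        neg-eq : y + - (t * y) ≈ - E
        neg-eq = begin
          y + - (t * y)          ≈⟨ +-congˡ (trans (-‿cong (sym rec)) (sym (-‿+-comm E y))) ⟩
          y + (- E + - y)        ≈⟨ solve 3 (λ y m n → y :+ (m :+ n) := m :+ (y :+ n)) refl y (- E) (- y) ⟩
          - E + (y + - y)        ≈⟨ trans (+-congˡ (-‿inverseʳ y)) (+-identityʳ _) ⟩
          - E                    ∎

      v-sign : ∀ j → j ℕ.≤ d′ → Sign j (eval (p (2 ℕ.+ n)) (v j))
      v-sign zero    _    = resp (sym (p-at-0 (2 ℕ.+ n))) 1-pos
      v-sign (suc i) i<d′ with split i<d′
      ... | inj₁ i<d               = ≡.subst (λ y → Sign (suc i) (eval (p (2 ℕ.+ n)) y)) (≡.sym (v-z i i<d)) (z-sign i i<d)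
      ... | inj₂ (i≡d , d′≡1+d) = ≡.subst₂ (λ j y → Sign j (eval (p (2 ℕ.+ n)) y)) (≡.trans d′≡1+d (≡.cong suc (≡.sym i≡d)))
        (≡.sym (≡.trans (≡.cong (λ k → extend d z b k) i≡d) (extend-≡ d z b))) (proj₁ (proj₂ lowest))

      between : ∀ j → j ℕ.< d′ → Σ[ w ∈ Carrier ] (v (suc j) ≺ w × w ≺ v j × eval (p (2 ℕ.+ n)) w ≈ 0#)
      between j j<d′ = ivt (2 ℕ.+ n) j (v-step j j<d′) (v-sign (suc j) j<d′) (v-sign j (ℕ.<⇒≤ j<d′))

      w-at : ∀ {j} → Dec (j ℕ.< d′) → Carrier
      w-at (yes j<d′) = proj₁ (between _ j<d′)
      w-at (no  _)    = 0#

      w : ℕ → Carrier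
      w j = w-at (j ℕ.<? d′)

      w-properties : ∀ j → j ℕ.< d′ → v (suc j) ≺ w j × w j ≺ v j × eval (p (2 ℕ.+ n)) (w j) ≈ 0#
      w-properties j j<d′ with j ℕ.<? d′
      ... | yes p = proj₂ (between j p)
      ... | no ¬p = contradiction j<d′ ¬p

      w≺v : ∀ i j → i ℕ.≤ j → j ℕ.< d′ → w j ≺ v i
      w≺v i j i≤j j<d′ with ℕ.m≤n⇒m<n∨m≡n i≤j
      ... | inj₁ i<j    = ≺-trans (proj₁ (proj₂ (w-properties j j<d′))) (v-decreasing i j i<j (ℕ.<⇒≤ j<d′))
      ... | inj₂ ≡.refl = proj₁ (proj₂ (w-properties j j<d′))

      v≺w : ∀ i j → j ℕ.< i → i ℕ.≤ d′ → v i ≺ w j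
      v≺w (suc i) j (s≤s j≤i) i<d′ with ℕ.m≤n⇒m<n∨m≡n j≤i
      ... | inj₁ j<i    = ≺-trans (v-decreasing (suc j) (suc i) (s≤s j<i) i<d′) (proj₁ (w-properties j (ℕ.<-trans j<i i<d′)))
      ... | inj₂ ≡.refl = proj₁ (w-properties j i<d′)

      w-sign : ∀ j → j ℕ.< d′ → Sign j (eval (p (suc n)) (w j))
      w-sign j j<d′ = sign-resp j (trans (*-comm _ _) (sym (factorisation d (degree (suc n)) z decreasing zeros (w j))))
        (sign-*-pos j (sign-Π d z (w j) j j≤d
          (λ i i<j → ≡.subst (w j ≺_) (v-z i (ℕ.<-≤-trans i<j j≤d)) (w≺v (suc i) j i<j j<d′))
          (λ i j≤i i<d → ≡.subst (_≺ w j) (v-z i i<d) (v≺w (suc i) j (s≤s j≤i) (ℕ.≤-trans i<d d≤d′)))) (ℓ-pos (suc n)))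
        where
        j≤d : j ℕ.≤ d
        j≤d = ℕ.s≤s⁻¹ (ℕ.<-≤-trans j<d′ d′≤1+d)

      next : Zeros (suc n)
      next = record
        { z          = w
        ; negative   = λ i i<d′ → w≺v 0 i z≤n i<d′
        ; decreasing = λ i j i<j j<d′ → ≺-trans (w≺v (suc i) j i<j j<d′) (proj₁ (w-properties i (ℕ.<-trans i<j j<d′)))
        ; zeros      = λ i i<d′ → proj₂ (proj₂ (w-properties i i<d′))
        ; signs      = w-sign
        }

    all-zeros : ∀ n → Zeros n
    all-zeros zero    = record { z = λ _ → 0# ; negative = λ _ () ; decreasing = λ _ _ _ () ; zeros = λ _ () ; signs = λ _ () }
    all-zeros (suc n) = Step.next n (all-zeros n)

    complete : ∀ n → 1 ℕ.≤ ⌊ suc n /2⌋ → ∀ x → eval (p (suc n)) x ≈ 0# →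
      ∃[ i ] (i ℕ.< ⌊ suc n /2⌋ × x ≈ Zeros.z (all-zeros n) i)
    complete n 1≤d x px≈0 = go ⌊ suc n /2⌋ 1≤d decreasing
      (cancel (ℓ-pos (suc n)) (trans (sym (factorisation d (degree (suc n)) z decreasing zeros x)) px≈0))
      where
      open Zeros (all-zeros n)
      go : ∀ d → 1 ℕ.≤ d → Decreasing d z → Π d z x ≈ 0# → ∃[ i ] (i ℕ.< d × x ≈ z i)
      go (suc d) _ dec Πx≈0 = zero-of-Π d z dec x Πx≈0

-- Real numbers

open ℚSolver.+-*-Solver using (solve; _:=_; _:+_; _:-_; _:*_; :-_)

-- Linear arithmetic: the ring solver turns a bound on one difference into a bound on an equal one.
by-≤ : ∀ {a b x y} → a ℚ.≤ b → b ℚ.- a ≡ y ℚ.- x → x ℚ.≤ y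
by-≤ {a} {b} {x} {y} a≤b eq = ≡.subst₂ ℚ._≤_
  (solve 2 (λ a x → a :+ (x :- a) := x) ≡.refl a x)
  (≡.trans (solve 3 (λ a b x → b :+ (x :- a) := (b :- a) :+ x) ≡.refl a b x)
    (≡.trans (≡.cong (ℚ._+ x) eq) (solve 2 (λ x y → (y :- x) :+ x := y) ≡.refl x y)))
  (ℚ.+-monoˡ-≤ (x ℚ.- a) a≤b)

by-< : ∀ {a b x y} → a ℚ.< b → b ℚ.- a ≡ y ℚ.- x → x ℚ.< y
by-< {a} {b} {x} {y} a<b eq = ≡.subst₂ ℚ._<_
  (solve 2 (λ a x → a :+ (x :- a) := x) ≡.refl a x)
  (≡.trans (solve 3 (λ a b x → b :+ (x :- a) := (b :- a) :+ x) ≡.refl a b x)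
    (≡.trans (≡.cong (ℚ._+ x) eq) (solve 2 (λ x y → (y :- x) :+ x := y) ≡.refl x y)))
  (ℚ.+-monoˡ-< (x ℚ.- a) a<b)

half : ∀ {ε} → 0ℚ ℚ.< ε → Σ[ δ ∈ ℚ ] (0ℚ ℚ.< δ × δ ℚ.+ δ ≡ ε)
half {ε} 0<ε = ½ ℚ.* ε , ℚ.*-monoʳ-<-pos ½ 0<ε , ≡.trans (≡.sym (ℚ.*-distribʳ-+ ε ½ ½)) (ℚ.*-identityˡ ε)

*-positive : ∀ {p q} → 0ℚ ℚ.< p → 0ℚ ℚ.< q → 0ℚ ℚ.< p ℚ.* q
*-positive {p} {q} 0<p 0<q = ≡.subst (ℚ._< p ℚ.* q) (ℚ.*-zeroʳ p) (ℚ.*-monoʳ-<-pos p {{ℚ.positive 0<p}} 0<q)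

p≤∣p∣ : ∀ p → p ℚ.≤ ℚ.∣ p ∣
p≤∣p∣ p with ℚ.∣p∣≡p∨∣p∣≡-p p
... | inj₁ eq = ℚ.≤-reflexive (≡.sym eq)
... | inj₂ eq = ℚ.≤-trans
  (≡.subst (ℚ._≤ 0ℚ) (≡.trans (≡.cong ℚ.-_ eq) (solve 1 (λ p → :- (:- p) := p) ≡.refl p)) (ℚ.neg-antimono-≤ (ℚ.0≤∣p∣ p)))
  (ℚ.0≤∣p∣ p)

-p≤∣p∣ : ∀ p → ℚ.- p ℚ.≤ ℚ.∣ p ∣
-p≤∣p∣ p = ≡.subst (ℚ.- p ℚ.≤_) (ℚ.∣-p∣≡∣p∣ p) (p≤∣p∣ (ℚ.- p))

∣∣-< : ∀ {p ε} → p ℚ.< ε → ℚ.- p ℚ.< ε → ℚ.∣ p ∣ ℚ.< ε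
∣∣-< {p} {ε} p<ε -p<ε with ℚ.∣p∣≡p∨∣p∣≡-p p
... | inj₁ eq = ≡.subst (ℚ._< ε) (≡.sym eq) p<ε
... | inj₂ eq = ≡.subst (ℚ._< ε) (≡.sym eq) -p<ε

∣∣-≤ : ∀ {p ε} → p ℚ.≤ ε → ℚ.- p ℚ.≤ ε → ℚ.∣ p ∣ ℚ.≤ ε
∣∣-≤ {p} {ε} p≤ε -p≤ε with ℚ.∣p∣≡p∨∣p∣≡-p p
... | inj₁ eq = ≡.subst (ℚ._≤ ε) (≡.sym eq) p≤ε
... | inj₂ eq = ≡.subst (ℚ._≤ ε) (≡.sym eq) -p≤ε

∣p-q∣≡∣q-p∣ : ∀ p q → ℚ.∣ p ℚ.- q ∣ ≡ ℚ.∣ q ℚ.- p ∣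
∣p-q∣≡∣q-p∣ p q = ≡.trans (≡.sym (ℚ.∣-p∣≡∣p∣ (p ℚ.- q))) (≡.cong ℚ.∣_∣ (solve 2 (λ p q → :- (p :- q) := q :- p) ≡.refl p q))

∣∣-double : ∀ {u v δ} → ℚ.∣ u ∣ ℚ.< δ → ℚ.∣ v ∣ ℚ.< δ → ℚ.∣ u ℚ.+ v ∣ ℚ.< δ ℚ.+ δ
∣∣-double {u} {v} u< v< = ℚ.≤-<-trans (ℚ.∣p+q∣≤∣p∣+∣q∣ u v) (ℚ.+-mono-< u< v<)

fraction : ∀ B ε → 0ℚ ℚ.< B → 0ℚ ℚ.< ε → Σ[ δ ∈ ℚ ] (0ℚ ℚ.< δ × B ℚ.* δ ≡ ε)
fraction B ε 0<B 0<ε = 1/B ℚ.* ε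
  , *-positive (ℚ.positive⁻¹ 1/B {{ℚ.1/pos⇒pos B}}) 0<ε
  , ≡.trans (≡.sym (ℚ.*-assoc B 1/B ε)) (≡.trans (≡.cong (ℚ._* ε) (ℚ.*-inverseʳ B)) (ℚ.*-identityˡ ε))
  where
  instance
    B-positive = ℚ.positive 0<B
    B-nonZero = ℚ.pos⇒nonZero B
  1/B = ℚ.1/ B

always : ∀ {P : ℕ → Set} → (∀ n → P n) → Eventually P
always p = 0 , λ n _ → p n

both : ∀ {P Q R : ℕ → Set} → (∀ n → P n → Q n → R n) → Eventually P → Eventually Q → Eventually R
both f (M , p) (N , q) = M ℕ.⊔ N , λ n n≥ → f n (p n (ℕ.m⊔n≤o⇒m≤o M N n≥)) (q n (ℕ.m⊔n≤o⇒n≤o M N n≥))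

eventually : ∀ {P Q : ℕ → Set} → (∀ n → P n → Q n) → Eventually P → Eventually Q
eventually f (M , p) = M , λ n n≥ → f n (p n n≥)

Null : (ℕ → ℚ) → Set
Null u = ∀ ε → 0ℚ ℚ.< ε → Eventually (λ n → ℚ.∣ u n ∣ ℚ.< ε)

null-≡ : ∀ {u v} → (∀ n → u n ≡ v n) → Null u → Null v
null-≡ eq u-null ε 0<ε = eventually (λ n → ≡.subst (λ a → ℚ.∣ a ∣ ℚ.< ε) (eq n)) (u-null ε 0<ε)

null-0 : Null (λ _ → 0ℚ)
null-0 ε 0<ε = always (λ _ → 0<ε)

null-+ : ∀ {u v} → Null u → Null v → Null (λ n → u n ℚ.+ v n)
null-+ u-null v-null ε 0<ε with δ , 0<δ , ≡.refl ← half 0<ε = both (λ n → ∣∣-double) (u-null δ 0<δ) (v-null δ 0<δ)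

null-neg : ∀ {u} → Null u → Null (λ n → ℚ.- u n)
null-neg {u} u-null ε 0<ε = eventually (λ n → ≡.subst (ℚ._< ε) (≡.sym (ℚ.∣-p∣≡∣p∣ (u n)))) (u-null ε 0<ε)

bounded : ∀ x → Σ[ B ∈ ℚ ] (0ℚ ℚ.< B × Eventually (λ n → ℚ.∣ approx x n ∣ ℚ.≤ B))
bounded x with N , close ← cauchy x 1ℚ (ℚ.positive⁻¹ 1ℚ) = 1ℚ ℚ.+ ℚ.∣ approx x N ∣
  , ℚ.+-mono-<-≤ (ℚ.positive⁻¹ 1ℚ) (ℚ.0≤∣p∣ (approx x N))
  , N , λ n N≤n → ℚ.≤-trans
      (ℚ.≤-reflexive (≡.cong ℚ.∣_∣ (solve 2 (λ u v → u := (u :- v) :+ v) ≡.refl (approx x n) (approx x N))))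
      (ℚ.≤-trans (ℚ.∣p+q∣≤∣p∣+∣q∣ (approx x n ℚ.- approx x N) (approx x N))
        (ℚ.+-monoˡ-≤ ℚ.∣ approx x N ∣ (ℚ.<⇒≤ (close n N N≤n ℕ.≤-refl))))

null-* : ∀ x {u} → Null u → Null (λ n → approx x n ℚ.* u n)
null-* x {u} u-null ε 0<ε =
  let B , 0<B , x≤B = bounded x
      δ , 0<δ , Bδ≡ε = fraction B ε 0<B 0<ε
  in both (λ n x≤ u< → ℚ.≤-<-trans (ℚ.≤-reflexive (ℚ.∣p*q∣≡∣p∣*∣q∣ (approx x n) (u n)))
       (ℚ.≤-<-trans (ℚ.*-monoʳ-≤-nonNeg ℚ.∣ u n ∣ {{ℚ.nonNegative (ℚ.0≤∣p∣ (u n))}} x≤)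
         (ℚ.<-≤-trans (ℚ.*-monoʳ-<-pos B {{ℚ.positive 0<B}} u<) (ℚ.≤-reflexive Bδ≡ε)))) x≤B (u-null δ 0<δ)

pointwise : ∀ x y → (∀ n → approx x n ≡ approx y n) → x ≈ℝ y
pointwise x y eq = null-≡ (λ n → ≡.sym (≡.trans (≡.cong (ℚ._- approx y n) (eq n)) (ℚ.+-inverseʳ (approx y n)))) null-0

≈ℝ-refl : ∀ {x} → x ≈ℝ x
≈ℝ-refl {x} = pointwise x x (λ _ → ≡.refl)

≈ℝ-sym : ∀ {x y} → x ≈ℝ y → y ≈ℝ x
≈ℝ-sym {x} {y} x≈y ε 0<ε = eventually (λ n → ≡.subst (ℚ._< ε) (∣p-q∣≡∣q-p∣ (approx x n) (approx y n))) (x≈y ε 0<ε)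

≈ℝ-trans : ∀ {x y z} → x ≈ℝ y → y ≈ℝ z → x ≈ℝ z
≈ℝ-trans {x} {y} {z} x≈y y≈z = null-≡
  (λ n → solve 3 (λ a b c → (a :- b) :+ (b :- c) := a :- c) ≡.refl (approx x n) (approx y n) (approx z n))
  (null-+ x≈y y≈z)

+ℝ-cong : ∀ {x y u v} → x ≈ℝ y → u ≈ℝ v → x +ℝ u ≈ℝ y +ℝ v
+ℝ-cong {x} {y} {u} {v} x≈y u≈v = null-≡
  (λ n → solve 4 (λ a b c d → (a :- b) :+ (c :- d) := (a :+ c) :- (b :+ d)) ≡.refl
    (approx x n) (approx y n) (approx u n) (approx v n))
  (null-+ x≈y u≈v)

*ℝ-cong : ∀ {x y u v} → x ≈ℝ y → u ≈ℝ v → x *ℝ u ≈ℝ y *ℝ v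
*ℝ-cong {x} {y} {u} {v} x≈y u≈v = null-≡
  (λ n → solve 4 (λ a b c d → a :* (c :- d) :+ d :* (a :- b) := a :* c :- b :* d) ≡.refl
    (approx x n) (approx y n) (approx u n) (approx v n))
  (null-+ (null-* x u≈v) (null-* v x≈y))

-ℝ-cong : ∀ {x y} → x ≈ℝ y → -ℝ x ≈ℝ -ℝ y
-ℝ-cong {x} {y} x≈y = null-≡
  (λ n → solve 2 (λ a b → :- (a :- b) := (:- a) :- (:- b)) ≡.refl (approx x n) (approx y n)) (null-neg x≈y)

ℝ-commutativeRing : CommutativeRing 0ℓ 0ℓ
ℝ-commutativeRing = record
  { Carrier = ℝ
  ; _≈_     = _≈ℝ_
  ; _+_     = _+ℝ_
  ; _*_     = _*ℝ_
  ; -_      = -ℝ_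
  ; 0#      = 0ℝ
  ; 1#      = fromℚ 1ℚ
  ; isCommutativeRing = record
    { isRing = record
      { +-isAbelianGroup = record
        { isGroup = record
          { isMonoid = record
            { isSemigroup = record
              { isMagma = record
                { isEquivalence = record { refl = λ {x} → ≈ℝ-refl {x} ; sym = λ {x} {y} → ≈ℝ-sym {x} {y} ; trans = λ {x} {y} {z} → ≈ℝ-trans {x} {y} {z} }
                ; ∙-cong        = λ {x} {y} {u} {v} → +ℝ-cong {x} {y} {u} {v}
                }
              ; assoc = λ x y z → pointwise ((x +ℝ y) +ℝ z) (x +ℝ (y +ℝ z)) (λ n → ℚ.+-assoc (approx x n) (approx y n) (approx z n))
              }
            ; identity = (λ x → pointwise (0ℝ +ℝ x) x (λ n → ℚ.+-identityˡ (approx x n))) , (λ x → pointwise (x +ℝ 0ℝ) x (λ n → ℚ.+-identityʳ (approx x n)))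
            }
          ; inverse = (λ x → pointwise ((-ℝ x) +ℝ x) 0ℝ (λ n → ℚ.+-inverseˡ (approx x n))) , (λ x → pointwise (x +ℝ (-ℝ x)) 0ℝ (λ n → ℚ.+-inverseʳ (approx x n)))
          ; ⁻¹-cong = λ {x} {y} → -ℝ-cong {x} {y}
          }
        ; comm = λ x y → pointwise (x +ℝ y) (y +ℝ x) (λ n → ℚ.+-comm (approx x n) (approx y n))
        }
      ; *-cong     = λ {x} {y} {u} {v} → *ℝ-cong {x} {y} {u} {v}
      ; *-assoc    = λ x y z → pointwise ((x *ℝ y) *ℝ z) (x *ℝ (y *ℝ z)) (λ n → ℚ.*-assoc (approx x n) (approx y n) (approx z n))
      ; *-identity = (λ x → pointwise (fromℚ 1ℚ *ℝ x) x (λ n → ℚ.*-identityˡ (approx x n))) , (λ x → pointwise (x *ℝ fromℚ 1ℚ) x (λ n → ℚ.*-identityʳ (approx x n)))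
      ; distrib    = (λ x y z → pointwise (x *ℝ (y +ℝ z)) ((x *ℝ y) +ℝ (x *ℝ z)) (λ n → ℚ.*-distribˡ-+ (approx x n) (approx y n) (approx z n)))
                   , (λ x y z → pointwise ((y +ℝ z) *ℝ x) ((y *ℝ x) +ℝ (z *ℝ x)) (λ n → ℚ.*-distribʳ-+ (approx x n) (approx y n) (approx z n)))
      }
    ; *-comm = λ x y → pointwise (x *ℝ y) (y *ℝ x) (λ n → ℚ.*-comm (approx x n) (approx y n))
    }
  }

Pos : ℝ → Set
Pos x = ∃[ ε ] (0ℚ ℚ.< ε × Eventually (λ n → ε ℚ.≤ approx x n))

<ℝ⇒Pos : ∀ {x y} → x <ℝ y → Pos (y +ℝ (-ℝ x))
<ℝ⇒Pos {x} {y} (ε , 0<ε , ev) = ε , 0<ε , eventually (λ n x+ε≤y → by-≤ x+ε≤y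
  (solve 3 (λ x y ε → y :- (x :+ ε) := (y :+ :- x) :- ε) ≡.refl (approx x n) (approx y n) ε)) ev

Pos⇒<ℝ : ∀ {x y} → Pos (y +ℝ (-ℝ x)) → x <ℝ y
Pos⇒<ℝ {x} {y} (ε , 0<ε , ev) = ε , 0<ε , eventually (λ n ε≤y-x → by-≤ ε≤y-x
  (solve 3 (λ x y ε → (y :+ :- x) :- ε := y :- (x :+ ε)) ≡.refl (approx x n) (approx y n) ε)) ev

pos-resp : ∀ {x y} → x ≈ℝ y → Pos x → Pos y
pos-resp {x} {y} x≈y (ε , 0<ε , ev) with δ , 0<δ , ≡.refl ← half 0<ε = δ , 0<δ ,
  both (λ n 2δ≤x close → by-≤ (ℚ.+-mono-≤ 2δ≤x (ℚ.<⇒≤ (ℚ.≤-<-trans (p≤∣p∣ (approx x n ℚ.- approx y n)) close)))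
    (solve 3 (λ x y δ → (x :+ δ) :- ((δ :+ δ) :+ (x :- y)) := y :- δ) ≡.refl (approx x n) (approx y n) δ))
    ev (x≈y δ 0<δ)

pos-+ : ∀ {x y} → Pos x → Pos y → Pos (x +ℝ y)
pos-+ (ε , 0<ε , ev) (δ , 0<δ , ev′) = ε ℚ.+ δ , ℚ.+-mono-< 0<ε 0<δ , both (λ n → ℚ.+-mono-≤) ev ev′

pos-* : ∀ {x y} → Pos x → Pos y → Pos (x *ℝ y)
pos-* {x} {y} (ε , 0<ε , ev) (δ , 0<δ , ev′) = ε ℚ.* δ , *-positive 0<ε 0<δ ,
  both (λ n ε≤x δ≤y → ℚ.≤-trans (ℚ.*-monoʳ-≤-nonNeg δ {{ℚ.nonNegative (ℚ.<⇒≤ 0<δ)}} ε≤x)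
    (ℚ.*-monoˡ-≤-nonNeg (approx x n) {{ℚ.nonNegative (ℚ.≤-trans (ℚ.<⇒≤ 0<ε) ε≤x)}} δ≤y)) ev ev′

pos-1 : Pos (fromℚ 1ℚ)
pos-1 = 1ℚ , ℚ.positive⁻¹ 1ℚ , always (λ _ → ℚ.≤-refl)

-- Write ε = 4η and compare a late rational approximation of x with 2η, which is decidable. As x
-- stays within η of it, either x ≥ η eventually, or x < 3η and the remainder y is at least η.
pos-cotransitive : ∀ x y → Pos (x +ℝ y) → Pos x ⊎ Pos y
pos-cotransitive x y (ε , 0<ε , N , h)
  with δ , 0<δ , ≡.refl ← half 0<ε
  with η , 0<η , ≡.refl ← half 0<δ
  with M , close ← cauchy x η 0<η
  with (η ℚ.+ η) ℚ.≤? approx x (N ℕ.⊔ M)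
... | yes 2η≤x = inj₁ (η , 0<η , N ℕ.⊔ M , λ n n≥ →
        by-≤ (ℚ.+-mono-≤ 2η≤x (ℚ.<⇒≤ (ℚ.≤-<-trans (p≤∣p∣ (approx x (N ℕ.⊔ M) ℚ.- approx x n))
            (close (N ℕ.⊔ M) n (ℕ.m≤n⊔m N M) (ℕ.m⊔n≤o⇒n≤o N M n≥)))))
          (solve 3 (λ k x η → (k :+ η) :- ((η :+ η) :+ (k :- x)) := x :- η) ≡.refl
            (approx x (N ℕ.⊔ M)) (approx x n) η))
... | no  2η≰x = inj₂ (η , 0<η , N ℕ.⊔ M , λ n n≥ →
        by-≤ (ℚ.+-mono-≤ (ℚ.+-mono-≤ (h n (ℕ.m⊔n≤o⇒m≤o N M n≥)) (ℚ.<⇒≤ (ℚ.≰⇒> 2η≰x)))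
            (ℚ.<⇒≤ (ℚ.≤-<-trans (p≤∣p∣ (approx x n ℚ.- approx x (N ℕ.⊔ M)))
              (close n (N ℕ.⊔ M) (ℕ.m⊔n≤o⇒n≤o N M n≥) (ℕ.m≤n⊔m N M)))))
          (solve 4 (λ k x y η → (((x :+ y) :+ (η :+ η)) :+ η) :- ((((η :+ η) :+ (η :+ η)) :+ k) :+ (x :- k)) := y :- η) ≡.refl
            (approx x (N ℕ.⊔ M)) (approx x n) (approx y n) η))

pos-cancel : ∀ {x y} → Pos x → x *ℝ y ≈ℝ 0ℝ → y ≈ℝ 0ℝ
pos-cancel {x} {y} (ε , 0<ε , ev) xy≈0 η 0<η = both (λ n ε≤x xy< → ℚ.*-cancelˡ-<-nonNeg ε {{ℚ.nonNegative (ℚ.<⇒≤ 0<ε)}}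
    (ℚ.≤-<-trans (ℚ.*-monoʳ-≤-nonNeg ℚ.∣ approx y n ℚ.- 0ℚ ∣ {{ℚ.nonNegative (ℚ.0≤∣p∣ (approx y n ℚ.- 0ℚ))}} (ℚ.≤-trans ε≤x (p≤∣p∣ (approx x n))))
      (ℚ.≤-<-trans (ℚ.≤-reflexive (≡.trans (≡.sym (ℚ.∣p*q∣≡∣p∣*∣q∣ (approx x n) (approx y n ℚ.- 0ℚ)))
        (≡.cong ℚ.∣_∣ (≡.trans (≡.cong (approx x n ℚ.*_) (ℚ.+-identityʳ (approx y n))) (≡.sym (ℚ.+-identityʳ (approx x n ℚ.* approx y n))))))) xy<)))
  ev (xy≈0 (ε ℚ.* η) (*-positive 0<ε 0<η))

archimedean : ∀ x → Σ[ m ∈ ℝ ] (Pos m × Pos (m +ℝ (-ℝ x)))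
archimedean x = go 1ℚ (ℚ.positive⁻¹ 1ℚ) (bounded x)
  where
  go : ∀ i → 0ℚ ℚ.< i → Σ[ B ∈ ℚ ] (0ℚ ℚ.< B × Eventually (λ n → ℚ.∣ approx x n ∣ ℚ.≤ B)) →
    Σ[ m ∈ ℝ ] (Pos m × Pos (m +ℝ (-ℝ x)))
  go i 0<i (B , 0<B , x≤B) = fromℚ (B ℚ.+ i)
    , (B ℚ.+ i , ℚ.+-mono-< 0<B 0<i , always (λ _ → ℚ.≤-refl))
    , i , 0<i , eventually (λ n ∣x∣≤B → by-≤ (ℚ.≤-trans (p≤∣p∣ (approx x n)) ∣x∣≤B)
        (solve 3 (λ b x i → b :- x := ((b :+ i) :+ :- x) :- i) ≡.refl B (approx x n) i)) x≤B

-- The intermediate value theorem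

/1-+ : ∀ a b → (a ℤ.+ b) ℚ./ 1 ≡ (a ℚ./ 1) ℚ.+ (b ℚ./ 1)
/1-+ a b = ℚ.toℚᵘ-injective (begin
  ℚ.toℚᵘ ((a ℤ.+ b) ℚ./ 1)                       ≈⟨ ℚ.toℚᵘ-fromℚᵘ (ℚᵘ.mkℚᵘ (a ℤ.+ b) 0) ⟩
  ℚᵘ.mkℚᵘ (a ℤ.+ b) 0                            ≈⟨ ℚᵘ.*≡* (solve′ 2 (λ a b → (a :+′ b) :*′ con′ 1ℤ :=′ ((a :*′ con′ 1ℤ) :+′ (b :*′ con′ 1ℤ)) :*′ con′ 1ℤ) ≡.refl a b) ⟩
  ℚᵘ.mkℚᵘ a 0 ℚᵘ.+ ℚᵘ.mkℚᵘ b 0                   ≈⟨ ℚᵘ.≃-sym (ℚᵘ.+-cong (ℚ.toℚᵘ-fromℚᵘ (ℚᵘ.mkℚᵘ a 0)) (ℚ.toℚᵘ-fromℚᵘ (ℚᵘ.mkℚᵘ b 0))) ⟩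
  ℚ.toℚᵘ (a ℚ./ 1) ℚᵘ.+ ℚ.toℚᵘ (b ℚ./ 1)         ≈⟨ ℚᵘ.≃-sym (ℚ.toℚᵘ-homo-+ (a ℚ./ 1) (b ℚ./ 1)) ⟩
  ℚ.toℚᵘ ((a ℚ./ 1) ℚ.+ (b ℚ./ 1))               ∎)
  where
  open ℤSolver.+-*-Solver using () renaming (solve to solve′; con to con′; _:=_ to _:=′_; _:+_ to _:+′_; _:*_ to _:*′_)
  open import Relation.Binary.Reasoning.Setoid ℚᵘ.≃-setoid

multiple : ℕ → ℚ → ℚ
multiple zero    q = 0ℚ
multiple (suc n) q = q ℚ.+ multiple n q

multiple-+ : ∀ n p q → multiple n (p ℚ.+ q) ≡ multiple n p ℚ.+ multiple n q
multiple-+ zero    p q = ≡.sym (ℚ.+-identityˡ 0ℚ)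
multiple-+ (suc n) p q = ≡.trans (≡.cong (p ℚ.+ q ℚ.+_) (multiple-+ n p q))
  (solve 4 (λ p q u v → (p :+ q) :+ (u :+ v) := (p :+ u) :+ (q :+ v)) ≡.refl p q (multiple n p) (multiple n q))

multiple-* : ∀ n p q → p ℚ.* multiple n q ≡ multiple n (p ℚ.* q)
multiple-* zero    p q = ℚ.*-zeroʳ p
multiple-* (suc n) p q = ≡.trans (ℚ.*-distribˡ-+ p q (multiple n q)) (≡.cong (p ℚ.* q ℚ.+_) (multiple-* n p q))

multiple-mono : ∀ n {p q} → p ℚ.≤ q → multiple n p ℚ.≤ multiple n q
multiple-mono zero    p≤q = ℚ.≤-refl
multiple-mono (suc n) p≤q = ℚ.+-mono-≤ p≤q (multiple-mono n p≤q)

multiple-nonneg : ∀ n {p} → 0ℚ ℚ.≤ p → 0ℚ ℚ.≤ multiple n p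
multiple-nonneg zero    0≤p = ℚ.≤-refl
multiple-nonneg (suc n) 0≤p = ℚ.+-mono-≤ 0≤p (multiple-nonneg n 0≤p)

multiple-1 : ∀ n → multiple n 1ℚ ≡ (+ n) ℚ./ 1
multiple-1 zero    = ≡.refl
multiple-1 (suc n) = ≡.trans (≡.cong (1ℚ ℚ.+_) (multiple-1 n)) (≡.sym (/1-+ 1ℤ (+ n)))

-- The absolute value of the numerator serves, the denominator being at least 1.
below-multiple : ∀ p → ∃[ n ] p ℚ.≤ multiple n 1ℚ
below-multiple p = ℤ.∣ ℚ.↥ p ∣ , ≡.subst (p ℚ.≤_) (≡.sym (multiple-1 ℤ.∣ ℚ.↥ p ∣))
  (ℚ.toℚᵘ-cancel-≤ (ℚᵘ.≤-respʳ-≃ (ℚᵘ.≃-sym (ℚ.toℚᵘ-fromℚᵘ (ℚᵘ.mkℚᵘ (+ ℤ.∣ ℚ.↥ p ∣) 0))) (numerator p)))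
  where
  numerator : ∀ p → ℚ.toℚᵘ p ℚᵘ.≤ ℚᵘ.mkℚᵘ (+ ℤ.∣ ℚ.↥ p ∣) 0
  numerator (ℚ.mkℚ (+ n)    d _) = ℚᵘ.*≤* (ℤ.*-monoˡ-≤-nonNeg (+ n) (ℤ.+≤+ (s≤s (z≤n {d}))))
  numerator (ℚ.mkℚ -[1+ n ] d _) = ℚᵘ.*≤* (ℤ.≤-trans (ℤ.≤-reflexive (ℤ.*-identityʳ -[1+ n ])) (ℤ.-≤+))

multiple-exceeds : ∀ {c ε} → 0ℚ ℚ.< c → 0ℚ ℚ.< ε → ∃[ n ] c ℚ.< multiple (suc n) ε
multiple-exceeds {c} {ε} 0<c 0<ε
  with δ , 0<δ , εδ≡c ← fraction ε c 0<ε 0<c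
  with n , δ≤n ← below-multiple δ = n , ℚ.≤-<-trans (begin
    c                           ≡⟨ ≡.sym εδ≡c ⟩
    ε ℚ.* δ                     ≤⟨ ℚ.*-monoˡ-≤-nonNeg ε {{ℚ.nonNegative (ℚ.<⇒≤ 0<ε)}} δ≤n ⟩
    ε ℚ.* multiple n 1ℚ         ≡⟨ multiple-* n ε 1ℚ ⟩
    multiple n (ε ℚ.* 1ℚ)       ≡⟨ ≡.cong (multiple n) (ℚ.*-identityʳ ε) ⟩
    multiple n ε                ∎)
    (≡.subst (ℚ._< ε ℚ.+ multiple n ε) (ℚ.+-identityˡ (multiple n ε)) (ℚ.+-monoˡ-< (multiple n ε) 0<ε))
  where open ℚ.≤-Reasoning

module Halving (w : ℕ → ℚ) (w-half : ∀ n → w (suc n) ℚ.+ w (suc n) ≡ w n) (0≤w : ∀ n → 0ℚ ℚ.≤ w n) where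
  -- The linear bound (n + 1) w n ≤ w 0 is weaker than 2^n w n = w 0 but already forces w n below
  -- any ε by the Archimedean property.
  multiple-w : ∀ n → multiple (suc n) (w n) ℚ.≤ w 0
  multiple-w zero    = ℚ.≤-reflexive (ℚ.+-identityʳ (w 0))
  multiple-w (suc n) = ℚ.≤-trans (begin
    w′ ℚ.+ multiple (suc n) w′                           ≤⟨ ℚ.+-monoˡ-≤ (multiple (suc n) w′) grow ⟩
    multiple (suc n) w′ ℚ.+ multiple (suc n) w′          ≡⟨ ≡.sym (multiple-+ (suc n) w′ w′) ⟩
    multiple (suc n) (w′ ℚ.+ w′)                         ≡⟨ ≡.cong (multiple (suc n)) (w-half n) ⟩
    multiple (suc n) (w n)                               ∎) (multiple-w n)
    where
    open ℚ.≤-Reasoning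
    w′ = w (suc n)
    grow : w′ ℚ.≤ w′ ℚ.+ multiple n w′
    grow = ≡.subst (ℚ._≤ w′ ℚ.+ multiple n w′) (ℚ.+-identityʳ w′) (ℚ.+-monoʳ-≤ w′ (multiple-nonneg n (0≤w (suc n))))

  w-small : 0ℚ ℚ.< w 0 → ∀ ε → 0ℚ ℚ.< ε → ∃[ n ] w n ℚ.< ε
  w-small 0<w₀ ε 0<ε with n , w₀< ← multiple-exceeds 0<w₀ 0<ε with w n ℚ.<? ε
  ... | yes w<ε = n , w<ε
  ... | no  w≮ε = contradiction (ℚ.<-≤-trans w₀< (ℚ.≤-trans (multiple-mono (suc n) (ℚ.≮⇒≥ w≮ε)) (multiple-w n))) (ℚ.<-irrefl ≡.refl)

-- Continuity in the form that polynomials supply directly. It is used to move real end points to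
-- rational ones and to show that the values along the bisection tend to 0.
LocallyLipschitz : (ℚ → ℚ) → Set
LocallyLipschitz f = ∀ B → Σ[ K ∈ ℚ ] (0ℚ ℚ.< K ×
  (∀ x y → ℚ.∣ x ∣ ℚ.≤ B → ℚ.∣ y ∣ ℚ.≤ B → ℚ.∣ f x ℚ.- f y ∣ ℚ.≤ K ℚ.* ℚ.∣ x ℚ.- y ∣))

-- Passing to -f(-x) turns the right end of an interval, with f positive, into a left end with
-- negative value, so one approximation argument handles both ends.
lipschitz-reflect : ∀ {f} → LocallyLipschitz f → LocallyLipschitz (λ x → ℚ.- f (ℚ.- x))
lipschitz-reflect {f} lip B = proj₁ (lip B) , proj₁ (proj₂ (lip B)) , λ x y x≤B y≤B →
  ≡.subst₂ ℚ._≤_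
    (≡.trans (≡.sym (ℚ.∣-p∣≡∣p∣ _)) (≡.cong ℚ.∣_∣ (solve 2 (λ a b → :- (a :- b) := (:- a) :- (:- b)) ≡.refl (f (ℚ.- x)) (f (ℚ.- y)))))
    (≡.cong (proj₁ (lip B) ℚ.*_) (≡.trans (≡.sym (ℚ.∣-p∣≡∣p∣ _)) (≡.cong ℚ.∣_∣ (solve 2 (λ x y → :- ((:- x) :- (:- y)) := x :- y) ≡.refl x y))))
    (proj₂ (proj₂ (lip B)) (ℚ.- x) (ℚ.- y) (≡.subst (ℚ._≤ B) (≡.sym (ℚ.∣-p∣≡∣p∣ x)) x≤B) (≡.subst (ℚ._≤ B) (≡.sym (ℚ.∣-p∣≡∣p∣ y)) y≤B))

⊓-positive : ∀ {p q} → 0ℚ ℚ.< p → 0ℚ ℚ.< q → 0ℚ ℚ.< p ℚ.⊓ q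
⊓-positive {p} {q} 0<p 0<q with ℚ.⊓-sel p q
... | inj₁ eq = ≡.subst (0ℚ ℚ.<_) (≡.sym eq) 0<p
... | inj₂ eq = ≡.subst (0ℚ ℚ.<_) (≡.sym eq) 0<q

-- Here c is a late approximation of the real end point and l = c + 2δ. The end point lies within δ
-- of c, hence strictly left of l. Between c and l the function changes by at most K δ₁ = ε, and f c
-- ≤ -ε, so f l ≤ 0.
module ApproachRight (f : ℚ → ℚ) (c δ h B K ε δ₁ : ℚ) (0<δ : 0ℚ ℚ.< δ) (0<h : 0ℚ ℚ.< h) (0<K : 0ℚ ℚ.< K)
  (2δ≤δ₁ : δ ℚ.+ δ ℚ.≤ δ₁) (2δ≤h : δ ℚ.+ δ ℚ.≤ h) (Kδ₁≡ε : K ℚ.* δ₁ ≡ ε) (∣c∣≤ : ℚ.∣ c ∣ ℚ.≤ B) (below : ε ℚ.≤ ℚ.- f c)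
  (bound : ∀ x y → ℚ.∣ x ∣ ℚ.≤ B ℚ.+ h → ℚ.∣ y ∣ ℚ.≤ B ℚ.+ h → ℚ.∣ f x ℚ.- f y ∣ ℚ.≤ K ℚ.* ℚ.∣ x ℚ.- y ∣) where

  l : ℚ
  l = c ℚ.+ (δ ℚ.+ δ)

  δ≤2δ : δ ℚ.≤ δ ℚ.+ δ
  δ≤2δ = ≡.subst (ℚ._≤ δ ℚ.+ δ) (ℚ.+-identityʳ δ) (ℚ.+-monoʳ-≤ δ (ℚ.<⇒≤ 0<δ))

  0≤2δ : 0ℚ ℚ.≤ δ ℚ.+ δ
  0≤2δ = ℚ.≤-trans (ℚ.<⇒≤ 0<δ) δ≤2δ

  B≤B+h : B ℚ.≤ B ℚ.+ h
  B≤B+h = ≡.subst (ℚ._≤ B ℚ.+ h) (ℚ.+-identityʳ B) (ℚ.+-monoʳ-≤ B (ℚ.<⇒≤ 0<h))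

  ∣l∣≤ : ℚ.∣ l ∣ ℚ.≤ B ℚ.+ h
  ∣l∣≤ = ℚ.≤-trans (ℚ.∣p+q∣≤∣p∣+∣q∣ c (δ ℚ.+ δ)) (ℚ.+-mono-≤ ∣c∣≤ (ℚ.≤-trans (ℚ.≤-reflexive (ℚ.0≤p⇒∣p∣≡p 0≤2δ)) 2δ≤h))

  ∣l-c∣≤δ₁ : ℚ.∣ l ℚ.- c ∣ ℚ.≤ δ₁
  ∣l-c∣≤δ₁ = ℚ.≤-trans (ℚ.≤-reflexive (≡.trans (≡.cong ℚ.∣_∣ (solve 2 (λ c d → (c :+ d) :- c := d) ≡.refl c (δ ℚ.+ δ))) (ℚ.0≤p⇒∣p∣≡p 0≤2δ))) 2δ≤δ₁

  fl-fc≤ε : f l ℚ.- f c ℚ.≤ ε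
  fl-fc≤ε = ℚ.≤-trans (p≤∣p∣ (f l ℚ.- f c)) (ℚ.≤-trans (bound l c ∣l∣≤ (ℚ.≤-trans ∣c∣≤ B≤B+h))
    (ℚ.≤-trans (ℚ.*-monoˡ-≤-nonNeg K {{ℚ.nonNegative (ℚ.<⇒≤ 0<K)}} ∣l-c∣≤δ₁) (ℚ.≤-reflexive Kδ₁≡ε)))

  fl≤0 : f l ℚ.≤ 0ℚ
  fl≤0 = by-≤ (ℚ.+-mono-≤ fl-fc≤ε below) (≡.trans (solve 3 (λ x y e → (e :+ :- y) :- ((x :- y) :+ e) := :- x) ≡.refl (f l) (f c) ε) (≡.sym (ℚ.+-identityˡ (ℚ.- f l))))

  below-l : ∀ x → x ℚ.- c ℚ.< δ → x ℚ.+ δ ℚ.≤ l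
  below-l x x-c<δ = by-≤ (ℚ.<⇒≤ x-c<δ) (solve 3 (λ x c δ → δ :- (x :- c) := (c :+ (δ :+ δ)) :- (x :+ δ)) ≡.refl x c δ)

  l-below : ∀ x → c ℚ.- x ℚ.< δ → l ℚ.≤ x ℚ.+ (h ℚ.+ h)
  l-below x c-x<δ = by-≤ (ℚ.+-mono-≤ (ℚ.<⇒≤ c-x<δ) (ℚ.+-mono-≤ 2δ≤h (ℚ.≤-trans δ≤2δ 2δ≤h)))
    (solve 4 (λ x c δ h → (δ :+ (h :+ h)) :- ((c :- x) :+ ((δ :+ δ) :+ δ)) := (x :+ (h :+ h)) :- (c :+ (δ :+ δ))) ≡.refl x c δ h)

Positive-below : (ℕ → ℚ) → Set
Positive-below u = ∃[ ε ] (0ℚ ℚ.< ε × Eventually (λ n → ε ℚ.≤ u n))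

RationalRightOf : (ℚ → ℚ) → ℝ → ℚ → Set
RationalRightOf f a g = Σ[ l ∈ ℚ ] ((∃[ η ] (0ℚ ℚ.< η × Eventually (λ n → approx a n ℚ.+ η ℚ.≤ l)))
  × Eventually (λ n → l ℚ.≤ approx a n ℚ.+ g) × f l ℚ.≤ 0ℚ)

approach-right : ∀ f → LocallyLipschitz f → ∀ a g → 0ℚ ℚ.< g → Positive-below (λ n → ℚ.- f (approx a n)) → RationalRightOf f a g
approach-right f lip a g 0<g (ε , 0<ε , N₁ , below) = go₁ (half 0<g) (bounded a)
  where
  go₁ : Σ[ h ∈ ℚ ] (0ℚ ℚ.< h × h ℚ.+ h ≡ g) → Σ[ B ∈ ℚ ] (0ℚ ℚ.< B × Eventually (λ n → ℚ.∣ approx a n ∣ ℚ.≤ B)) → RationalRightOf f a g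
  go₁ (h , 0<h , ≡.refl) (B , 0<B , N₂ , a≤B) = go₂ (lip (B ℚ.+ h))
    where
    go₂ : Σ[ K ∈ ℚ ] (0ℚ ℚ.< K × (∀ x y → ℚ.∣ x ∣ ℚ.≤ B ℚ.+ h → ℚ.∣ y ∣ ℚ.≤ B ℚ.+ h → ℚ.∣ f x ℚ.- f y ∣ ℚ.≤ K ℚ.* ℚ.∣ x ℚ.- y ∣)) →
      RationalRightOf f a (h ℚ.+ h)
    go₂ (K , 0<K , bound) = go₃ (fraction K ε 0<K 0<ε)
      where
      go₃ : Σ[ δ₁ ∈ ℚ ] (0ℚ ℚ.< δ₁ × K ℚ.* δ₁ ≡ ε) → RationalRightOf f a (h ℚ.+ h)
      go₃ (δ₁ , 0<δ₁ , Kδ₁≡ε) = go₄ (half (⊓-positive 0<δ₁ 0<h))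
        where
        go₄ : Σ[ δ ∈ ℚ ] (0ℚ ℚ.< δ × δ ℚ.+ δ ≡ δ₁ ℚ.⊓ h) → RationalRightOf f a (h ℚ.+ h)
        go₄ (δ , 0<δ , 2δ≡e) = go₅ (cauchy a δ 0<δ)
          where
          go₅ : ∃[ N ] (∀ m n → N ℕ.≤ m → N ℕ.≤ n → ℚ.∣ approx a m ℚ.- approx a n ∣ ℚ.< δ) → RationalRightOf f a (h ℚ.+ h)
          go₅ (N₃ , close) = l
            , (δ , 0<δ , N , λ n n≥ → below-l (approx a n) (ℚ.≤-<-trans (p≤∣p∣ (approx a n ℚ.- approx a N)) (close n N (ℕ.≤-trans N₃≤N n≥) N₃≤N)))
            , (N , λ n n≥ → l-below (approx a n) (ℚ.≤-<-trans (p≤∣p∣ (approx a N ℚ.- approx a n)) (close N n N₃≤N (ℕ.≤-trans N₃≤N n≥))))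
            , fl≤0
            where
            N = (N₁ ℕ.⊔ N₂) ℕ.⊔ N₃
            N₃≤N = ℕ.m≤n⊔m (N₁ ℕ.⊔ N₂) N₃
            open ApproachRight f (approx a N) δ h B K ε δ₁ 0<δ 0<h 0<K
              (ℚ.≤-trans (ℚ.≤-reflexive 2δ≡e) (ℚ.p⊓q≤p δ₁ h)) (ℚ.≤-trans (ℚ.≤-reflexive 2δ≡e) (ℚ.p⊓q≤q δ₁ h)) Kδ₁≡ε
              (a≤B N (ℕ.≤-trans (ℕ.m≤n⊔m N₁ N₂) (ℕ.m≤m⊔n (N₁ ℕ.⊔ N₂) N₃)))
              (below N (ℕ.≤-trans (ℕ.m≤m⊔n N₁ N₂) (ℕ.m≤m⊔n (N₁ ℕ.⊔ N₂) N₃))) bound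

-- Only weak inequalities are kept at the ends of a bracket, and the ends are rational, so the test
-- at the midpoint is decidable and always leaves a valid half.
module Bisection (f : ℚ → ℚ) (lip : LocallyLipschitz f) (l u : ℚ) (l<u : l ℚ.< u) (fl≤0 : f l ℚ.≤ 0ℚ) (0≤fu : 0ℚ ℚ.≤ f u) where
  midpoint : ∀ p q → Σ[ m ∈ ℚ ] m ℚ.+ m ≡ p ℚ.+ q
  midpoint p q = ½ ℚ.* (p ℚ.+ q) , ≡.trans (≡.sym (ℚ.*-distribʳ-+ (p ℚ.+ q) ½ ½)) (ℚ.*-identityˡ (p ℚ.+ q))

  record Bracket : Set where
    field
      lo hi : ℚ
      lo≤hi : lo ℚ.≤ hi
      f-lo  : f lo ℚ.≤ 0ℚ
      f-hi  : 0ℚ ℚ.≤ f hi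
  open Bracket

  left-half : ∀ {m p q} → m ℚ.+ m ≡ p ℚ.+ q → (m ℚ.- p) ℚ.+ (m ℚ.- p) ≡ q ℚ.- p
  left-half {m} {p} {q} 2m≡ = ≡.trans (solve 2 (λ m p → (m :- p) :+ (m :- p) := (m :+ m) :- (p :+ p)) ≡.refl m p)
    (≡.trans (≡.cong (ℚ._- (p ℚ.+ p)) 2m≡) (solve 2 (λ p q → (p :+ q) :- (p :+ p) := q :- p) ≡.refl p q))

  right-half : ∀ {m p q} → m ℚ.+ m ≡ p ℚ.+ q → (q ℚ.- m) ℚ.+ (q ℚ.- m) ≡ q ℚ.- p
  right-half {m} {p} {q} 2m≡ = ≡.trans (solve 2 (λ m q → (q :- m) :+ (q :- m) := (q :+ q) :- (m :+ m)) ≡.refl m q)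
    (≡.trans (≡.cong (λ z → (q ℚ.+ q) ℚ.- z) 2m≡) (solve 2 (λ p q → (q :+ q) :- (p :+ q) := q :- p) ≡.refl p q))

  half-nonneg : ∀ {d e} → d ℚ.+ d ≡ e → 0ℚ ℚ.≤ e → 0ℚ ℚ.≤ d
  half-nonneg {d} ≡.refl 0≤2d = go (0ℚ ℚ.≤? d)
    where
    go : Dec (0ℚ ℚ.≤ d) → 0ℚ ℚ.≤ d
    go (yes 0≤d) = 0≤d
    go (no  0≰d) = contradiction (ℚ.≤-<-trans 0≤2d (ℚ.+-mono-< (ℚ.≰⇒> 0≰d) (ℚ.≰⇒> 0≰d))) (ℚ.<-irrefl ≡.refl)

  0≤q-p : ∀ {p q} → p ℚ.≤ q → 0ℚ ℚ.≤ q ℚ.- p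
  0≤q-p {p} {q} p≤q = ≡.subst (ℚ._≤ q ℚ.- p) (ℚ.+-inverseʳ p) (ℚ.+-monoˡ-≤ (ℚ.- p) p≤q)

  p≤q-from : ∀ {p q} → 0ℚ ℚ.≤ q ℚ.- p → p ℚ.≤ q
  p≤q-from {p} {q} 0≤q-p = by-≤ 0≤q-p (ℚ.+-identityʳ (q ℚ.- p))

  width : Bracket → ℚ
  width b = hi b ℚ.- lo b

  Refines : Bracket → Bracket → Set
  Refines b b′ = lo b ℚ.≤ lo b′ × hi b′ ℚ.≤ hi b

  Halved : Bracket → Set
  Halved b = Σ[ b′ ∈ Bracket ] (Refines b b′ × width b′ ℚ.+ width b′ ≡ width b)

  bisect : ∀ b → Halved b
  bisect b = at (midpoint (lo b) (hi b))
    where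
    at : Σ[ m ∈ ℚ ] m ℚ.+ m ≡ lo b ℚ.+ hi b → Halved b
    at (m , 2m≡) = choose (f m ℚ.≤? 0ℚ)
      where
      m≤hi : m ℚ.≤ hi b
      m≤hi = p≤q-from (half-nonneg {hi b ℚ.- m} {hi b ℚ.- lo b} (right-half {m} {lo b} {hi b} 2m≡) (0≤q-p (lo≤hi b)))
      lo≤m : lo b ℚ.≤ m
      lo≤m = p≤q-from (half-nonneg {m ℚ.- lo b} {hi b ℚ.- lo b} (left-half {m} {lo b} {hi b} 2m≡) (0≤q-p (lo≤hi b)))
      choose : Dec (f m ℚ.≤ 0ℚ) → Halved b
      choose (yes fm≤0) = record { lo = m ; hi = hi b ; lo≤hi = m≤hi ; f-lo = fm≤0 ; f-hi = f-hi b } , (lo≤m , ℚ.≤-refl) , right-half {m} {lo b} {hi b} 2m≡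
      choose (no  fm≰0) = record { lo = lo b ; hi = m ; lo≤hi = lo≤m ; f-lo = f-lo b ; f-hi = ℚ.<⇒≤ (ℚ.≰⇒> fm≰0) } , (ℚ.≤-refl , m≤hi) , left-half {m} {lo b} {hi b} 2m≡

  bracket : ℕ → Bracket
  bracket zero    = record { lo = l ; hi = u ; lo≤hi = ℚ.<⇒≤ l<u ; f-lo = fl≤0 ; f-hi = 0≤fu }
  bracket (suc n) = proj₁ (bisect (bracket n))

  refines : ∀ m k → Refines (bracket m) (bracket (k ℕ.+ m))
  refines m zero    = ℚ.≤-refl , ℚ.≤-refl
  refines m (suc k) = refine-trans {bracket m} {bracket (k ℕ.+ m)} {bracket (suc k ℕ.+ m)} (refines m k) (proj₁ (proj₂ (bisect (bracket (k ℕ.+ m)))))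
    where
    refine-trans : ∀ {a b c} → Refines a b → Refines b c → Refines a c
    refine-trans (lo≤ , hi≤) (lo≤′ , hi≤′) = ℚ.≤-trans lo≤ lo≤′ , ℚ.≤-trans hi≤′ hi≤

  refines-≤ : ∀ {m n} → m ℕ.≤ n → Refines (bracket m) (bracket n)
  refines-≤ {m} {n} m≤n = ≡.subst (λ k → Refines (bracket m) (bracket k)) (ℕ.m∸n+n≡m m≤n) (refines m (n ℕ.∸ m))

  w : ℕ → ℚ
  w n = width (bracket n)

  w-small : ∀ ε → 0ℚ ℚ.< ε → ∃[ n ] w n ℚ.< ε
  w-small = Halving.w-small w (λ n → proj₂ (proj₂ (bisect (bracket n)))) (λ n → 0≤q-p (lo≤hi (bracket n)))
    (≡.subst (ℚ._< u ℚ.- l) (ℚ.+-inverseʳ l) (ℚ.+-monoˡ-< (ℚ.- l) l<u))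

  lo-lo : ∀ N m n → N ℕ.≤ m → N ℕ.≤ n → lo (bracket m) ℚ.- lo (bracket n) ℚ.≤ w N
  lo-lo N m n N≤m N≤n = by-≤ (ℚ.+-mono-≤ (ℚ.≤-trans (lo≤hi (bracket m)) (proj₂ (refines-≤ N≤m))) (proj₁ (refines-≤ N≤n)))
    (solve 4 (λ h k a b → (h :+ b) :- (a :+ k) := (h :- k) :- (a :- b)) ≡.refl (hi (bracket N)) (lo (bracket N)) (lo (bracket m)) (lo (bracket n)))

  limit : ℝ
  approx limit n = lo (bracket n)
  cauchy limit ε 0<ε = proj₁ (w-small ε 0<ε) , λ m n N≤m N≤n → ℚ.≤-<-trans
    (∣∣-≤ (lo-lo _ m n N≤m N≤n)
      (≡.subst (ℚ._≤ w (proj₁ (w-small ε 0<ε))) (solve 2 (λ a b → b :- a := :- (a :- b)) ≡.refl (lo (bracket m)) (lo (bracket n))) (lo-lo _ n m N≤n N≤m)))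
    (proj₂ (w-small ε 0<ε))

  l≤limit : ∀ n → l ℚ.≤ approx limit n
  l≤limit n = proj₁ (refines-≤ {0} {n} z≤n)

  limit≤u : ∀ n → approx limit n ℚ.≤ u
  limit≤u n = ℚ.≤-trans (lo≤hi (bracket n)) (proj₂ (refines-≤ {0} {n} z≤n))

  between-bound : ∀ {x} → l ℚ.≤ x → x ℚ.≤ u → ℚ.∣ x ∣ ℚ.≤ ℚ.∣ l ∣ ℚ.+ ℚ.∣ u ∣
  between-bound {x} l≤x x≤u = ∣∣-≤
    (ℚ.≤-trans x≤u (ℚ.≤-trans (p≤∣p∣ u) (≡.subst (ℚ._≤ ℚ.∣ l ∣ ℚ.+ ℚ.∣ u ∣) (ℚ.+-identityˡ ℚ.∣ u ∣) (ℚ.+-monoˡ-≤ ℚ.∣ u ∣ (ℚ.0≤∣p∣ l)))))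
    (ℚ.≤-trans (ℚ.neg-antimono-≤ l≤x) (ℚ.≤-trans (-p≤∣p∣ l) (≡.subst (ℚ._≤ ℚ.∣ l ∣ ℚ.+ ℚ.∣ u ∣) (ℚ.+-identityʳ ℚ.∣ l ∣) (ℚ.+-monoʳ-≤ ℚ.∣ l ∣ (ℚ.0≤∣p∣ u)))))

  -- Since f lo ≤ 0 ≤ f hi on every bracket, the size of f lo is at most f hi - f lo, which is at
  -- most K times the width.
  f-limit : Null (f ∘ approx limit)
  f-limit ε 0<ε = go₁ (lip (ℚ.∣ l ∣ ℚ.+ ℚ.∣ u ∣))
    where
    Goal : Set
    Goal = Eventually (λ n → ℚ.∣ f (approx limit n) ∣ ℚ.< ε)
    go₁ : Σ[ K ∈ ℚ ] (0ℚ ℚ.< K × (∀ x y → ℚ.∣ x ∣ ℚ.≤ ℚ.∣ l ∣ ℚ.+ ℚ.∣ u ∣ → ℚ.∣ y ∣ ℚ.≤ ℚ.∣ l ∣ ℚ.+ ℚ.∣ u ∣ →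
      ℚ.∣ f x ℚ.- f y ∣ ℚ.≤ K ℚ.* ℚ.∣ x ℚ.- y ∣)) → Goal
    go₁ (K , 0<K , bound) = go₂ (fraction K ε 0<K 0<ε)
      where
      go₂ : Σ[ δ ∈ ℚ ] (0ℚ ℚ.< δ × K ℚ.* δ ≡ ε) → Goal
      go₂ (δ , 0<δ , Kδ≡ε) = go₃ (w-small δ 0<δ)
        where
        go₃ : ∃[ N ] w N ℚ.< δ → Goal
        go₃ (N , wN<δ) = N , λ n N≤n → ∣∣-< (ℚ.≤-<-trans (f-lo (bracket n)) 0<ε)
          (ℚ.≤-<-trans (ℚ.≤-trans (-f≤ n) (ℚ.≤-trans (p≤∣p∣ (f (hi (bracket n)) ℚ.- f (lo (bracket n)))) (difference n))) (Kw<ε n N≤n))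
          where
          difference : ∀ n → ℚ.∣ f (hi (bracket n)) ℚ.- f (lo (bracket n)) ∣ ℚ.≤ K ℚ.* ℚ.∣ w n ∣
          difference n = bound (hi (bracket n)) (lo (bracket n))
            (between-bound (ℚ.≤-trans (l≤limit n) (lo≤hi (bracket n))) (proj₂ (refines-≤ {0} {n} z≤n)))
            (between-bound (l≤limit n) (limit≤u n))
          wn≤wN : ∀ n → N ℕ.≤ n → w n ℚ.≤ w N
          wn≤wN n N≤n = ℚ.+-mono-≤ (proj₂ (refines-≤ N≤n)) (ℚ.neg-antimono-≤ (proj₁ (refines-≤ N≤n)))
          Kw<ε : ∀ n → N ℕ.≤ n → K ℚ.* ℚ.∣ w n ∣ ℚ.< ε
          Kw<ε n N≤n = ℚ.<-≤-trans (ℚ.*-monoʳ-<-pos K {{ℚ.positive 0<K}}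
            (ℚ.≤-<-trans (ℚ.≤-reflexive (ℚ.0≤p⇒∣p∣≡p (0≤q-p (lo≤hi (bracket n))))) (ℚ.≤-<-trans (wn≤wN n N≤n) wN<δ))) (ℚ.≤-reflexive Kδ≡ε)
          -f≤ : ∀ n → ℚ.- f (lo (bracket n)) ℚ.≤ f (hi (bracket n)) ℚ.- f (lo (bracket n))
          -f≤ n = ≡.subst (ℚ._≤ f (hi (bracket n)) ℚ.- f (lo (bracket n))) (ℚ.+-identityˡ (ℚ.- f (lo (bracket n))))
            (ℚ.+-monoˡ-≤ (ℚ.- f (lo (bracket n))) (f-hi (bracket n)))

gap-< : ∀ {a b g l u} → 0ℚ ℚ.< g → a ℚ.+ ((g ℚ.+ g) ℚ.+ (g ℚ.+ g)) ℚ.≤ b → l ℚ.≤ a ℚ.+ g → u ℚ.≤ (ℚ.- b) ℚ.+ g → l ℚ.< ℚ.- u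
gap-< {a} {b} {g} {l} {u} 0<g gap l≤ u≤ = by-< (ℚ.+-mono-<-≤ 0<g (ℚ.+-mono-≤ gap (ℚ.+-mono-≤ l≤ (ℚ.+-mono-≤ u≤ (ℚ.<⇒≤ 0<g)))))
  (≡.trans (≡.cong (λ z → (g ℚ.+ (b ℚ.+ ((a ℚ.+ g) ℚ.+ (((ℚ.- b) ℚ.+ g) ℚ.+ g)))) ℚ.- (0ℚ ℚ.+ ((a ℚ.+ ((g ℚ.+ g) ℚ.+ (g ℚ.+ g))) ℚ.+ (l ℚ.+ z)))) (ℚ.+-identityʳ u))
    (≡.trans (≡.cong (λ z → (g ℚ.+ (b ℚ.+ ((a ℚ.+ g) ℚ.+ (((ℚ.- b) ℚ.+ g) ℚ.+ g)))) ℚ.- z) (ℚ.+-identityˡ ((a ℚ.+ ((g ℚ.+ g) ℚ.+ (g ℚ.+ g))) ℚ.+ (l ℚ.+ u))))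
      (solve 5 (λ a b g l u → (g :+ (b :+ ((a :+ g) :+ (((:- b) :+ g) :+ g)))) :- ((a :+ ((g :+ g) :+ (g :+ g))) :+ (l :+ u)) := (:- u) :- l) ≡.refl a b g l u)))

-p+ε≤u⇒-u+ε≤p : ∀ {p ε u} → (ℚ.- p) ℚ.+ ε ℚ.≤ u → (ℚ.- u) ℚ.+ ε ℚ.≤ p
-p+ε≤u⇒-u+ε≤p {p} {ε} {u} h = by-≤ h (solve 3 (λ p ε u → u :- ((:- p) :+ ε) := p :- ((:- u) :+ ε)) ≡.refl p ε u)

neg-neg : ∀ p → ℚ.- (ℚ.- p) ≡ p
neg-neg = solve 1 (λ p → :- (:- p) := p) ≡.refl

-- The gap between a and b is at least G = 4g, and each rational end is moved inward by at most g,
-- so the ends stay in order. Both ends lie strictly inside, hence so does the limit of the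
-- bisection.
intermediate-value : ∀ f → LocallyLipschitz f → ∀ a b → a <ℝ b →
  Positive-below (λ n → ℚ.- f (approx a n)) → Positive-below (λ n → f (approx b n)) →
  Σ[ w ∈ ℝ ] (a <ℝ w × w <ℝ b × Null (f ∘ approx w))
intermediate-value f lip a b (G , 0<G , N , gap) neg (ε , 0<ε , pos) = go₁ (half 0<G)
  where
  Goal : Set
  Goal = Σ[ w ∈ ℝ ] (a <ℝ w × w <ℝ b × Null (f ∘ approx w))
  go₁ : Σ[ h ∈ ℚ ] (0ℚ ℚ.< h × h ℚ.+ h ≡ G) → Goal
  go₁ (h , 0<h , 2h≡G) = go₂ (half 0<h)
    where
    go₂ : Σ[ g ∈ ℚ ] (0ℚ ℚ.< g × g ℚ.+ g ≡ h) → Goal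
    go₂ (g , 0<g , 2g≡h) = go₃ (approach-right f lip a g 0<g neg)
      (approach-right (λ x → ℚ.- f (ℚ.- x)) (lipschitz-reflect {f} lip) (-ℝ b) g 0<g
        (ε , 0<ε , eventually (λ n ε≤ → ≡.subst (ε ℚ.≤_) (≡.sym (≡.trans (neg-neg (f (ℚ.- (ℚ.- approx b n)))) (≡.cong f (neg-neg (approx b n))))) ε≤) pos))
      where
      go₃ : RationalRightOf f a g → RationalRightOf (λ x → ℚ.- f (ℚ.- x)) (-ℝ b) g → Goal
      go₃ (l , (η , 0<η , a<l) , (N₁ , l≤) , fl≤0) (u , (θ , 0<θ , b<u) , (N₂ , u≤) , fu≤0) = limit
        , (η , 0<η , eventually (λ n a+η≤l → ℚ.≤-trans a+η≤l (l≤limit n)) a<l)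
        , (θ , 0<θ , eventually (λ n -b+θ≤u → ℚ.≤-trans (ℚ.+-monoˡ-≤ θ (limit≤u n)) (-p+ε≤u⇒-u+ε≤p {approx b n} {θ} {u} -b+θ≤u)) b<u)
        , f-limit
        where
        M = N ℕ.⊔ (N₁ ℕ.⊔ N₂)
        l<-u : l ℚ.< ℚ.- u
        l<-u = gap-< {approx a M} {approx b M} {g} {l} {u} 0<g (≡.subst (λ z → approx a M ℚ.+ z ℚ.≤ approx b M) (≡.sym (≡.trans (≡.cong₂ ℚ._+_ 2g≡h 2g≡h) 2h≡G)) (gap M (ℕ.m≤m⊔n N (N₁ ℕ.⊔ N₂))))
          (l≤ M (ℕ.≤-trans (ℕ.m≤m⊔n N₁ N₂) (ℕ.m≤n⊔m N (N₁ ℕ.⊔ N₂)))) (u≤ M (ℕ.≤-trans (ℕ.m≤n⊔m N₁ N₂) (ℕ.m≤n⊔m N (N₁ ℕ.⊔ N₂))))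
        open Bisection f lip l (ℚ.- u) l<-u fl≤0 (≡.subst (0ℚ ℚ.≤_) (neg-neg (f (ℚ.- u))) (ℚ.neg-antimono-≤ fu≤0))

-- Lipschitz constants of polynomials

module LipschitzEval where
  open Ring ℚ.+-*-rawRing using (eval)

  *-mono : ∀ {a b c d} → 0ℚ ℚ.≤ c → 0ℚ ℚ.≤ b → a ℚ.≤ b → c ℚ.≤ d → a ℚ.* c ℚ.≤ b ℚ.* d
  *-mono {a} {b} {c} {d} 0≤c 0≤b a≤b c≤d = ℚ.≤-trans (ℚ.*-monoʳ-≤-nonNeg c {{ℚ.nonNegative 0≤c}} a≤b) (ℚ.*-monoˡ-≤-nonNeg b {{ℚ.nonNegative 0≤b}} c≤d)

  *-nonneg : ∀ {a b} → 0ℚ ℚ.≤ a → 0ℚ ℚ.≤ b → 0ℚ ℚ.≤ a ℚ.* b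
  *-nonneg {a} {b} 0≤a 0≤b = ≡.subst (ℚ._≤ a ℚ.* b) (ℚ.*-zeroʳ a) (ℚ.*-monoˡ-≤-nonNeg a {{ℚ.nonNegative 0≤a}} 0≤b)

  Bound : List ℚ → ℚ → Set
  Bound p B = Σ[ S ∈ ℚ ] (0ℚ ℚ.≤ S × (∀ x → ℚ.∣ x ∣ ℚ.≤ B → ℚ.∣ eval p x ∣ ℚ.≤ S))

  eval-bound : ∀ p B → Bound p B
  eval-bound []      B = 0ℚ , ℚ.≤-refl , λ _ _ → ℚ.≤-refl
  eval-bound (c ∷ p) B = go (eval-bound p B)
    where
    go : Bound p B → Bound (c ∷ p) B
    go (S , 0≤S , bound) = ℚ.∣ c ∣ ℚ.+ ℚ.∣ B ∣ ℚ.* S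
      , ℚ.+-mono-≤ (ℚ.0≤∣p∣ c) (*-nonneg {ℚ.∣ B ∣} {S} (ℚ.0≤∣p∣ B) 0≤S)
      , λ x x≤B → ℚ.≤-trans (ℚ.∣p+q∣≤∣p∣+∣q∣ c (x ℚ.* eval p x)) (ℚ.+-monoʳ-≤ ℚ.∣ c ∣
          (ℚ.≤-trans (ℚ.≤-reflexive (ℚ.∣p*q∣≡∣p∣*∣q∣ x (eval p x)))
            (*-mono {ℚ.∣ x ∣} {ℚ.∣ B ∣} {ℚ.∣ eval p x ∣} {S} (ℚ.0≤∣p∣ (eval p x)) (ℚ.0≤∣p∣ B) (ℚ.≤-trans x≤B (p≤∣p∣ B)) (bound x x≤B))))

  LipschitzOn : (ℚ → ℚ) → ℚ → Set
  LipschitzOn f B = Σ[ K ∈ ℚ ] (0ℚ ℚ.< K × (∀ x y → ℚ.∣ x ∣ ℚ.≤ B → ℚ.∣ y ∣ ℚ.≤ B → ℚ.∣ f x ℚ.- f y ∣ ℚ.≤ K ℚ.* ℚ.∣ x ℚ.- y ∣))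

  eval-lipschitz : ∀ p → LocallyLipschitz (eval p)
  eval-lipschitz []      B = 1ℚ , ℚ.positive⁻¹ 1ℚ , λ x y _ _ → *-nonneg {1ℚ} {ℚ.∣ x ℚ.- y ∣} (ℚ.<⇒≤ (ℚ.positive⁻¹ 1ℚ)) (ℚ.0≤∣p∣ (x ℚ.- y))
  eval-lipschitz (c ∷ p) B = go 1ℚ (ℚ.positive⁻¹ 1ℚ) (eval-bound p B) (eval-lipschitz p B)
    where
    go : ∀ i → 0ℚ ℚ.< i → Bound p B → LipschitzOn (eval p) B → LipschitzOn (eval (c ∷ p)) B
    -- From x u - y v = x(u - v) + (x - y)v comes the constant M = |B| K + S; adding i, which is 1,
    -- makes it strictly positive even when M is 0.
    go i 0<i (S , 0≤S , sup) (K , 0<K , bound) = i ℚ.+ M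
      , ℚ.+-mono-<-≤ 0<i (ℚ.+-mono-≤ (*-nonneg {ℚ.∣ B ∣} {K} (ℚ.0≤∣p∣ B) (ℚ.<⇒≤ 0<K)) 0≤S)
      , λ x y x≤B y≤B → estimate x y (eval p x) (eval p y) (ℚ.≤-trans x≤B (p≤∣p∣ B)) (bound x y x≤B y≤B) (sup y y≤B)
      where
      M = ℚ.∣ B ∣ ℚ.* K ℚ.+ S
      estimate : ∀ x y u v → ℚ.∣ x ∣ ℚ.≤ ℚ.∣ B ∣ → ℚ.∣ u ℚ.- v ∣ ℚ.≤ K ℚ.* ℚ.∣ x ℚ.- y ∣ → ℚ.∣ v ∣ ℚ.≤ S →
        ℚ.∣ (c ℚ.+ x ℚ.* u) ℚ.- (c ℚ.+ y ℚ.* v) ∣ ℚ.≤ (i ℚ.+ M) ℚ.* ℚ.∣ x ℚ.- y ∣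
      estimate x y u v x≤ u-v≤ v≤ = begin
        ℚ.∣ (c ℚ.+ x ℚ.* u) ℚ.- (c ℚ.+ y ℚ.* v) ∣
          ≡⟨ ≡.cong ℚ.∣_∣ (solve 5 (λ c x y u v → (c :+ x :* u) :- (c :+ y :* v) := x :* (u :- v) :+ (x :- y) :* v) ≡.refl c x y u v) ⟩
        ℚ.∣ x ℚ.* (u ℚ.- v) ℚ.+ (x ℚ.- y) ℚ.* v ∣
          ≤⟨ ℚ.∣p+q∣≤∣p∣+∣q∣ (x ℚ.* (u ℚ.- v)) ((x ℚ.- y) ℚ.* v) ⟩
        ℚ.∣ x ℚ.* (u ℚ.- v) ∣ ℚ.+ ℚ.∣ (x ℚ.- y) ℚ.* v ∣
          ≡⟨ ≡.cong₂ ℚ._+_ (ℚ.∣p*q∣≡∣p∣*∣q∣ x (u ℚ.- v)) (ℚ.∣p*q∣≡∣p∣*∣q∣ (x ℚ.- y) v) ⟩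
        ℚ.∣ x ∣ ℚ.* ℚ.∣ u ℚ.- v ∣ ℚ.+ ℚ.∣ x ℚ.- y ∣ ℚ.* ℚ.∣ v ∣
          ≤⟨ ℚ.+-mono-≤
               (*-mono {ℚ.∣ x ∣} {ℚ.∣ B ∣} {ℚ.∣ u ℚ.- v ∣} {K ℚ.* ℚ.∣ x ℚ.- y ∣} (ℚ.0≤∣p∣ (u ℚ.- v)) (ℚ.0≤∣p∣ B) x≤ u-v≤)
               (*-mono {ℚ.∣ x ℚ.- y ∣} {ℚ.∣ x ℚ.- y ∣} {ℚ.∣ v ∣} {S} (ℚ.0≤∣p∣ v) (ℚ.0≤∣p∣ (x ℚ.- y)) ℚ.≤-refl v≤) ⟩
        ℚ.∣ B ∣ ℚ.* (K ℚ.* ℚ.∣ x ℚ.- y ∣) ℚ.+ ℚ.∣ x ℚ.- y ∣ ℚ.* S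
          ≡⟨ solve 4 (λ b k d s → b :* (k :* d) :+ d :* s := (b :* k :+ s) :* d) ≡.refl ℚ.∣ B ∣ K ℚ.∣ x ℚ.- y ∣ S ⟩
        M ℚ.* ℚ.∣ x ℚ.- y ∣
          ≤⟨ ℚ.*-monoʳ-≤-nonNeg ℚ.∣ x ℚ.- y ∣ {{ℚ.nonNegative (ℚ.0≤∣p∣ (x ℚ.- y))}}
               (≡.subst (ℚ._≤ i ℚ.+ M) (ℚ.+-identityˡ M) (ℚ.+-monoˡ-≤ M (ℚ.<⇒≤ 0<i))) ⟩
        (i ℚ.+ M) ℚ.* ℚ.∣ x ℚ.- y ∣ ∎
        where open ℚ.≤-Reasoning

-- Zeros at q = 1

Pos-isPositiveCone : IsPositiveCone ℝ-commutativeRing Pos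
Pos-isPositiveCone = record
  { resp         = λ {x} {y} → pos-resp {x} {y}
  ; +-pos        = λ {x} {y} → pos-+ {x} {y}
  ; *-pos        = λ {x} {y} → pos-* {x} {y}
  ; 1-pos        = pos-1
  ; cotransitive = pos-cotransitive
  ; cancel       = λ {x} {y} → pos-cancel {x} {y}
  ; archimedean  = archimedean
  }

ι : ℤ → ℝ
ι c = fromℚ (c ℚ./ 1)

open Sturm ℝ-commutativeRing Pos Pos-isPositiveCone using (Sign; sgn; Degree; leading; _∷_; _≺_; module Family)

binomial-positive : ∀ n k → k ≤ n → 1 ≤ n C k
binomial-positive n       zero    _         = ℕ.≤-refl
binomial-positive (suc n) (suc k) (s≤s k≤n) = ≡.subst (1 ≤_) (nCk+nC[k+1]≡[n+1]C[k+1] n k)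
  (ℕ.≤-trans (binomial-positive n k k≤n) (ℕ.m≤m+n (n C k) (n C suc k)))

leadingCoefficient : ℕ → ℤ
leadingCoefficient r = evenBinomial r ⌊ r /2⌋

-- A positive integer is at least 1, which provides the bound 2ℓ > 1 from which the sign near -∞ is
-- derived.
leadingCoefficient≥1 : ∀ r → 1ℚ ℚ.≤ leadingCoefficient r ℚ./ 1
leadingCoefficient≥1 r = go (r C (2 ℕ.* ⌊ r /2⌋)) (binomial-positive r (2 ℕ.* ⌊ r /2⌋)
  (≡.subst (_≤ r) (≡.cong (⌊ r /2⌋ ℕ.+_) (≡.sym (ℕ.+-identityʳ ⌊ r /2⌋))) (⌊n/2⌋+⌊n/2⌋≤n r)))
  where
  go : ∀ m → 1 ≤ m → 1ℚ ℚ.≤ (+ m) ℚ./ 1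
  go (suc m) _ = ≡.subst (1ℚ ℚ.≤_) (multiple-1 (suc m))
    (≡.subst (ℚ._≤ 1ℚ ℚ.+ multiple m 1ℚ) (ℚ.+-identityʳ 1ℚ) (ℚ.+-monoʳ-≤ 1ℚ (multiple-nonneg m (ℚ.<⇒≤ (ℚ.positive⁻¹ 1ℚ)))))

evenBinomials-degree : ∀ r → Degree (ι (leadingCoefficient r)) ⌊ r /2⌋ (map ι (evenBinomials r))
evenBinomials-degree r = ≡.subst (λ p → Degree (ι (leadingCoefficient r)) ⌊ r /2⌋ (map ι p))
  (≡.sym (List.map-upTo (evenBinomial r) (suc ⌊ r /2⌋))) (go ⌊ r /2⌋ (evenBinomial r))
  where
  go : ∀ d (c : ℕ → ℤ) → Degree (ι (c d)) d (map ι (applyUpTo c (suc d)))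
  go zero    c = leading (≈ℝ-refl {ι (c 0)})
  go (suc d) c = ι (c 0) ∷ go d (c ∘ suc)

ι-cong : ∀ {a b} → a ≡ b → ι a ≈ℝ ι b
ι-cong {a} ≡.refl = ≈ℝ-refl {ι a}

ι-+ : ∀ a b → ι (a ℤ.+ b) ≈ℝ (ι a +ℝ ι b)
ι-+ a b = pointwise (ι (a ℤ.+ b)) (ι a +ℝ ι b) (λ _ → /1-+ a b)

module EvaluateAt (x : ℝ) = Evaluation ℤ-commutativeRing ℝ-commutativeRing ι ι-cong (≈ℝ-refl {0ℝ}) ι-+ x

module _ where
  open Ring ℚ.+-*-rawRing using (eval)

  -- Real operations act termwise on approximations, so evaluating at a real is evaluating at each
  -- of its rational approximations; this brings the rational bisection to bear on real polynomials.
  approx-eval : ∀ (p : Poly₁) x n → approx (evalℝ p x) n ≡ eval (map (ℚ._/ 1) p) (approx x n)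
  approx-eval []      x n = ≡.refl
  approx-eval (c ∷ p) x n = ≡.cong (λ u → (c ℚ./ 1) ℚ.+ approx x n ℚ.* u) (approx-eval p x n)

  sgnℚ : ℕ → ℚ → ℚ
  sgnℚ zero    u = u
  sgnℚ (suc j) u = ℚ.- sgnℚ j u

  approx-sgn : ∀ j x n → approx (sgn j x) n ≡ sgnℚ j (approx x n)
  approx-sgn zero    x n = ≡.refl
  approx-sgn (suc j) x n = ≡.cong ℚ.-_ (approx-sgn j x n)

  lipschitz-neg : ∀ {f} → LocallyLipschitz f → LocallyLipschitz (λ u → ℚ.- f u)
  lipschitz-neg {f} lip B = proj₁ (lip B) , proj₁ (proj₂ (lip B)) , λ u v u≤B v≤B →
    ≡.subst (ℚ._≤ proj₁ (lip B) ℚ.* ℚ.∣ u ℚ.- v ∣)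
      (≡.trans (≡.sym (ℚ.∣-p∣≡∣p∣ (f u ℚ.- f v))) (≡.cong ℚ.∣_∣ (ℚ.neg-distrib-+ (f u) (ℚ.- f v))))
      (proj₂ (proj₂ (lip B)) u v u≤B v≤B)

  lipschitz-sgn : ∀ j {f} → LocallyLipschitz f → LocallyLipschitz (sgnℚ j ∘ f)
  lipschitz-sgn zero    {f} lip = lip
  lipschitz-sgn (suc j) {f} lip = lipschitz-neg {sgnℚ j ∘ f} (lipschitz-sgn j {f} lip)

  null-sgn : ∀ j {u : ℕ → ℚ} → Null (sgnℚ j ∘ u) → Null u
  null-sgn zero    u-null = u-null
  null-sgn (suc j) {u} u-null = null-sgn j (null-≡ (λ n → neg-neg (sgnℚ j (u n))) (null-neg u-null))

  polynomial-intermediate-value : ∀ (p : Poly₁) j {x y} → x ≺ y → Sign (suc j) (evalℝ p x) → Sign j (evalℝ p y) →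
    Σ[ w ∈ ℝ ] (x ≺ w × w ≺ y × evalℝ p w ≈ℝ 0ℝ)
  polynomial-intermediate-value p j {x} {y} x≺y (ε , 0<ε , at-x) (δ , 0<δ , at-y) = go
    (intermediate-value f (lipschitz-sgn j {eval (map (ℚ._/ 1) p)} (LipschitzEval.eval-lipschitz (map (ℚ._/ 1) p))) x y (Pos⇒<ℝ {x} {y} x≺y)
      (ε , 0<ε , eventually (λ n → ≡.subst (ε ℚ.≤_) (≡.cong ℚ.-_ (value x n))) at-x)
      (δ , 0<δ , eventually (λ n → ≡.subst (δ ℚ.≤_) (value y n)) at-y))
    where
    f : ℚ → ℚ
    -- The factor (-1)^j reduces either sign pattern to a passage from negative to positive.
    f = sgnℚ j ∘ eval (map (ℚ._/ 1) p)
    value : ∀ x n → approx (sgn j (evalℝ p x)) n ≡ f (approx x n)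
    value x n = ≡.trans (approx-sgn j (evalℝ p x) n) (≡.cong (sgnℚ j) (approx-eval p x n))
    go : Σ[ w ∈ ℝ ] (x <ℝ w × w <ℝ y × Null (f ∘ approx w)) → Σ[ w ∈ ℝ ] (x ≺ w × w ≺ y × evalℝ p w ≈ℝ 0ℝ)
    go (w , x<w , w<y , fw-null) = w , <ℝ⇒Pos {x} {w} x<w , <ℝ⇒Pos {w} {y} w<y
      , null-≡ (λ n → ≡.sym (≡.trans (ℚ.+-identityʳ (approx (evalℝ p w) n)) (approx-eval p w n))) (null-sgn j fw-null)

fromℚ-pos : ∀ {p} → 0ℚ ℚ.< p → Pos (fromℚ p)
fromℚ-pos {p} 0<p = p , 0<p , always (λ _ → ℚ.≤-refl)

eval-1 : ∀ {p} → p ≡ 1ℤ ∷ [] → ∀ x → evalℝ p x ≈ℝ fromℚ 1ℚ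
eval-1 ≡.refl x = pointwise (evalℝ (1ℤ ∷ []) x) (fromℚ 1ℚ)
  (λ n → ≡.trans (≡.cong (1ℚ ℚ.+_) (ℚ.*-zeroʳ (approx x n))) (ℚ.+-identityʳ 1ℚ))

module RealZeros (B : ℕ → Poly₁) (B-0 : B 0 ≡ 1ℤ ∷ []) (B-1 : B 1 ≡ 1ℤ ∷ [])
  (B-rec : ∀ r → RawRing._+_ ℤ[x] (B (2 ℕ.+ r)) (B r) ≈₁
    RawRing._+_ ℤ[x] (RawRing._+_ ℤ[x] (B (1 ℕ.+ r)) (B (1 ℕ.+ r))) (RawRing._*_ ℤ[x] q (B r)))
  (ℓ : ℕ → ℚ) (1≤ℓ : ∀ r → 1ℚ ℚ.≤ ℓ r) (B-degree : ∀ r → Degree (fromℚ (ℓ r)) ⌊ r /2⌋ (map ι (B r))) where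

  eval-rec : ∀ r x → (evalℝ (B (2 ℕ.+ r)) x +ℝ evalℝ (B r) x) ≈ℝ
    ((evalℝ (B (1 ℕ.+ r)) x +ℝ evalℝ (B (1 ℕ.+ r)) x) +ℝ (x *ℝ evalℝ (B r) x))
  eval-rec r x = begin
    ev (B (2 ℕ.+ r)) +ℝ ev (B r)                                  ≈⟨ ≈ℝ-sym {ev (B (2 ℕ.+ r) + B r)} {ev (B (2 ℕ.+ r)) +ℝ ev (B r)} (evaluate-+ (B (2 ℕ.+ r)) (B r)) ⟩
    ev (B (2 ℕ.+ r) + B r)                                        ≈⟨ evaluate-cong (B (2 ℕ.+ r) + B r) (B (1 ℕ.+ r) + B (1 ℕ.+ r) + q * B r) (B-rec r) ⟩
    ev (B (1 ℕ.+ r) + B (1 ℕ.+ r) + q * B r)                      ≈⟨ evaluate-+ (B (1 ℕ.+ r) + B (1 ℕ.+ r)) (q * B r) ⟩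
    ev (B (1 ℕ.+ r) + B (1 ℕ.+ r)) +ℝ ev (q * B r)
      ≈⟨ +ℝ-cong {ev (B (1 ℕ.+ r) + B (1 ℕ.+ r))} {ev (B (1 ℕ.+ r)) +ℝ ev (B (1 ℕ.+ r))} {ev (q * B r)} {x *ℝ ev (B r)}
           (evaluate-+ (B (1 ℕ.+ r)) (B (1 ℕ.+ r))) (evaluate-X* (B r)) ⟩
    (ev (B (1 ℕ.+ r)) +ℝ ev (B (1 ℕ.+ r))) +ℝ (x *ℝ ev (B r))     ∎
    where
    open EvaluateAt x
    open RawRing ℤ[x] using (_+_; _*_)
    open import Relation.Binary.Reasoning.Setoid (CommutativeRing.setoid ℝ-commutativeRing)
    ev = evaluate

  ℓ-pos : ∀ r → Pos (fromℚ (ℓ r))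
  ℓ-pos r = fromℚ-pos (ℚ.<-≤-trans (ℚ.positive⁻¹ 1ℚ) (1≤ℓ r))

  2ℓ>1 : ∀ r → Pos ((fromℚ (ℓ r) +ℝ fromℚ (ℓ r)) +ℝ (-ℝ fromℚ 1ℚ))
  2ℓ>1 r = (ℓ r ℚ.+ ℓ r) ℚ.+ ℚ.- 1ℚ
    , ≡.subst (0ℚ ℚ.<_) (≡.sym (ℚ.+-assoc (ℓ r) (ℓ r) (ℚ.- 1ℚ))) (ℚ.+-mono-<-≤ (ℚ.<-≤-trans (ℚ.positive⁻¹ 1ℚ) (1≤ℓ r))
        (≡.subst (ℚ._≤ ℓ r ℚ.+ ℚ.- 1ℚ) (ℚ.+-inverseʳ 1ℚ) (ℚ.+-monoˡ-≤ (ℚ.- 1ℚ) (1≤ℓ r))))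
    , always (λ _ → ℚ.≤-refl)

  open Family (map ι ∘ B) (fromℚ ∘ ℓ) B-degree ℓ-pos 2ℓ>1 (eval-1 B-0) (eval-1 B-1) eval-rec
    (λ r j {x} {y} → polynomial-intermediate-value (B r) j {x} {y})

  module _ (n : ℕ) where
    open Zeros (all-zeros n) using (z; negative; decreasing; zeros)

    z-negative : ∀ i → i < ⌊ suc n /2⌋ → z i <ℝ 0ℝ
    z-negative i i<d = Pos⇒<ℝ {z i} {0ℝ} (negative i i<d)

    z-decreasing : ∀ i j → i < j → j < ⌊ suc n /2⌋ → z j <ℝ z i
    z-decreasing i j i<j j<d = Pos⇒<ℝ {z j} {z i} (decreasing i j i<j j<d)

    z-apart : ∀ i j → i < ⌊ suc n /2⌋ → j < ⌊ suc n /2⌋ → i ≢ j → z i # z j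
    z-apart i j i<d j<d i≢j = go (ℕ.<-cmp i j)
      where
      go : Tri (i < j) (i ≡ j) (j < i) → z i # z j
      go (tri< i<j _ _) = inj₂ (z-decreasing i j i<j j<d)
      go (tri≈ _ i≡j _) = contradiction i≡j i≢j
      go (tri> _ _ j<i) = inj₁ (z-decreasing j i j<i i<d)

    module _ (p : Poly₁) (p≈ : p ≈₁ B (suc n)) (1≤d : 1 ≤ ⌊ suc n /2⌋) where
      eval≈ : ∀ x → evalℝ p x ≈ℝ evalℝ (B (suc n)) x
      eval≈ x = EvaluateAt.evaluate-cong x p (B (suc n)) p≈

      z-zero : ∀ i → i < ⌊ suc n /2⌋ → evalℝ p (z i) ≈ℝ 0ℝ
      z-zero i i<d = ≈ℝ-trans {evalℝ p (z i)} {evalℝ (B (suc n)) (z i)} {0ℝ} (eval≈ (z i)) (zeros i i<d)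

      z-complete : ∀ x → evalℝ p x ≈ℝ 0ℝ → ∃[ i ] (i < ⌊ suc n /2⌋ × x ≈ℝ z i)
      z-complete x px≈0 = complete n 1≤d x (≈ℝ-trans {evalℝ (B (suc n)) x} {evalℝ p x} {0ℝ} (≈ℝ-sym {evalℝ p x} {evalℝ (B (suc n)) x} (eval≈ x)) px≈0)

      distinct-negative-zeros : ExactlyDistinctNegativeZeros ⌊ suc n /2⌋ p
      distinct-negative-zeros = (λ i → z (toℕ i))
        , (λ i → z-negative (toℕ i) (Fin.toℕ<n i) , z-zero (toℕ i) (Fin.toℕ<n i))
        , (λ i j i≢j → z-apart (toℕ i) (toℕ j) (Fin.toℕ<n i) (Fin.toℕ<n j) (λ eq → i≢j (Fin.toℕ-injective eq)))
        , λ x (_ , px≈0) → go x (z-complete x px≈0)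
        where
        go : ∀ x → ∃[ i ] (i < ⌊ suc n /2⌋ × x ≈ℝ z i) → ∃[ i ] x ≈ℝ z (toℕ i)
        go x (i , i<d , x≈zi) = fromℕ< i<d , ≡.subst (λ k → x ≈ℝ z k) (≡.sym (Fin.toℕ-fromℕ< i<d)) x≈zi

open RealZeros evenBinomials ≡.refl ≡.refl evenBinomials-rec (λ r → leadingCoefficient r ℚ./ 1) leadingCoefficient≥1 evenBinomials-degree
  using (distinct-negative-zeros)

corollary5p6 : (r : ℕ) .{{_ : NonZero r}} →
    Σ[ ℍ ∈ Poly₂ ]
    ( IsNumerator (rootPoset r) ℍ
    × (∀ ℍ′ → IsNumerator (rootPoset r) ℍ′ → ℍ′ ≈₂ ℍ)
    × ℍ ≈₂ wordPolynomial (r ∸ 1)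
    × CoefficientwiseNonnegative ℍ
    × (∀ k → 1 ≤ k → k ≤ ⌊ r /2⌋ → [t^ k ] ℍ ≈₁ gaussianFormula r k)
    × (∀ k → ⌊ r /2⌋ < k → [t^ k ] ℍ ≈₁ RawRing.0# ℤ[x])
    × [t^ 0 ] ℍ ≈₁ RawRing.1# ℤ[x]
    × at-q≡1 ℍ ≈₁ evenBinomialPolynomial r
    × two ·₁ substitute-square (at-q≡1 ℍ) ≈₁ conjugatePowers r
    × (2 ≤ r → ExactlyDistinctNegativeZeros ⌊ r /2⌋ (at-q≡1 ℍ)) )
corollary5p6 (suc n) = ℍ
  , wordPolynomial-isNumerator n
  -- The defining identity prescribes each coefficient of a numerator outright, so any two agree by
  -- transitivity.
  , (λ ℍ′ numerator′ k m → ≡.trans (≡.sym (numerator′ k m)) (wordPolynomial-isNumerator n k m))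
  , (λ _ _ → ≡.refl)
  , wordPolynomial-nonnegative n
  , coefficient-formula n
  , coefficient-vanish n
  , coefficient-constant n
  , (λ k → ≡.trans (at-q≡1≈evenBinomials n k) (≡.sym (evenBinomialPolynomial≈evenBinomials (suc n) k)))
  , (λ k → ≡.trans
      (CommutativeRing.*-congˡ ℤ[x]-commutativeRing {two} {substitute-square (at-q≡1 ℍ)} {substitute-square (evenBinomials (suc n))}
        (SubstituteSquare.evaluate-cong (at-q≡1 ℍ) (evenBinomials (suc n)) (at-q≡1≈evenBinomials n)) k)
      (substitute-square≈conjugatePowers (suc n) k))
  , λ { (s≤s 1≤n) → distinct-negative-zeros n (at-q≡1 ℍ) (at-q≡1≈evenBinomials n) (ℕ.⌊n/2⌋-mono (s≤s 1≤n)) }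
  where
  ℍ : Poly₂
  ℍ = wordPolynomial n
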